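{- Fix any constant $c\in(0,1/5)$. Then there is $\varepsilon_0=\varepsilon_0(c)>0$ such that for every $0<\varepsilon<\varepsilon_0$ there exists $n_0\in\mathbb{N}$ such that the following holds for all integers $n,s$ with $n\ge n_0$ and $cn\le s\le n/5$. If $G$ is a stable $4$-graph on $[n]$ with $\nu(G)\le s$ and $e(G)\ge \binom{n}{4}-\binom{n-s}{4}-\varepsilon n^4$, then $G$ is $400\varepsilon^{1/4}$-close to $H_1$.
   Context: A $k$-graph on $[n]=\{1,\dots,n\}$ is a family of $k$-element subsets (edges) of $[n]$; $e(G)$ is its number of edges and $\nu(G)$ its matching number (maximum number of pairwise disjoint edges). A $k$-graph $G$ on $[n]$ is stable if for every edge $\{a_1,\dots,a_k\}\in E(G)$ and every $\{b_1,\dots,b_k\}\in\binom{[n]}{k}$ with $b_i\le a_i$ for all $i$, also $\{b_1,\dots,b_k\}\in E(G)$. For two $k$-graphs $G,H$ on the same $n$-element vertex set and $\varepsilon>0$, $G$ is $\varepsilon$-close to $H$ if $|E(H)\setminus E(G)|<\varepsilon n^k$. Here $H_1$ is the $4$-graph on $[n]$ whose edges are all $e\in\binom{[n]}{4}$ with $e\cap[s]\neq\emptyset$.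
   Formalization: The constant c and the parameter ε range over rational numbers instead of real numbers; closeness with 400ε^{1/4} is stated in the equivalent form |E(H₁)∖E(G)|⁴ < 400⁴ ε n¹⁶. -}

module Defs where

open import Data.Nat as ℕ using (ℕ; _^_; _∸_)
open import Data.Nat.Combinatorics using (_C_)
open import Data.Bool using (Bool; true; false; _∧_; not; T)
open import Data.Fin using (Fin; toℕ)
open import Data.Fin.Properties using (_<?_)
open import Data.List using (List; []; _∷_; length; filter; concatMap; map; allFin)
open import Data.List.Relation.Unary.All using (All)
open import Data.List.Relation.Unary.AllPairs using (AllPairs)
open import Data.Product using (_×_; _,_)
open import Data.Integer using (+_)
open import Data.Rational as ℚ using (ℚ; _/_)
open import Data.Vec.Functional using (Vector)
open import Relation.Binary.PropositionalEquality using (_≡_; _≢_)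
open import Relation.Nullary.Decidable using (_×-dec_)
open import Data.Fin using () renaming (_<_ to _<ᶠ_; _≤_ to _≤ᶠ_)

-- Vertex set [n] is represented by Fin n (vertex i+1 of the paper is i : Fin n).
-- A candidate 4-edge is a quadruple of vertices; a 4-set {a1<a2<a3<a4}
-- is represented by its unique strictly increasing listing.
Quad : ℕ → Set
Quad n = Fin n × Fin n × Fin n × Fin n

Increasing : ∀ {n} → Quad n → Set
Increasing (a , b , c , d) = (a <ᶠ b) × (b <ᶠ c) × (c <ᶠ d)

allQuads : (n : ℕ) → List (Quad n)
allQuads n =
  concatMap (λ a → concatMap (λ b → concatMap (λ c → map (λ d → (a , b , c , d))
    (allFin n)) (allFin n)) (allFin n))
    (allFin n)

fourSets : (n : ℕ) → List (Quad n)
fourSets n = filter (λ { (a , b , c , d) → (a <? b) ×-dec ((b <? c) ×-dec (c <? d)) }) (allQuads n)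

-- A 4-graph on [n]: its edges are the 4-sets (increasing quadruples q) with G q ≡ true.
-- (The value of G on non-increasing quadruples is irrelevant.)
FourGraph : ℕ → Set
FourGraph n = Quad n → Bool

edges : ∀ {n} → FourGraph n → ℕ
edges {n} G = length (filter (λ q → Data.Bool._≟_ (G q) true) (fourSets n))
  where import Data.Bool

missing : ∀ {n} → FourGraph n → FourGraph n → ℕ
missing {n} G H = length (filter (λ q → Data.Bool._≟_ (H q ∧ not (G q)) true) (fourSets n))
  where import Data.Bool

IsEdge : ∀ {n} → FourGraph n → Quad n → Set
IsEdge G q = Increasing q × (G q ≡ true)

Stable : ∀ {n} → FourGraph n → Set
Stable {n} G = ∀ (a b : Quad n) → IsEdge G a → Increasing b →
  let (a₁ , a₂ , a₃ , a₄) = a ; (b₁ , b₂ , b₃ , b₄) = b in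
  b₁ ≤ᶠ a₁ → b₂ ≤ᶠ a₂ → b₃ ≤ᶠ a₃ → b₄ ≤ᶠ a₄ → IsEdge G b

_∈q_ : ∀ {n} → Fin n → Quad n → Set
x ∈q (a , b , c , d) = (x ≡ a) Data.Sum.⊎ (x ≡ b) Data.Sum.⊎ (x ≡ c) Data.Sum.⊎ (x ≡ d)
  where import Data.Sum

Disjoint : ∀ {n} → Quad n → Quad n → Set
Disjoint q r = ∀ x → x ∈q q → x ∈q r → Data.Empty.⊥
  where import Data.Empty

IsMatching : ∀ {n} → FourGraph n → List (Quad n) → Set
IsMatching G M = All (IsEdge G) M × AllPairs Disjoint M

MatchingNumberAtMost : ∀ {n} → FourGraph n → ℕ → Set
MatchingNumberAtMost G s = ∀ M → IsMatching G M → length M ℕ.≤ s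

H₁ : (n s : ℕ) → FourGraph n
H₁ n s (a , b , c , d) = lt a Data.Bool.∨ lt b Data.Bool.∨ lt c Data.Bool.∨ lt d
  where
    import Data.Bool
    lt : Fin n → Bool
    lt x = toℕ x ℕ.<ᵇ s

ℕ→ℚ : ℕ → ℚ
ℕ→ℚ k = (+ k) / 1

-- G is δ-close to H for δ = 400·ε^{1/4} (ε > 0):
--   |E(H)\E(G)| < 400 ε^{1/4} n^4   ⇔   |E(H)\E(G)|^4 < 400^4 · ε · n^16
-- (both sides nonnegative, x ↦ x^4 strictly increasing on [0,∞)).
Close400 : (ε : ℚ) (n : ℕ) → FourGraph n → FourGraph n → Set
Close400 ε n G H = ℕ→ℚ (missing G H ^ 4) ℚ.< ℕ→ℚ (400 ^ 4 ℕ.* n ^ 16) ℚ.* ε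

{-# OPTIONS --safe #-}
module Submission where

open import Defs
open import Data.Nat as ℕ using (ℕ; zero; suc; _+_; _*_; _∸_; _^_; _⊔_; _⊔′_; _!; _≤_; _<_; _<ᵇ_; _≤?_; _<?_; z≤n; s≤s; s≤s⁻¹; NonZero; >-nonZero)
open import Data.Nat.Combinatorics using (_C_; nCk+nC[k+1]≡[n+1]C[k+1]; nC1≡n)
open import Data.Nat.Coprimality as Coprimality using (Coprime; 1-coprimeTo)
open import Data.Nat.DivMod using (m/n*n≤m; m<n*o⇒m/o<n; m≡m%n+[m/n]*n; m%n<n)
open import Data.Nat.ListAction using (sum)
open import Data.Nat.ListAction.Properties using (sum-++)
open import Data.Nat.Properties
open import Data.Nat.Tactic.RingSolver using (solve-∀)
import Data.Integer as ℤ
import Data.Integer.Properties as ℤ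
open import Data.Rational as ℚ using (ℚ; mkℚ; _/_; 0ℚ; 1ℚ; toℚᵘ)
import Data.Rational.Properties as ℚ
open import Data.Rational.Unnormalised as ℚᵘ using (mkℚᵘ; *≡*)
import Data.Rational.Unnormalised.Properties as ℚᵘ
open import Data.Bool using (Bool; true; false; _∧_; not; T) renaming (_≟_ to _≟ᵇ_)
open import Data.Bool.Properties using (∧-zeroʳ)
open import Data.Empty using (⊥; ⊥-elim)
open import Data.Unit using (tt)
open import Data.Product using (Σ; ∃; _×_; _,_; proj₁; proj₂)
open import Data.Sum using (_⊎_; inj₁; inj₂)
open import Data.Fin as Fin using (Fin; toℕ; fromℕ<)
import Data.Fin.Properties as Fin
open import Data.List using (List; []; _∷_; _++_; length; map; filter; concatMap; allFin; tabulate)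
open import Data.List.Properties using (map-++; map-∘; map-tabulate)
open import Data.List.Relation.Unary.All as All using (All; []; _∷_)
open import Data.List.Relation.Unary.AllPairs using ([]; _∷_)
open import Data.List.Relation.Unary.Any using (Any; any?; satisfied)
open import Relation.Binary using (tri<; tri≈; tri>)
open import Relation.Binary.PropositionalEquality
open import Relation.Nullary using (Dec; yes; no; ¬_)
open import Relation.Nullary.Decidable using (_×-dec_; _→-dec_; toWitness)
open import Relation.Unary using (Pred; Decidable)

-- Rational weights replace matchings: repeatedly adding an edge that does not increase the
-- weighted excess over prescribed loads (Blackwell's approachability) either produces, by
-- stability, a matching of size s + 1, or stops at a fractional vertex cover w of total
-- weight about s in units of Y, every edge having weight at least Y.
--
-- Let T be the s heaviest vertices, R the others, Y − D the smallest weight on T. The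
-- deficits Y − w(t) on T add up to at least the weight of R, and a 4-set {t} ∪ B with
-- B ⊂ R is missing from G whenever w(B) < Y − w(t). It suffices to show that these missing
-- sets outnumber, by a factor 1.01, the 4-subsets of R of weight at least Y, since the
-- density hypothesis says that |H₁ ∖ G| exceeds |G ∖ H₁| by at most ε n⁴. Because |R| ≥ 4 s,
-- this follows by averaging over T (padded by vertices of deficit 0) once
--   P(S₄ ≥ Y) + P(S₃ ≥ δ) ≤ 1 + (3.96 μ − δ) / D      for all 0 ≤ δ ≤ D,
-- where S₃ and S₄ are sums of independent weights from R, which are at most Y − D and have
-- mean μ ≤ D / 4. For D + δ ≤ 0.99 Y, or 4 (Y − D) < Y, this is the expectation of a
-- pointwise linear inequality. Otherwise (D / Y , δ / D) lies in one of finitely many cells;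
-- on each of them the indicators are dominated by a convex function of S₄, whose expectation
-- is largest for weights 0 and Y − D, and a numerical check remains.


-- With a factor 1 in place of 1.01 nothing would follow, since H₁ could lose many sets and G gain
-- as many outside it. With 1.01 the two comparisons leave at most 102 ε n⁴ missing sets for large
-- n. For ε < 1 this is below 400 times the fourth root of ε times n⁴, so `ε₀` can be 1. The one
-- percent comes from a first moment: 4 μ is the mean of S₄, and 3.96 μ is 99 percent of it.
-- Markov's inequality exchanges the saved part of the mean for one percent of P(S₄ ≥ Y).
-- Approachability stands in for linear programming duality. It is a finite search over natural
-- numbers, and the cover it leaves is a nonnegative combination of initial segments. Hence the
-- weights decrease along the vertices, and up to a shift the s heaviest vertices are the first s,
-- as the definition of H₁ wants. The price is a rounding to blocks of b vertices and a shift by 2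
-- b, which cost errors of order b n³. The linear argument stops where it does because at S₄ = Y
-- both indicators may hold, and the line is too low there once D + δ exceeds 0.99 Y.

-- Finite sums and indicators

∑ : ℕ → (ℕ → ℕ) → ℕ
∑ zero    f = 0
∑ (suc n) f = ∑ n f + f n

∑-cong : ∀ n {f g} → (∀ i → i < n → f i ≡ g i) → ∑ n f ≡ ∑ n g
∑-cong zero    h = refl
∑-cong (suc n) h = cong₂ _+_ (∑-cong n (λ i p → h i (m<n⇒m<1+n p))) (h n (n<1+n n))

∑-mono : ∀ n {f g} → (∀ i → i < n → f i ≤ g i) → ∑ n f ≤ ∑ n g
∑-mono zero    h = z≤n
∑-mono (suc n) h = +-mono-≤ (∑-mono n (λ i p → h i (m<n⇒m<1+n p))) (h n (n<1+n n))

∑-+ : ∀ n f g → ∑ n (λ i → f i + g i) ≡ ∑ n f + ∑ n g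
∑-+ zero    f g = refl
∑-+ (suc n) f g = trans (cong (_+ (f n + g n)) (∑-+ n f g)) (lem (∑ n f) (∑ n g) (f n) (g n))
  where
  lem : ∀ a b c d → (a + b) + (c + d) ≡ (a + c) + (b + d)
  lem = solve-∀

∑-*ˡ : ∀ n c f → ∑ n (λ i → c * f i) ≡ c * ∑ n f
∑-*ˡ zero    c f = sym (*-zeroʳ c)
∑-*ˡ (suc n) c f = trans (cong (_+ c * f n) (∑-*ˡ n c f)) (sym (*-distribˡ-+ c (∑ n f) (f n)))

∑-*ʳ : ∀ n c f → ∑ n (λ i → f i * c) ≡ ∑ n f * c
∑-*ʳ zero    c f = refl
∑-*ʳ (suc n) c f = trans (cong (_+ f n * c) (∑-*ʳ n c f)) (sym (*-distribʳ-+ c (∑ n f) (f n)))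

∑-const : ∀ n c → ∑ n (λ _ → c) ≡ n * c
∑-const zero    c = refl
∑-const (suc n) c = trans (cong (_+ c) (∑-const n c)) (+-comm (n * c) c)

∑-zero : ∀ n → ∑ n (λ _ → 0) ≡ 0
∑-zero n = trans (∑-const n 0) (*-zeroʳ n)

∑-swap : ∀ m n (f : ℕ → ℕ → ℕ) → ∑ m (λ i → ∑ n (λ j → f i j)) ≡ ∑ n (λ j → ∑ m (λ i → f i j))
∑-swap zero    n f = sym (∑-zero n)
∑-swap (suc m) n f = trans (cong (_+ ∑ n (f m)) (∑-swap m n f)) (sym (∑-+ n (λ j → ∑ m (λ i → f i j)) (f m)))

∑-split : ∀ m n f → ∑ (m + n) f ≡ ∑ m f + ∑ n (λ i → f (m + i))
∑-split m zero    f = trans (cong (λ k → ∑ k f) (+-identityʳ m)) (sym (+-identityʳ _))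
∑-split m (suc n) f = trans (cong (λ k → ∑ k f) (+-suc m n))
  (trans (cong (_+ f (m + n)) (∑-split m n f)) (+-assoc (∑ m f) _ _))

∑-front : ∀ n f → ∑ (suc n) f ≡ f 0 + ∑ n (λ i → f (suc i))
∑-front n f = ∑-split 1 n f

∑-mono-range : ∀ {m n} → m ≤ n → ∀ f → ∑ m f ≤ ∑ n f
∑-mono-range {m} {n} m≤n f = subst (λ k → ∑ m f ≤ ∑ k f) (m+[n∸m]≡n m≤n)
  (≤-trans (m≤m+n _ _) (≤-reflexive (sym (∑-split m (n ∸ m) f))))

∑-≤const : ∀ n {f} c → (∀ i → i < n → f i ≤ c) → ∑ n f ≤ n * c
∑-≤const n c h = ≤-trans (∑-mono n h) (≤-reflexive (∑-const n c))

term≤∑ : ∀ {n i} f → i < n → f i ≤ ∑ n f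
term≤∑ {n} {i} f i<n = ≤-trans (m≤n+m (f i) (∑ i f)) (∑-mono-range i<n f)

⟦_⟧ : ∀ {a} {A : Set a} → Dec A → ℕ
⟦ yes _ ⟧ = 1
⟦ no _ ⟧ = 0

⟦⟧≤1 : ∀ {a} {A : Set a} (d : Dec A) → ⟦ d ⟧ ≤ 1
⟦⟧≤1 (yes _) = ≤-refl
⟦⟧≤1 (no _)  = z≤n

⟦⟧-yes : ∀ {a} {A : Set a} (d : Dec A) → A → ⟦ d ⟧ ≡ 1
⟦⟧-yes (yes _) _ = refl
⟦⟧-yes (no ¬a) a = ⊥-elim (¬a a)

⟦⟧-no : ∀ {a} {A : Set a} (d : Dec A) → ¬ A → ⟦ d ⟧ ≡ 0
⟦⟧-no (yes a) ¬a = ⊥-elim (¬a a)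
⟦⟧-no (no _)  _  = refl

⟦⟧-mono : ∀ {a b} {A : Set a} {B : Set b} (d : Dec A) (e : Dec B) → (A → B) → ⟦ d ⟧ ≤ ⟦ e ⟧
⟦⟧-mono (yes a) e f = ≤-reflexive (sym (⟦⟧-yes e (f a)))
⟦⟧-mono (no _)  e f = z≤n

-- Ordered tuples and subsets of the weights

module Tuples (r : ℕ → ℕ) where

  tuples : ℕ → ℕ → (ℕ → ℕ) → ℕ → ℕ
  tuples n zero    F z = F z
  tuples n (suc k) F z = ∑ n (λ i → tuples n k F (z + r i))

  -- Each set is listed from its largest index downwards, the order in which `chains` nests its
  -- sums.
  subsets : ℕ → ℕ → (ℕ → ℕ) → ℕ → ℕ
  subsets n zero    F z = F z
  subsets n (suc k) F z = ∑ n (λ i → subsets i k F (z + r i))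

  tuples-mono-range : ∀ {m n} → m ≤ n → ∀ k F z → tuples m k F z ≤ tuples n k F z
  tuples-mono-range m≤n zero    F z = ≤-refl
  tuples-mono-range {m} {n} m≤n (suc k) F z = ≤-trans
    (∑-mono m (λ i _ → tuples-mono-range m≤n k F (z + r i)))
    (∑-mono-range m≤n _)

  -- Among the tuples over `suc n` indices are those that use the new index `n` exactly once, in one
  -- of `suc k` positions, and those that never use it; the rest are dropped.
  tuples-suc : ∀ n k F z →
    suc k * tuples n k F (z + r n) + tuples n (suc k) F z ≤ tuples (suc n) (suc k) F z
  tuples-suc n zero F z = ≤-reflexive (lem (F (z + r n)) (∑ n (λ i → F (z + r i))))
    where
    lem : ∀ a b → 1 * a + b ≡ b + a
    lem = solve-∀
  tuples-suc n (suc k) F z = begin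
    suc (suc k) * A + B
      ≡⟨ lem (suc k) A B ⟩
    (suc k * A + B) + A
      ≡⟨ cong (λ x → (x + B) + A) (trans (sym (∑-*ˡ n (suc k) (λ i → tuples n k F (z + r n + r i))))
           (∑-cong n (λ i _ → cong (λ x → suc k * tuples n k F x) (comm z (r n) (r i))))) ⟩
    (∑ n (λ i → suc k * tuples n k F (z + r i + r n)) + B) + A
      ≡⟨ cong (_+ A) (sym (∑-+ n (λ i → suc k * tuples n k F (z + r i + r n)) (λ i → tuples n (suc k) F (z + r i)))) ⟩
    ∑ n (λ i → suc k * tuples n k F (z + r i + r n) + tuples n (suc k) F (z + r i)) + A
      ≤⟨ +-mono-≤ (∑-mono n (λ i _ → tuples-suc n k F (z + r i)))
                  (tuples-mono-range (n≤1+n n) (suc k) F (z + r n)) ⟩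
    tuples (suc n) (suc (suc k)) F z ∎
    where
    open ≤-Reasoning
    A = tuples n (suc k) F (z + r n)
    B = tuples n (suc (suc k)) F z
    lem : ∀ k a b → suc k * a + b ≡ (k * a + b) + a
    lem = solve-∀
    comm : ∀ x y w → x + y + w ≡ x + w + y
    comm = solve-∀

  factorial-subsets≤tuples : ∀ n k F z → k ! * subsets n k F z ≤ tuples n k F z
  factorial-subsets≤tuples n zero F z = ≤-reflexive (*-identityˡ _)
  factorial-subsets≤tuples zero (suc k) F z = ≤-reflexive (*-zeroʳ (suc k !))
  factorial-subsets≤tuples (suc n) (suc k) F z = begin
    suc k ! * (subsets n (suc k) F z + subsets n k F (z + r n))
      ≡⟨ lem (suc k) (k !) (subsets n (suc k) F z) (subsets n k F (z + r n)) ⟩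
    suc k * (k ! * subsets n k F (z + r n)) + suc k ! * subsets n (suc k) F z
      ≤⟨ +-mono-≤ (*-monoʳ-≤ (suc k) (factorial-subsets≤tuples n k F (z + r n)))
                  (factorial-subsets≤tuples n (suc k) F z) ⟩
    suc k * tuples n k F (z + r n) + tuples n (suc k) F z
      ≤⟨ tuples-suc n k F z ⟩
    tuples (suc n) (suc k) F z ∎
    where
    open ≤-Reasoning
    lem : ∀ a f x y → a * f * (x + y) ≡ a * (f * y) + a * f * x
    lem = solve-∀

-- Convexity and the comparison with Bernoulli variables

-- Convexity of g over steps of length U, in the form that bounds a variable with
-- values in [0 , U] by the two-point variable with values 0 and U and the same mean.
Chordal : ℕ → (ℕ → ℕ) → Set
Chordal U g = ∀ z v w → v + w ≡ U → U * g (z + w) ≤ v * g z + w * g (z + U)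

-- `V` and `M` are unnormalised probabilities of the values 0 and `U`. Iterated `k` times, this is
-- `(V + M) ^ k` times an expectation over a binomial number of steps `U`.
twoPoint : (U V M : ℕ) → (ℕ → ℕ) → ℕ → ℕ
twoPoint U V M g z = V * g z + M * g (z + U)

twoPoints : (U V M : ℕ) → ℕ → (ℕ → ℕ) → ℕ → ℕ
twoPoints U V M zero    g = g
twoPoints U V M (suc k) g = twoPoint U V M (twoPoints U V M k g)

+-exchange : ∀ x y z → x + y + z ≡ x + z + y
+-exchange = solve-∀

chordal-twoPoint : ∀ U V M {g} → Chordal U g → Chordal U (twoPoint U V M g)
chordal-twoPoint U V M {g} cvx z v w v+w≡U = begin
  U * (V * g (z + w) + M * g (z + w + U))
    ≡⟨ cong (λ x → U * (V * g (z + w) + M * g x)) (+-exchange z w U) ⟩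
  U * (V * g (z + w) + M * g (z + U + w))
    ≡⟨ expand U V M (g (z + w)) (g (z + U + w)) ⟩
  V * (U * g (z + w)) + M * (U * g (z + U + w))
    ≤⟨ +-mono-≤ (*-monoʳ-≤ V (cvx z v w v+w≡U)) (*-monoʳ-≤ M (cvx (z + U) v w v+w≡U)) ⟩
  V * (v * g z + w * g (z + U)) + M * (v * g (z + U) + w * g (z + U + U))
    ≡⟨ regroup V M v w (g z) (g (z + U)) (g (z + U + U)) ⟩
  v * (V * g z + M * g (z + U)) + w * (V * g (z + U) + M * g (z + U + U)) ∎
  where
  open ≤-Reasoning
  expand : ∀ U V M a b → U * (V * a + M * b) ≡ V * (U * a) + M * (U * b)
  expand = solve-∀
  regroup : ∀ V M v w a b c → V * (v * a + w * b) + M * (v * b + w * c) ≡ v * (V * a + M * b) + w * (V * b + M * c)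
  regroup = solve-∀

chordal-twoPoints : ∀ U V M k {g} → Chordal U g → Chordal U (twoPoints U V M k g)
chordal-twoPoints U V M zero    cvx = cvx
chordal-twoPoints U V M (suc k) cvx = chordal-twoPoint U V M (chordal-twoPoints U V M k cvx)

chordal-⊔ : ∀ U {f g} → Chordal U f → Chordal U g → Chordal U (λ x → f x ⊔ g x)
chordal-⊔ U {f} {g} cf cg z v w eq = begin
  U * (f (z + w) ⊔ g (z + w))
    ≡⟨ *-distribˡ-⊔ U (f (z + w)) (g (z + w)) ⟩
  U * f (z + w) ⊔ U * g (z + w)
    ≤⟨ ⊔-lub
        (≤-trans (cf z v w eq) (+-mono-≤ (*-monoʳ-≤ v (m≤m⊔n _ _)) (*-monoʳ-≤ w (m≤m⊔n _ _))))
        (≤-trans (cg z v w eq) (+-mono-≤ (*-monoʳ-≤ v (m≤n⊔m (f z) _)) (*-monoʳ-≤ w (m≤n⊔m (f (z + U)) _)))) ⟩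
  v * (f z ⊔ g z) + w * (f (z + U) ⊔ g (z + U)) ∎
  where open ≤-Reasoning

∸-subadditive : ∀ a b c d → (a + b) ∸ (c + d) ≤ (a ∸ c) + (b ∸ d)
∸-subadditive a b c d = m≤n+o⇒m∸n≤o (a + b) (c + d) (begin
  a + b                            ≤⟨ +-mono-≤ (m≤n+m∸n a c) (m≤n+m∸n b d) ⟩
  (c + (a ∸ c)) + (d + (b ∸ d))    ≡⟨ lem c (a ∸ c) d (b ∸ d) ⟩
  c + d + ((a ∸ c) + (b ∸ d))      ∎)
  where
  open ≤-Reasoning
  lem : ∀ a b c d → (a + b) + (c + d) ≡ a + c + (b + d)
  lem = solve-∀

-- An affine function of `x` cut off at 0, hence convex. The unit `y` makes it homogeneous, so that
-- its values can be checked on integers at `y = 1`.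
line : (α β γ y x : ℕ) → ℕ
line α β γ y x = (α * y + β * x) ∸ γ * y

line-mono : ∀ α β γ y {x x′} → x ≤ x′ → line α β γ y x ≤ line α β γ y x′
line-mono α β γ y x≤x′ = ∸-monoˡ-≤ (γ * y) (+-monoʳ-≤ (α * y) (*-monoʳ-≤ β x≤x′))

line-scale : ∀ α β γ y x → line α β γ y (x * y) ≡ line α β γ 1 x * y
line-scale α β γ y x = trans (cong₂ _∸_ (lem α β y x) (lem′ γ y)) (sym (*-distribʳ-∸ y (α * 1 + β * x) (γ * 1)))
  where
  lem : ∀ α β y x → α * y + β * (x * y) ≡ (α * 1 + β * x) * y
  lem = solve-∀
  lem′ : ∀ γ y → γ * y ≡ γ * 1 * y
  lem′ = solve-∀

chordal-line : ∀ U α β γ y → Chordal U (line α β γ y)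
chordal-line U α β γ y z v w refl = begin
  (v + w) * ((α * y + β * (z + w)) ∸ γ * y)
    ≡⟨ *-distribˡ-∸ (v + w) (α * y + β * (z + w)) (γ * y) ⟩
  ((v + w) * (α * y + β * (z + w))) ∸ ((v + w) * (γ * y))
    ≡⟨ cong₂ _∸_ (lem v w (α * y) β z) (*-distribʳ-+ (γ * y) v w) ⟩
  (v * (α * y + β * z) + w * (α * y + β * (z + (v + w)))) ∸ (v * (γ * y) + w * (γ * y))
    ≤⟨ ∸-subadditive (v * (α * y + β * z)) _ (v * (γ * y)) _ ⟩
  (v * (α * y + β * z) ∸ v * (γ * y)) + (w * (α * y + β * (z + (v + w))) ∸ w * (γ * y))
    ≡⟨ sym (cong₂ _+_ (*-distribˡ-∸ v (α * y + β * z) (γ * y)) (*-distribˡ-∸ w (α * y + β * (z + (v + w))) (γ * y))) ⟩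
  v * line α β γ y z + w * line α β γ y (z + (v + w)) ∎
  where
  open ≤-Reasoning
  lem : ∀ v w a β z → (v + w) * (a + β * (z + w)) ≡ v * (a + β * z) + w * (a + β * (z + (v + w)))
  lem = solve-∀

module _ (r : ℕ → ℕ) (N U : ℕ) (r≤U : ∀ i → i < N → r i ≤ U) where
  open Tuples r

  private
    M V : ℕ
    M = ∑ N r
    V = ∑ N (λ i → U ∸ r i)

  complement-sum : V + M ≡ N * U
  complement-sum = trans (sym (∑-+ N (λ i → U ∸ r i) r))
    (trans (∑-cong N (λ i i<N → m∸n+n≡m (r≤U i i<N))) (∑-const N U))

  -- The weights are replaced one at a time. By convexity `r i` may be traded for `U` with
  -- probability `r i / U` and 0 otherwise; summing over `i` turns these probabilities into `M` and
  -- `V`. The replaced variables leave a function that is still convex in the partial sum.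
  tuples≤twoPoints : ∀ k {g} z → Chordal U g → U ^ k * tuples N k g z ≤ twoPoints U V M k g z
  tuples≤twoPoints zero z cvx = ≤-reflexive (*-identityˡ _)
  tuples≤twoPoints (suc k) {g} z cvx = begin
    U * U ^ k * ∑ N (λ i → tuples N k g (z + r i))
      ≡⟨ *-assoc U (U ^ k) _ ⟩
    U * (U ^ k * ∑ N (λ i → tuples N k g (z + r i)))
      ≡⟨ cong (U *_) (sym (∑-*ˡ N (U ^ k) (λ i → tuples N k g (z + r i)))) ⟩
    U * ∑ N (λ i → U ^ k * tuples N k g (z + r i))
      ≤⟨ *-monoʳ-≤ U (∑-mono N (λ i _ → tuples≤twoPoints k (z + r i) cvx)) ⟩
    U * ∑ N (λ i → G (z + r i))
      ≡⟨ sym (∑-*ˡ N U (λ i → G (z + r i))) ⟩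
    ∑ N (λ i → U * G (z + r i))
      ≤⟨ ∑-mono N (λ i i<N → chordal-twoPoints U V M k cvx z (U ∸ r i) (r i) (m∸n+n≡m (r≤U i i<N))) ⟩
    ∑ N (λ i → (U ∸ r i) * G z + r i * G (z + U))
      ≡⟨ ∑-+ N (λ i → (U ∸ r i) * G z) (λ i → r i * G (z + U)) ⟩
    ∑ N (λ i → (U ∸ r i) * G z) + ∑ N (λ i → r i * G (z + U))
      ≡⟨ cong₂ _+_ (∑-*ʳ N (G z) (λ i → U ∸ r i)) (∑-*ʳ N (G (z + U)) r) ⟩
    V * G z + M * G (z + U) ∎
    where
    open ≤-Reasoning
    G = twoPoints U V M k g

-- With p = M / (V + M) ≤ a / (a + e), these are p ↦ E (Bin(4,p) − j)⁺ / p for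
-- j = 1, 2, 3, which are nondecreasing in p.
module _ (V M a e : ℕ) (p≤ : M * e ≤ a * V) where
  private
    Q b g h X Z : ℕ
    Q = V + M
    b = a + e
    X = b * M
    Z = a * Q
    g = a * V ∸ M * e
    h = e * Q

    Z≡ : Z ≡ X + g
    Z≡ = begin
      a * (V + M)                ≡⟨ *-distribˡ-+ a V M ⟩
      a * V + a * M              ≡⟨ cong (_+ a * M) (sym (m+[n∸m]≡n p≤)) ⟩
      (M * e + g) + a * M        ≡⟨ lem M e g a ⟩
      (a + e) * M + g            ∎
      where
      open ≡-Reasoning
      lem : ∀ M e g a → (M * e + g) + a * M ≡ (a + e) * M + g
      lem = solve-∀

    bV≡ : b * V ≡ g + h
    bV≡ = begin
      (a + e) * V                      ≡⟨ *-distribʳ-+ V a e ⟩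
      a * V + e * V                    ≡⟨ cong (_+ e * V) (sym (m+[n∸m]≡n p≤)) ⟩
      (M * e + g) + e * V              ≡⟨ lem M e g V ⟩
      g + e * (V + M)                  ∎
      where
      open ≡-Reasoning
      lem : ∀ M e g V → (M * e + g) + e * V ≡ g + e * (V + M)
      lem = solve-∀

  -- Over the common denominator `b * Q` the success masses are `X` and `X + g`, the failure masses
  -- `g + h` and `h`. Raising p thus moves `g` from failure to success, and the difference of the
  -- two forms has no negative coefficient. `hinge₂` goes the same way.
  hinge₁ : b * b * b * (M * (3 * (M * M) + 8 * (V * M) + 6 * (V * V)))
         ≤ Q * Q * Q * (a * (3 * (a * a) + 8 * (a * e) + 6 * (e * e)))
  hinge₁ = begin
    b * b * b * (M * (3 * (M * M) + 8 * (V * M) + 6 * (V * V)))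
      ≡⟨ lhs b M V ⟩
    F X (b * V)                                ≡⟨ cong (F X) bV≡ ⟩
    F X (g + h)                                ≤⟨ m≤m+n _ _ ⟩
    F X (g + h) + (X * X * g + 3 * (X * g * g) + 3 * (g * g * g) + 4 * (X * g * h) + 8 * (g * g * h) + 6 * (g * h * h))
                                               ≡⟨ diff X g h ⟩
    F (X + g) h                                ≡⟨ cong (λ z → F z h) (sym Z≡) ⟩
    F Z h                                      ≡⟨ rhs Q a e ⟩
    Q * Q * Q * (a * (3 * (a * a) + 8 * (a * e) + 6 * (e * e))) ∎
    where
    open ≤-Reasoning
    F : ℕ → ℕ → ℕ
    F x t = x * (3 * (x * x) + 8 * (t * x) + 6 * (t * t))
    lhs : ∀ b M V → b * b * b * (M * (3 * (M * M) + 8 * (V * M) + 6 * (V * V)))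
      ≡ b * M * (3 * (b * M * (b * M)) + 8 * (b * V * (b * M)) + 6 * (b * V * (b * V)))
    lhs = solve-∀
    rhs : ∀ Q a e → a * Q * (3 * (a * Q * (a * Q)) + 8 * (e * Q * (a * Q)) + 6 * (e * Q * (e * Q)))
      ≡ Q * Q * Q * (a * (3 * (a * a) + 8 * (a * e) + 6 * (e * e)))
    rhs = solve-∀
    diff : ∀ X g h → X * (3 * (X * X) + 8 * ((g + h) * X) + 6 * ((g + h) * (g + h)))
      + (X * X * g + 3 * (X * g * g) + 3 * (g * g * g) + 4 * (X * g * h) + 8 * (g * g * h) + 6 * (g * h * h))
      ≡ (X + g) * (3 * ((X + g) * (X + g)) + 8 * (h * (X + g)) + 6 * (h * h))
    diff = solve-∀

  hinge₂ : b * b * b * (M * M * (2 * M + 4 * V)) ≤ Q * Q * Q * (a * a * (2 * a + 4 * e))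
  hinge₂ = begin
    b * b * b * (M * M * (2 * M + 4 * V))      ≡⟨ lhs b M V ⟩
    F X (b * V)                                ≡⟨ cong (F X) bV≡ ⟩
    F X (g + h)                                ≤⟨ m≤m+n _ _ ⟩
    F X (g + h) + (2 * (X * X * g) + 6 * (X * g * g) + 2 * (g * g * g) + 8 * (X * g * h) + 4 * (g * g * h))
                                               ≡⟨ diff X g h ⟩
    F (X + g) h                                ≡⟨ cong (λ z → F z h) (sym Z≡) ⟩
    F Z h                                      ≡⟨ rhs Q a e ⟩
    Q * Q * Q * (a * a * (2 * a + 4 * e))      ∎
    where
    open ≤-Reasoning
    F : ℕ → ℕ → ℕ
    F x t = x * x * (2 * x + 4 * t)
    lhs : ∀ b M V → b * b * b * (M * M * (2 * M + 4 * V)) ≡ b * M * (b * M) * (2 * (b * M) + 4 * (b * V))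
    lhs = solve-∀
    rhs : ∀ Q a e → a * Q * (a * Q) * (2 * (a * Q) + 4 * (e * Q)) ≡ Q * Q * Q * (a * a * (2 * a + 4 * e))
    rhs = solve-∀
    diff : ∀ X g h → X * X * (2 * X + 4 * (g + h))
      + (2 * (X * X * g) + 6 * (X * g * g) + 2 * (g * g * g) + 8 * (X * g * h) + 4 * (g * g * h))
      ≡ (X + g) * (X + g) * (2 * (X + g) + 4 * h)
    diff = solve-∀

  hinge₃ : b * b * b * (M * M * M) ≤ Q * Q * Q * (a * a * a)
  hinge₃ = begin
    b * b * b * (M * M * M)  ≡⟨ lem b M ⟩
    X * X * X                ≤⟨ *-mono-≤ (*-mono-≤ X≤Z X≤Z) X≤Z ⟩
    Z * Z * Z                ≡⟨ sym (lem′ Q a) ⟩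
    Q * Q * Q * (a * a * a)  ∎
    where
    open ≤-Reasoning
    X≤Z : X ≤ Z
    X≤Z = ≤-trans (m≤m+n X g) (≤-reflexive (sym Z≡))
    lem : ∀ b M → b * b * b * (M * M * M) ≡ b * M * (b * M) * (b * M)
    lem = solve-∀
    lem′ : ∀ Q a → Q * Q * Q * (a * a * a) ≡ a * Q * (a * Q) * (a * Q)
    lem′ = solve-∀

-- E g(Bin(4,p)) for the convex sequence g with g 0 = k and slopes d, d + c₁,
-- d + c₁ + c₂, d + c₁ + c₂ + c₃ is at most k plus p times its secant slope at a / (a + e).
secant : (a e d c₁ c₂ c₃ : ℕ) → ℕ
secant a e d c₁ c₂ c₃ = 4 * d * ((a + e) * (a + e) * (a + e))
  + c₁ * (a * (3 * (a * a) + 8 * (a * e) + 6 * (e * e)))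
  + c₂ * (a * a * (2 * a + 4 * e)) + c₃ * (a * a * a)

binomial≤secant : ∀ V M a e k d c₁ c₂ c₃ → M * e ≤ a * V →
  let b = a + e ; Q = V + M in
  b * b * b * (V * V * V * V * k + 4 * (V * V * V * M * (k + d)) + 6 * (V * V * M * M * (k + 2 * d + c₁))
    + 4 * (V * M * M * M * (k + 3 * d + 2 * c₁ + c₂)) + M * M * M * M * (k + 4 * d + 3 * c₁ + 2 * c₂ + c₃))
  ≤ Q * Q * Q * (b * b * b * k * Q + M * secant a e d c₁ c₂ c₃)
binomial≤secant V M a e k d c₁ c₂ c₃ p≤ = begin
  b * b * b * (V * V * V * V * k + 4 * (V * V * V * M * (k + d)) + 6 * (V * V * M * M * (k + 2 * d + c₁))
    + 4 * (V * M * M * M * (k + 3 * d + 2 * c₁ + c₂)) + M * M * M * M * (k + 4 * d + 3 * c₁ + 2 * c₂ + c₃))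
    -- A convex sequence is a constant plus a linear part plus nonnegative multiples of the hinges
    -- at 1, 2 and 3. The first two have exact expectations; only the hinges need the bound on p.
    ≡⟨ cong (b * b * b *_) (split V M k d c₁ c₂ c₃) ⟩
  b * b * b * (Q * Q * Q * (k * Q + M * (4 * d)) + M * (c₁ * P₁ + c₂ * P₂ + c₃ * P₃))
    ≡⟨ regroup (b * b * b) (Q * Q * Q) k Q M d c₁ P₁ c₂ P₂ c₃ P₃ ⟩
  Q * Q * Q * (b * b * b * k * Q + M * (4 * d * (b * b * b)))
    + M * (c₁ * (b * b * b * P₁) + c₂ * (b * b * b * P₂) + c₃ * (b * b * b * P₃))
    ≤⟨ +-monoʳ-≤ _ (*-monoʳ-≤ M (+-mono-≤ (+-mono-≤
         (*-monoʳ-≤ c₁ (hinge₁ V M a e p≤)) (*-monoʳ-≤ c₂ (hinge₂ V M a e p≤))) (*-monoʳ-≤ c₃ (hinge₃ V M a e p≤)))) ⟩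
  Q * Q * Q * (b * b * b * k * Q + M * (4 * d * (b * b * b)))
    + M * (c₁ * (Q * Q * Q * R₁) + c₂ * (Q * Q * Q * R₂) + c₃ * (Q * Q * Q * R₃))
    ≡⟨ collect (Q * Q * Q) (b * b * b * k * Q) M (4 * d * (b * b * b)) c₁ R₁ c₂ R₂ c₃ R₃ ⟩
  Q * Q * Q * (b * b * b * k * Q + M * secant a e d c₁ c₂ c₃) ∎
  where
  open ≤-Reasoning
  b Q P₁ P₂ P₃ R₁ R₂ R₃ : ℕ
  b = a + e
  Q = V + M
  P₁ = M * (3 * (M * M) + 8 * (V * M) + 6 * (V * V))
  P₂ = M * M * (2 * M + 4 * V)
  P₃ = M * M * M
  R₁ = a * (3 * (a * a) + 8 * (a * e) + 6 * (e * e))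
  R₂ = a * a * (2 * a + 4 * e)
  R₃ = a * a * a
  split : ∀ V M k d c₁ c₂ c₃ →
    V * V * V * V * k + 4 * (V * V * V * M * (k + d)) + 6 * (V * V * M * M * (k + 2 * d + c₁))
      + 4 * (V * M * M * M * (k + 3 * d + 2 * c₁ + c₂)) + M * M * M * M * (k + 4 * d + 3 * c₁ + 2 * c₂ + c₃)
    ≡ (V + M) * (V + M) * (V + M) * (k * (V + M) + M * (4 * d))
      + M * (c₁ * (M * (3 * (M * M) + 8 * (V * M) + 6 * (V * V))) + c₂ * (M * M * (2 * M + 4 * V)) + c₃ * (M * M * M))
  split = solve-∀
  regroup : ∀ B q k Q M d c₁ P₁ c₂ P₂ c₃ P₃ →
    B * (q * (k * Q + M * (4 * d)) + M * (c₁ * P₁ + c₂ * P₂ + c₃ * P₃))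
    ≡ q * (B * k * Q + M * (4 * d * B)) + M * (c₁ * (B * P₁) + c₂ * (B * P₂) + c₃ * (B * P₃))
  regroup = solve-∀
  collect : ∀ q x M y c₁ R₁ c₂ R₂ c₃ R₃ →
    q * (x + M * y) + M * (c₁ * (q * R₁) + c₂ * (q * R₂) + c₃ * (q * R₃))
    ≡ q * (x + M * (y + c₁ * R₁ + c₂ * R₂ + c₃ * R₃))
  collect = solve-∀

-- Kernels dominating the indicators of heavy tuples

triples : (δ a b c d : ℕ) → ℕ
triples δ a b c d = ⟦ δ ≤? b + c + d ⟧ + ⟦ δ ≤? a + c + d ⟧ + ⟦ δ ≤? a + b + d ⟧ + ⟦ δ ≤? a + b + c ⟧

-- Symmetrised over the weight left out of S₃, so that both indicators can be controlled by the same
-- total. Its average is `4 * (P (S₄ ≥ Y) + P (S₃ ≥ δ))`.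
target : (Y δ a b c d : ℕ) → ℕ
target Y δ a b c d = 4 * ⟦ Y ≤? a + b + c + d ⟧ + triples δ a b c d

-- What `t` triples reaching `δ` say about the total `S` alone. The sum of `t` triples is
-- `(t - 1) * S` plus `4 - t` of the weights, each at most `U`; besides, a single triple already
-- gives `δ ≤ S`.
data Tally (δ U S : ℕ) : ℕ → Set where
  count₀  : Tally δ U S 0
  count₁   : δ ≤ S → Tally δ U S 1
  count₂   : δ ≤ S → 2 * δ ≤ S + 2 * U → Tally δ U S 2
  count₃ : δ ≤ S → 3 * δ ≤ 2 * S + U → Tally δ U S 3
  count₄  : 4 * δ ≤ 3 * S → Tally δ U S 4

module _ {δ U S : ℕ} where
  tally₁ : ∀ {p a} → p + a ≡ S → δ ≤ p → Tally δ U S 1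
  tally₁ refl δ≤p = count₁ (≤-trans δ≤p (m≤m+n _ _))

  tally₂ : ∀ {p q a c d} → p + a ≡ S → p + q ≡ S + (c + d) → c ≤ U → d ≤ U → δ ≤ p → δ ≤ q → Tally δ U S 2
  tally₂ {p} {q} {a} {c} {d} refl eq c≤U d≤U δ≤p δ≤q = count₂ (≤-trans δ≤p (m≤m+n _ _)) (begin
    2 * δ              ≡⟨ lem δ ⟩
    δ + δ              ≤⟨ +-mono-≤ δ≤p δ≤q ⟩
    p + q              ≡⟨ eq ⟩
    p + a + (c + d)    ≤⟨ +-monoʳ-≤ (p + a) (+-mono-≤ c≤U d≤U) ⟩
    p + a + (U + U)    ≡⟨ cong (p + a +_) (sym (lem U)) ⟩
    p + a + 2 * U      ∎)
    where
    open ≤-Reasoning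
    lem : ∀ x → 2 * x ≡ x + x
    lem = solve-∀

  tally₃ : ∀ {p q t a d} → p + a ≡ S → p + q + t ≡ 2 * S + d → d ≤ U → δ ≤ p → δ ≤ q → δ ≤ t → Tally δ U S 3
  tally₃ {p} {q} {t} {a} {d} refl eq d≤U δ≤p δ≤q δ≤t = count₃ (≤-trans δ≤p (m≤m+n _ _)) (begin
    3 * δ              ≡⟨ lem δ ⟩
    δ + δ + δ          ≤⟨ +-mono-≤ (+-mono-≤ δ≤p δ≤q) δ≤t ⟩
    p + q + t          ≡⟨ eq ⟩
    2 * (p + a) + d    ≤⟨ +-monoʳ-≤ (2 * (p + a)) d≤U ⟩
    2 * (p + a) + U    ∎)
    where
    open ≤-Reasoning
    lem : ∀ x → 3 * x ≡ x + x + x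
    lem = solve-∀

tally : ∀ δ U a b c d → a ≤ U → b ≤ U → c ≤ U → d ≤ U → Tally δ U (a + b + c + d) (triples δ a b c d)
tally δ U a b c d a≤ b≤ c≤ d≤ with δ ≤? b + c + d | δ ≤? a + c + d | δ ≤? a + b + d | δ ≤? a + b + c
... | no _  | no _  | no _  | no _  = count₀
... | yes p | no _  | no _  | no _  = tally₁ (e₁ a b c d) p
  where
  e₁ : ∀ a b c d → b + c + d + a ≡ a + b + c + d
  e₁ = solve-∀
... | no _  | yes p | no _  | no _  = tally₁ (e₂ a b c d) p
  where
  e₂ : ∀ a b c d → a + c + d + b ≡ a + b + c + d
  e₂ = solve-∀
... | no _  | no _  | yes p | no _  = tally₁ (e₃ a b c d) p
  where
  e₃ : ∀ a b c d → a + b + d + c ≡ a + b + c + d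
  e₃ = solve-∀
... | no _  | no _  | no _  | yes p = tally₁ {a = d} refl p
... | yes p | yes q | no _  | no _  = tally₂ (e₁ a b c d) (e a b c d) c≤ d≤ p q
  where
  e₁ : ∀ a b c d → b + c + d + a ≡ a + b + c + d
  e₁ = solve-∀
  e : ∀ a b c d → b + c + d + (a + c + d) ≡ a + b + c + d + (c + d)
  e = solve-∀
... | yes p | no _  | yes q | no _  = tally₂ (e₁ a b c d) (e a b c d) b≤ d≤ p q
  where
  e₁ : ∀ a b c d → b + c + d + a ≡ a + b + c + d
  e₁ = solve-∀
  e : ∀ a b c d → b + c + d + (a + b + d) ≡ a + b + c + d + (b + d)
  e = solve-∀
... | yes p | no _  | no _  | yes q = tally₂ (e₁ a b c d) (e a b c d) b≤ c≤ p q
  where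
  e₁ : ∀ a b c d → b + c + d + a ≡ a + b + c + d
  e₁ = solve-∀
  e : ∀ a b c d → b + c + d + (a + b + c) ≡ a + b + c + d + (b + c)
  e = solve-∀
... | no _  | yes p | yes q | no _  = tally₂ (e₂ a b c d) (e a b c d) a≤ d≤ p q
  where
  e₂ : ∀ a b c d → a + c + d + b ≡ a + b + c + d
  e₂ = solve-∀
  e : ∀ a b c d → a + c + d + (a + b + d) ≡ a + b + c + d + (a + d)
  e = solve-∀
... | no _  | yes p | no _  | yes q = tally₂ (e₂ a b c d) (e a b c d) a≤ c≤ p q
  where
  e₂ : ∀ a b c d → a + c + d + b ≡ a + b + c + d
  e₂ = solve-∀
  e : ∀ a b c d → a + c + d + (a + b + c) ≡ a + b + c + d + (a + c)
  e = solve-∀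
... | no _  | no _  | yes p | yes q = tally₂ (e₃ a b c d) (e a b c d) a≤ b≤ p q
  where
  e₃ : ∀ a b c d → a + b + d + c ≡ a + b + c + d
  e₃ = solve-∀
  e : ∀ a b c d → a + b + d + (a + b + c) ≡ a + b + c + d + (a + b)
  e = solve-∀
... | yes p | yes q | yes t | no _  = tally₃ (e₁ a b c d) (e a b c d) d≤ p q t
  where
  e₁ : ∀ a b c d → b + c + d + a ≡ a + b + c + d
  e₁ = solve-∀
  e : ∀ a b c d → b + c + d + (a + c + d) + (a + b + d) ≡ 2 * (a + b + c + d) + d
  e = solve-∀
... | yes p | yes q | no _  | yes t = tally₃ (e₁ a b c d) (e a b c d) c≤ p q t
  where
  e₁ : ∀ a b c d → b + c + d + a ≡ a + b + c + d
  e₁ = solve-∀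
  e : ∀ a b c d → b + c + d + (a + c + d) + (a + b + c) ≡ 2 * (a + b + c + d) + c
  e = solve-∀
... | yes p | no _  | yes q | yes t = tally₃ (e₁ a b c d) (e a b c d) b≤ p q t
  where
  e₁ : ∀ a b c d → b + c + d + a ≡ a + b + c + d
  e₁ = solve-∀
  e : ∀ a b c d → b + c + d + (a + b + d) + (a + b + c) ≡ 2 * (a + b + c + d) + b
  e = solve-∀
... | no _  | yes p | yes q | yes t = tally₃ (e₂ a b c d) (e a b c d) a≤ p q t
  where
  e₂ : ∀ a b c d → a + c + d + b ≡ a + b + c + d
  e₂ = solve-∀
  e : ∀ a b c d → a + c + d + (a + b + d) + (a + b + c) ≡ 2 * (a + b + c + d) + a
  e = solve-∀
... | yes p | yes q | yes t | yes v = count₄ (begin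
    4 * δ                                                      ≡⟨ e δ ⟩
    δ + δ + δ + δ                                              ≤⟨ +-mono-≤ (+-mono-≤ (+-mono-≤ p q) t) v ⟩
    b + c + d + (a + c + d) + (a + b + d) + (a + b + c)        ≡⟨ e′ a b c d ⟩
    3 * (a + b + c + d)                                        ∎)
  where
  open ≤-Reasoning
  e : ∀ x → 4 * x ≡ x + x + x + x
  e = solve-∀
  e′ : ∀ a b c d → b + c + d + (a + c + d) + (a + b + d) + (a + b + c) ≡ 3 * (a + b + c + d)
  e′ = solve-∀

-- After averaging and dividing by `100 * D`, the 99 meets the four weights of the total and gives
-- 3.96 μ. Values above 4 occur only for totals of at least `Y`, where the first alternative is
-- used; values up to 4 follow from `δ ≤ D` together with the lower bounds on `S` in `Tally`.
target-linear : ∀ Y D δ U a b c d → δ ≤ D → a ≤ U → b ≤ U → c ≤ U → d ≤ U →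
  (100 * (D + δ) ≤ 99 * Y) ⊎ (a + b + c + d < Y) →
  25 * D * target Y δ a b c d + 100 * δ ≤ 100 * D + 99 * (a + b + c + d)
target-linear Y D δ U a b c d δ≤D a≤ b≤ c≤ d≤ hyp with Y ≤? a + b + c + d
... | yes Y≤S with hyp
...   | inj₂ S<Y = ⊥-elim (<⇒≱ S<Y Y≤S)
...   | inj₁ D+δ≤ = begin
  25 * D * (4 + triples δ a b c d) + 100 * δ  ≤⟨ +-monoˡ-≤ (100 * δ) (*-monoʳ-≤ (25 * D) (+-monoʳ-≤ 4 triples≤4)) ⟩
  25 * D * (4 + 4) + 100 * δ              ≡⟨ lem D δ ⟩
  100 * D + 100 * (D + δ)                 ≤⟨ +-monoʳ-≤ (100 * D) (≤-trans D+δ≤ (*-monoʳ-≤ 99 Y≤S)) ⟩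
  100 * D + 99 * (a + b + c + d)          ∎
  where
  open ≤-Reasoning
  triples≤4 : triples δ a b c d ≤ 4
  triples≤4 = +-mono-≤ (+-mono-≤ (+-mono-≤ (⟦⟧≤1 (δ ≤? b + c + d)) (⟦⟧≤1 (δ ≤? a + c + d)))
    (⟦⟧≤1 (δ ≤? a + b + d))) (⟦⟧≤1 (δ ≤? a + b + c))
  lem : ∀ D δ → 25 * D * (4 + 4) + 100 * δ ≡ 100 * D + 100 * (D + δ)
  lem = solve-∀
target-linear Y D δ U a b c d δ≤D a≤ b≤ c≤ d≤ hyp | no _ = bound (tally δ U a b c d a≤ b≤ c≤ d≤)
  where
  open ≤-Reasoning
  S : ℕ
  S = a + b + c + d
  few : ∀ {t} → t ≤ 3 → δ ≤ S → 25 * D * t + 100 * δ ≤ 100 * D + 99 * S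
  few {t} t≤3 δ≤S = begin
    25 * D * t + 100 * δ         ≤⟨ +-monoˡ-≤ (100 * δ) (*-monoʳ-≤ (25 * D) t≤3) ⟩
    25 * D * 3 + 100 * δ         ≡⟨ lem D δ ⟩
    75 * D + δ + 99 * δ          ≤⟨ +-mono-≤ (+-monoʳ-≤ (75 * D) (≤-trans δ≤D (m≤m+n D (24 * D)))) (*-monoʳ-≤ 99 δ≤S) ⟩
    75 * D + (25 * D) + 99 * S   ≡⟨ lem′ D S ⟩
    100 * D + 99 * S             ∎
    where
    lem : ∀ D δ → 25 * D * 3 + 100 * δ ≡ 75 * D + δ + 99 * δ
    lem = solve-∀
    lem′ : ∀ D S → 75 * D + 25 * D + 99 * S ≡ 100 * D + 99 * S
    lem′ = solve-∀
  bound : ∀ {t} → Tally δ U S t → 25 * D * t + 100 * δ ≤ 100 * D + 99 * S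
  bound count₀ = begin
    25 * D * 0 + 100 * δ  ≡⟨ cong (_+ 100 * δ) (*-zeroʳ (25 * D)) ⟩
    100 * δ               ≤⟨ *-monoʳ-≤ 100 δ≤D ⟩
    100 * D               ≤⟨ m≤m+n _ _ ⟩
    100 * D + 99 * S      ∎
  bound (count₁ p)     = few (s≤s z≤n) p
  bound (count₂ p _)   = few (s≤s (s≤s z≤n)) p
  bound (count₃ p _) = few ≤-refl p
  bound (count₄ p) = begin
    25 * D * 4 + 100 * δ      ≡⟨ lem D δ ⟩
    100 * D + 25 * (4 * δ)    ≤⟨ +-monoʳ-≤ (100 * D) (*-monoʳ-≤ 25 p) ⟩
    100 * D + 25 * (3 * S)    ≤⟨ +-monoʳ-≤ (100 * D) (≤-trans (m≤m+n _ (24 * S)) (≤-reflexive (lem′ S))) ⟩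
    100 * D + 99 * S          ∎
    where
    lem : ∀ D δ → 25 * D * 4 + 100 * δ ≡ 100 * D + 25 * (4 * δ)
    lem = solve-∀
    lem′ : ∀ S → 25 * (3 * S) + 24 * S ≡ 99 * S
    lem′ = solve-∀

-- Two cut-off lines, whose maximum is the convex dominating function; `L` is the common denominator
-- of its values.
record Kernel : Set where
  constructor kernel
  field α β γ α′ β′ γ′ L : ℕ

module _ (K : Kernel) where
  open Kernel K

  -- Written with ⊔′, which computes by the primitive comparison.
  eval : ℕ → ℕ → ℕ
  eval y x = line α β γ y x ⊔′ line α′ β′ γ′ y x

  eval-⊔ : ∀ y x → eval y x ≡ line α β γ y x ⊔ line α′ β′ γ′ y x
  eval-⊔ y x = sym (⊔≡⊔′ (line α β γ y x) _)

  eval-mono : ∀ y {x x′} → x ≤ x′ → eval y x ≤ eval y x′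
  eval-mono y {x} {x′} p = subst₂ _≤_ (sym (eval-⊔ y x)) (sym (eval-⊔ y x′))
    (⊔-mono-≤ (line-mono α β γ y p) (line-mono α′ β′ γ′ y p))

  eval-scale : ∀ y x → eval y (x * y) ≡ eval 1 x * y
  eval-scale y x = begin
    eval y (x * y)                                          ≡⟨ eval-⊔ y (x * y) ⟩
    line α β γ y (x * y) ⊔ line α′ β′ γ′ y (x * y)          ≡⟨ cong₂ _⊔_ (line-scale α β γ y x) (line-scale α′ β′ γ′ y x) ⟩
    line α β γ 1 x * y ⊔ line α′ β′ γ′ 1 x * y              ≡⟨ sym (*-distribʳ-⊔ y (line α β γ 1 x) (line α′ β′ γ′ 1 x)) ⟩
    (line α β γ 1 x ⊔ line α′ β′ γ′ 1 x) * y                ≡⟨ cong (_* y) (sym (eval-⊔ 1 x)) ⟩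
    eval 1 x * y                                            ∎
    where open ≡-Reasoning

  chordal-eval : ∀ U y → Chordal U (eval y)
  chordal-eval U y z v w eq rewrite eval-⊔ y (z + w) | eval-⊔ y z | eval-⊔ y (z + U) =
    chordal-⊔ U (chordal-line U α β γ y) (chordal-line U α′ β′ γ′ y) z v w eq

-- Cells of the (D / Y , δ / D) square: i ≤ 200 D / Y ≤ i + 1 and k ≤ 60 δ / D ≤ k + 1.
gap : ℕ → ℕ
gap i = 200 ∸ i

low : ℕ → ℕ → ℕ
low i k = k * i ℕ./ 60

-- One condition for each value of `target`. The arguments are lower bounds, in units of `y`, for
-- the totals that `Tally` permits with weights up to `u` and threshold at least `d`. Rounding them
-- down only strengthens the conditions, because `eval` is monotone.
Dominates : (u d : ℕ) → Kernel → Set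
Dominates u d K = Kernel.L K ≤ eval K 1 d
  × 2 * Kernel.L K ≤ eval K 1 (d ⊔′ (2 * d ∸ 2 * u))
  × 3 * Kernel.L K ≤ eval K 1 (d ⊔′ ((3 * d ∸ u) ℕ./ 2))
  × 4 * Kernel.L K ≤ eval K 1 (4 * d ℕ./ 3)
  × 8 * Kernel.L K ≤ eval K 1 200

-- In `Valid` the increments are truncated differences. These equations certify that nothing was
-- truncated, so that the values are nondecreasing and convex along the multiples of `u`.
ConvexValues : (k₀ k₁ k₂ k₃ k₄ d c₁ c₂ c₃ : ℕ) → Set
ConvexValues k₀ k₁ k₂ k₃ k₄ d c₁ c₂ c₃ =
  k₁ ≡ k₀ + d × k₂ ≡ k₀ + 2 * d + c₁ × k₃ ≡ k₀ + 3 * d + 2 * c₁ + c₂ × k₄ ≡ k₀ + 4 * d + 3 * c₁ + 2 * c₂ + c₃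

-- `E / B` is the secant slope in p, and p is at most `a / (4 * u)`. The two inequalities compare
-- the kernel's expectation, divided by `L`, with `4 * (1 + (3.96 μ - δ) / D)` at the ends μ = 0 and
-- μ = D / 4, taking `δ / D` as `suc k / 60`. Here 240 is 4 times 60 and 23760 is 3.96 times 6000.
MeanBound : (a e k u L k₀ E : ℕ) → Set
MeanBound a e k u L k₀ E = a + e ≡ 4 * u × 60 * k₀ + 4 * L * suc k ≤ 240 * L
  × 1500 * a * E + 100 * B * u * (60 * k₀ + 4 * L * suc k) ≤ 100 * B * u * (240 * L) + 23760 * B * u * L
  where B = (a + e) * (a + e) * (a + e)

ValidAt : (i k : ℕ) → Kernel → (u e k₀ k₁ k₂ k₃ k₄ d c₁ c₂ c₃ : ℕ) → Set
ValidAt i k K u e k₀ k₁ k₂ k₃ k₄ d c₁ c₂ c₃ = 0 < Kernel.L K × 0 < u × Dominates u (low i k) K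
  × ConvexValues k₀ k₁ k₂ k₃ k₄ d c₁ c₂ c₃
  × MeanBound (suc i) e k u (Kernel.L K) k₀ (secant (suc i) e d c₁ c₂ c₃)

Valid : ℕ → ℕ → Kernel → Set
Valid i k K = ValidAt i k K u (4 * u ∸ suc i) k₀ k₁ k₂ k₃ k₄
  (k₁ ∸ k₀) (k₂ + k₀ ∸ 2 * k₁) (k₃ + k₁ ∸ 2 * k₂) (k₄ + k₂ ∸ 2 * k₃)
  where
  u = gap i
  k₀ = eval K 1 0
  k₁ = eval K 1 u
  k₂ = eval K 1 (u + u)
  k₃ = eval K 1 (u + u + u)
  k₄ = eval K 1 (u + u + u + u)

valid? : ∀ i k K → Dec (Valid i k K)
valid? i k K = (0 <? Kernel.L K) ×-dec (0 <? gap i)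
  ×-dec ((_ ≤? _) ×-dec (_ ≤? _) ×-dec (_ ≤? _) ×-dec (_ ≤? _) ×-dec (_ ≤? _))
  ×-dec ((_ ≟ _) ×-dec (_ ≟ _) ×-dec (_ ≟ _) ×-dec (_ ≟ _))
  ×-dec ((_ ≟ _) ×-dec (_ ≤? _) ×-dec (_ ≤? _))

-- The line with value v/5 at p and value 8 at 200, alone or together with the line
-- with value 4 (1 − (k + 1)/60) at 0 and value at least 4 at 4 δ / 3; all scaled by L.
single double : (v p i k : ℕ) → Kernel
single v p i k = kernel (8 * L) β (β * 200) 0 0 0 L
  where
  L = 300 * (200 ∸ p)
  β = (40 ∸ v) * 60
double v p i k = kernel (8 * L) β (β * 200) α (rise (4 * low i k ℕ./ 3)) 0 L
  where
  L = 300 * (200 ∸ p)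
  β = (40 ∸ v) * 60
  α = 20 * (200 ∸ p) * (59 ∸ k)
  rise : ℕ → ℕ
  rise zero        = 0
  rise x@(suc _) = suc ((4 * L ∸ α) ℕ./ x)

-- With value 3 at δ, `single 15` serves up to three triples by `δ ≤ S` alone. The others start
-- lower, which favours the mean, and rely on the finer bounds of `Tally` or on a second line. One
-- success per cell is enough.
kernels : ℕ → ℕ → List Kernel
kernels i k = single 15 d i k ∷ single 11 d i k ∷ double 1 d i k ∷ single 13 d i k
  ∷ double 1 (2 * gap i) i k ∷ single 14 d i k ∷ []
  where d = low i k

-- Necessary for `100 * (D + δ) > 99 * Y` to occur in the cell, where `D ≤ suc i * y`,
-- `60 * δ ≤ suc k * D` and `Y = 200 * y`.
Nonlinear : ℕ → ℕ → Set
Nonlinear i k = 19800 * 60 < 100 * (suc i * (61 + k))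

-- The second linear case leaves only `4 * (Y - D) ≥ Y`, that is `D ≤ 150 * y`; equality falls into
-- row 150.
cells? : Dec (∀ {i} → i < 151 → ∀ {k} → k < 60 → Nonlinear i k → Any (Valid i k) (kernels i k))
cells? = allUpTo? (λ i → allUpTo? (λ k → (_ <? _) →-dec any? (valid? i k) (kernels i k)) 60) 151

cells : ∀ {i} → i < 151 → ∀ {k} → k < 60 → Nonlinear i k → Any (Valid i k) (kernels i k)
cells = toWitness {a? = cells?} _

cell-kernel : ∀ i k → i < 151 → k < 60 → Nonlinear i k → ∃ (Valid i k)
cell-kernel i k i<151 k<60 h = satisfied (cells i<151 k<60 h)

/-scale≤ : ∀ m n x y .{{_ : NonZero n}} → m * y ≤ n * x → m ℕ./ n * y ≤ x
/-scale≤ m n x y p = *-cancelˡ-≤ n (begin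
  n * (m ℕ./ n * y)   ≡⟨ lem n (m ℕ./ n) y ⟩
  m ℕ./ n * n * y     ≤⟨ *-monoˡ-≤ y (m/n*n≤m m n) ⟩
  m * y             ≤⟨ p ⟩
  n * x             ∎)
  where
  open ≤-Reasoning
  lem : ∀ n q y → n * (q * y) ≡ q * n * y
  lem = solve-∀

∸-scale≤ : ∀ m n x y → m * y ≤ x + n * y → (m ∸ n) * y ≤ x
∸-scale≤ m n x y p = ≤-trans (≤-reflexive (*-distribʳ-∸ y m n)) (m≤n+o⇒m∸n≤o (m * y) (n * y) (≤-trans p (≤-reflexive (+-comm x _))))

⊔′-scale≤ : ∀ m n x y → m * y ≤ x → n * y ≤ x → (m ⊔′ n) * y ≤ x
⊔′-scale≤ m n x y p q = ≤-trans (≤-reflexive (cong (_* y) (sym (⊔≡⊔′ m n))))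
  (≤-trans (≤-reflexive (*-distribʳ-⊔ y m n)) (⊔-lub p q))

target≤eval : ∀ K {u d} y δ a b c e → Dominates u d K → d * y ≤ δ →
  a ≤ u * y → b ≤ u * y → c ≤ u * y → e ≤ u * y →
  Kernel.L K * y * target (200 * y) δ a b c e ≤ eval K y (a + b + c + e)
target≤eval K {u} {d} y δ a b c e (L≤₁ , L≤₂ , L≤₃ , L≤₄ , L≤₈) dy≤δ a≤ b≤ c≤ e≤ = go
  where
  open ≤-Reasoning
  S L : ℕ
  S = a + b + c + e
  L = Kernel.L K
  reach : ∀ {t j x} → t ≤ j → j * L ≤ eval K 1 x → x * y ≤ S → L * y * t ≤ eval K y S
  reach {t} {j} {x} t≤j jL≤ xy≤S = begin
    L * y * t          ≤⟨ *-monoʳ-≤ (L * y) t≤j ⟩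
    L * y * j          ≡⟨ lem L y j ⟩
    j * L * y          ≤⟨ *-monoˡ-≤ y jL≤ ⟩
    eval K 1 x * y     ≡⟨ sym (eval-scale K y x) ⟩
    eval K y (x * y)   ≤⟨ eval-mono K y xy≤S ⟩
    eval K y S         ∎
    where
    lem : ∀ L y j → L * y * j ≡ j * L * y
    lem = solve-∀
  assoc : ∀ k x y → k * (x * y) ≡ k * x * y
  assoc = solve-∀
  scaled : ∀ k {x} → k * δ ≤ x → k * d * y ≤ x
  scaled k p = ≤-trans (≤-trans (≤-reflexive (sym (assoc k d y))) (*-monoʳ-≤ k dy≤δ)) p
  few : ∀ {t} → Tally δ (u * y) S t → L * y * t ≤ eval K y S
  few count₀ = ≤-trans (≤-reflexive (*-zeroʳ (L * y))) z≤n
  few (count₁ p) = reach {j = 1} {x = d} ≤-refl (≤-trans (≤-reflexive (*-identityˡ L)) L≤₁) (≤-trans dy≤δ p)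
  few (count₂ p q) = reach {j = 2} {x = d ⊔′ (2 * d ∸ 2 * u)} ≤-refl L≤₂ (⊔′-scale≤ d (2 * d ∸ 2 * u) S y (≤-trans dy≤δ p)
    (∸-scale≤ (2 * d) (2 * u) S y (≤-trans (scaled 2 q) (≤-reflexive (cong (S +_) (assoc 2 u y))))))
  few (count₃ p q) = reach {j = 3} {x = d ⊔′ ((3 * d ∸ u) ℕ./ 2)} ≤-refl L≤₃ (⊔′-scale≤ d ((3 * d ∸ u) ℕ./ 2) S y (≤-trans dy≤δ p)
    (/-scale≤ (3 * d ∸ u) 2 S y (∸-scale≤ (3 * d) u (2 * S) y (scaled 3 q))))
  few (count₄ p) = reach {j = 4} {x = 4 * d ℕ./ 3} ≤-refl L≤₄ (/-scale≤ (4 * d) 3 S y (scaled 4 p))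
  triples≤4 : triples δ a b c e ≤ 4
  triples≤4 = +-mono-≤ (+-mono-≤ (+-mono-≤ (⟦⟧≤1 (δ ≤? b + c + e)) (⟦⟧≤1 (δ ≤? a + c + e)))
    (⟦⟧≤1 (δ ≤? a + b + e))) (⟦⟧≤1 (δ ≤? a + b + c))
  go : L * y * target (200 * y) δ a b c e ≤ eval K y S
  go with 200 * y ≤? a + b + c + e
  ... | yes Y≤S = reach {j = 8} {x = 200} (+-monoʳ-≤ 4 triples≤4) L≤₈ Y≤S
  ... | no _ = few (tally δ (u * y) a b c e a≤ b≤ c≤ e≤)

0<* : ∀ {m n} → 0 < m → 0 < n → 0 < m * n
0<* = *-mono-≤

-- Both sides are affine in `M`, and the hypotheses are the cases `M = 0` and `4 * M = ND`. The
-- slack `x` of the first case, multiplied by `4 * M ≤ ND`, interpolates between them.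
slope-gain : ∀ a E M B u k₀ L k ND → 4 * M ≤ ND → 60 * k₀ + 4 * L * suc k ≤ 240 * L →
  1500 * a * E + 100 * B * u * (60 * k₀ + 4 * L * suc k) ≤ 100 * B * u * (240 * L) + 23760 * B * u * L →
  1500 * a * E * M + 1500 * B * u * k₀ * ND + 100 * B * u * L * (suc k * ND) ≤ 6000 * B * u * L * ND + 23760 * B * u * L * M
slope-gain a E M B u k₀ L k ND 4M≤ intercept slope = begin
  1500 * a * E * M + 1500 * B * u * k₀ * ND + 100 * B * u * L * (suc k * ND)
    ≡⟨ lem (1500 * a * E * M) B u k₀ L (suc k) ND ⟩
  1500 * a * E * M + 25 * (B * u) * (60 * k₀ + 4 * L * suc k) * ND
    ≤⟨ +-monoˡ-≤ _ (*-monoˡ-≤ M aE≤) ⟩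
  (100 * B * u * x + 23760 * B * u * L) * M + 25 * (B * u) * (60 * k₀ + 4 * L * suc k) * ND
    ≡⟨ lem₃ B u x L M (60 * k₀ + 4 * L * suc k) ND ⟩
  25 * (B * u) * x * (4 * M) + (25 * (B * u) * (60 * k₀ + 4 * L * suc k) * ND + 23760 * B * u * L * M)
    ≤⟨ +-monoˡ-≤ _ (*-monoʳ-≤ (25 * (B * u) * x) 4M≤) ⟩
  25 * (B * u) * x * ND + (25 * (B * u) * (60 * k₀ + 4 * L * suc k) * ND + 23760 * B * u * L * M)
    ≡⟨ lem₄ (B * u) x (60 * k₀ + 4 * L * suc k) ND (23760 * B * u * L * M) ⟩
  25 * (B * u) * (60 * k₀ + 4 * L * suc k + x) * ND + 23760 * B * u * L * M
    ≡⟨ cong (λ z → 25 * (B * u) * z * ND + 23760 * B * u * L * M) eq ⟩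
  25 * (B * u) * (240 * L) * ND + 23760 * B * u * L * M
    ≡⟨ cong (_+ 23760 * B * u * L * M) (lem₅ B u L ND) ⟩
  6000 * B * u * L * ND + 23760 * B * u * L * M ∎
  where
  open ≤-Reasoning
  x : ℕ
  x = 240 * L ∸ (60 * k₀ + 4 * L * suc k)
  eq : 60 * k₀ + 4 * L * suc k + x ≡ 240 * L
  eq = m+[n∸m]≡n intercept
  aE≤ : 1500 * a * E ≤ 100 * B * u * x + 23760 * B * u * L
  aE≤ = +-cancelʳ-≤ (100 * B * u * (60 * k₀ + 4 * L * suc k)) _ _ (begin
    1500 * a * E + 100 * B * u * (60 * k₀ + 4 * L * suc k)         ≤⟨ slope ⟩
    100 * B * u * (240 * L) + 23760 * B * u * L                    ≡⟨ cong (λ z → 100 * B * u * z + 23760 * B * u * L) (sym eq) ⟩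
    100 * B * u * (60 * k₀ + 4 * L * suc k + x) + 23760 * B * u * L ≡⟨ lem₆ (100 * B * u) (60 * k₀ + 4 * L * suc k) x (23760 * B * u * L) ⟩
    100 * B * u * x + 23760 * B * u * L + 100 * B * u * (60 * k₀ + 4 * L * suc k) ∎)
    where
    lem₆ : ∀ c p x q → c * (p + x) + q ≡ c * x + q + c * p
    lem₆ = solve-∀
  lem : ∀ z B u k₀ L k ND → z + 1500 * B * u * k₀ * ND + 100 * B * u * L * (k * ND) ≡ z + 25 * (B * u) * (60 * k₀ + 4 * L * k) * ND
  lem = solve-∀
  lem₃ : ∀ B u x L M p ND → (100 * B * u * x + 23760 * B * u * L) * M + 25 * (B * u) * p * ND
    ≡ 25 * (B * u) * x * (4 * M) + (25 * (B * u) * p * ND + 23760 * B * u * L * M)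
  lem₃ = solve-∀
  lem₄ : ∀ w x p ND z → 25 * w * x * ND + (25 * w * p * ND + z) ≡ 25 * w * (p + x) * ND + z
  lem₄ = solve-∀
  lem₅ : ∀ B u L ND → 25 * (B * u) * (240 * L) * ND ≡ 6000 * B * u * L * ND
  lem₅ = solve-∀

-- Averaging over four independent weights

module _ (r : ℕ → ℕ) (N : ℕ) where
  open Tuples r

  cube : ℕ
  cube = N * N * N

  ∑⁴ : (ℕ → ℕ → ℕ → ℕ → ℕ) → ℕ
  ∑⁴ g = ∑ N (λ i → ∑ N (λ j → ∑ N (λ k → ∑ N (λ l → g (r i) (r j) (r k) (r l)))))

  ∑⁴-mono : ∀ {f g} U → (∀ i → i < N → r i ≤ U) →
    (∀ a b c d → a ≤ U → b ≤ U → c ≤ U → d ≤ U → f a b c d ≤ g a b c d) → ∑⁴ f ≤ ∑⁴ g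
  ∑⁴-mono U r≤ h = ∑-mono N (λ i p → ∑-mono N (λ j q → ∑-mono N (λ k s → ∑-mono N (λ l t →
    h _ _ _ _ (r≤ i p) (r≤ j q) (r≤ k s) (r≤ l t)))))

  ∑⁴-+ : ∀ f g → ∑⁴ (λ a b c d → f a b c d + g a b c d) ≡ ∑⁴ f + ∑⁴ g
  ∑⁴-+ f g = trans (∑-cong N (λ i _ → trans (∑-cong N (λ j _ → trans (∑-cong N (λ k _ → ∑-+ N _ _)) (∑-+ N _ _))) (∑-+ N _ _))) (∑-+ N _ _)

  ∑⁴-* : ∀ x f → ∑⁴ (λ a b c d → x * f a b c d) ≡ x * ∑⁴ f
  ∑⁴-* x f = trans (∑-cong N (λ i _ → trans (∑-cong N (λ j _ → trans (∑-cong N (λ k _ → ∑-*ˡ N x _)) (∑-*ˡ N x _))) (∑-*ˡ N x _))) (∑-*ˡ N x _)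

  private
    M : ℕ
    M = ∑ N r

  ∑⁴-first : ∀ (F : ℕ → ℕ → ℕ → ℕ) → ∑⁴ (λ a b c d → F b c d) ≡ N * ∑ N (λ i → ∑ N (λ j → ∑ N (λ k → F (r i) (r j) (r k))))
  ∑⁴-first F = ∑-const N _

  ∑⁴-second : ∀ (F : ℕ → ℕ → ℕ → ℕ) → ∑⁴ (λ a b c d → F a c d) ≡ N * ∑ N (λ i → ∑ N (λ j → ∑ N (λ k → F (r i) (r j) (r k))))
  ∑⁴-second F = trans (∑-cong N (λ i _ → ∑-const N _)) (∑-*ˡ N N _)

  ∑⁴-third : ∀ (F : ℕ → ℕ → ℕ → ℕ) → ∑⁴ (λ a b c d → F a b d) ≡ N * ∑ N (λ i → ∑ N (λ j → ∑ N (λ k → F (r i) (r j) (r k))))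
  ∑⁴-third F = trans (∑-cong N (λ i _ → trans (∑-cong N (λ j _ → ∑-const N _)) (∑-*ˡ N N _))) (∑-*ˡ N N _)

  ∑⁴-fourth : ∀ (F : ℕ → ℕ → ℕ → ℕ) → ∑⁴ (λ a b c d → F a b c) ≡ N * ∑ N (λ i → ∑ N (λ j → ∑ N (λ k → F (r i) (r j) (r k))))
  ∑⁴-fourth F = trans (∑-cong N (λ i _ → trans (∑-cong N (λ j _ → trans (∑-cong N (λ k _ → ∑-const N _)) (∑-*ˡ N N _))) (∑-*ˡ N N _))) (∑-*ˡ N N _)

  private
    cube≡ : N * (N * (N * M)) ≡ cube * M
    cube≡ = lem N M
      where
      lem : ∀ N M → N * (N * (N * M)) ≡ N * N * N * M
      lem = solve-∀
    constants : ∀ x → ∑ N (λ _ → ∑ N (λ _ → x)) ≡ N * (N * x)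
    constants x = trans (∑-const N _) (cong (N *_) (∑-const N x))

  ∑⁴-sum : ∑⁴ (λ a b c d → a + b + c + d) ≡ 4 * (cube * M)
  ∑⁴-sum = begin
    ∑⁴ (λ a b c d → a + b + c + d)
      ≡⟨ trans (∑⁴-+ (λ a b c d → a + b + c) (λ a b c d → d)) (cong (_+ ∑⁴ (λ a b c d → d))
          (trans (∑⁴-+ (λ a b c d → a + b) (λ a b c d → c)) (cong (_+ ∑⁴ (λ a b c d → c)) (∑⁴-+ (λ a b c d → a) (λ a b c d → b))))) ⟩
    ∑⁴ (λ a b c d → a) + ∑⁴ (λ a b c d → b) + ∑⁴ (λ a b c d → c) + ∑⁴ (λ a b c d → d)
      ≡⟨ cong₂ _+_ (cong₂ _+_ (cong₂ _+_
           (trans (∑⁴-fourth (λ a _ _ → a)) (cong (N *_) (trans (∑-cong N (λ i _ → constants (r i))) (trans (∑-*ˡ N N _) (cong (N *_) (∑-*ˡ N N r))))))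
           (trans (∑⁴-first (λ b _ _ → b)) (cong (N *_) (trans (∑-cong N (λ i _ → constants (r i))) (trans (∑-*ˡ N N _) (cong (N *_) (∑-*ˡ N N r)))))))
           (trans (∑⁴-first (λ _ c _ → c)) (cong (N *_) (trans (∑-const N _) (cong (N *_) (trans (∑-cong N (λ i _ → ∑-const N (r i))) (∑-*ˡ N N r)))))))
           (trans (∑⁴-first (λ _ _ d → d)) (cong (N *_) (constants M))) ⟩
    N * (N * (N * M)) + N * (N * (N * M)) + N * (N * (N * M)) + N * (N * (N * M))
      ≡⟨ cong₂ _+_ (cong₂ _+_ (cong₂ _+_ cube≡ cube≡) cube≡) cube≡ ⟩
    cube * M + cube * M + cube * M + cube * M
      ≡⟨ lem (cube * M) ⟩
    4 * (cube * M) ∎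
    where
    open ≡-Reasoning
    lem : ∀ x → x + x + x + x ≡ 4 * x
    lem = solve-∀

  ∑⁴-const : ∀ x → ∑⁴ (λ _ _ _ _ → x) ≡ N * cube * x
  ∑⁴-const x = trans (∑⁴-first (λ _ _ _ → x)) (trans (cong (N *_) (trans (∑-const N _) (cong (N *_) (constants x)))) (lem N x))
    where
    lem : ∀ N x → N * (N * (N * (N * x))) ≡ N * (N * N * N) * x
    lem = solve-∀

  heavy : ℕ → ℕ
  heavy Y = tuples N 4 (λ z → ⟦ Y ≤? z ⟧) 0

  heavy₃ : ℕ → ℕ
  heavy₃ δ = tuples N 3 (λ z → ⟦ δ ≤? z ⟧) 0

  ∑⁴-target : ∀ Y δ → ∑⁴ (target Y δ) ≡ 4 * (heavy Y + N * heavy₃ δ)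
  ∑⁴-target Y δ = begin
    ∑⁴ (target Y δ)
      ≡⟨ ∑⁴-+ (λ a b c d → 4 * ⟦ Y ≤? a + b + c + d ⟧) (triples δ) ⟩
    ∑⁴ (λ a b c d → 4 * ⟦ Y ≤? a + b + c + d ⟧) + ∑⁴ (triples δ)
      ≡⟨ cong₂ _+_ (∑⁴-* 4 (λ a b c d → ⟦ Y ≤? a + b + c + d ⟧))
          (trans (∑⁴-+ (λ a b c d → F b c d + F a c d + F a b d) (λ a b c d → F a b c)) (cong (_+ ∑⁴ (λ a b c d → F a b c))
          (trans (∑⁴-+ (λ a b c d → F b c d + F a c d) (λ a b c d → F a b d)) (cong (_+ ∑⁴ (λ a b c d → F a b d))
          (∑⁴-+ (λ a b c d → F b c d) (λ a b c d → F a c d)))))) ⟩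
    4 * heavy Y + (∑⁴ (λ a b c d → F b c d) + ∑⁴ (λ a b c d → F a c d) + ∑⁴ (λ a b c d → F a b d) + ∑⁴ (λ a b c d → F a b c))
      ≡⟨ cong (4 * heavy Y +_) (cong₂ _+_ (cong₂ _+_ (cong₂ _+_ (∑⁴-first F) (∑⁴-second F)) (∑⁴-third F)) (∑⁴-fourth F)) ⟩
    4 * heavy Y + (N * heavy₃ δ + N * heavy₃ δ + N * heavy₃ δ + N * heavy₃ δ)
      ≡⟨ lem (heavy Y) (N * heavy₃ δ) ⟩
    4 * (heavy Y + N * heavy₃ δ) ∎
    where
    open ≡-Reasoning
    F : ℕ → ℕ → ℕ → ℕ
    F a b c = ⟦ δ ≤? a + b + c ⟧
    lem : ∀ x z → 4 * x + (z + z + z + z) ≡ 4 * (x + z)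
    lem = solve-∀

  -- The bound on P(S₄ ≥ Y) + P(S₃ ≥ δ) with μ = `M / N`, multiplied by `100 * D * N ^ 4`.
  Estimate : (Y D δ : ℕ) → Set
  Estimate Y D δ = 25 * D * ∑⁴ (target Y δ) + 100 * (N * cube * δ) ≤ 100 * (N * cube * D) + 396 * (cube * M)

  estimate-linear : ∀ Y D δ U → δ ≤ D → (∀ i → i < N → r i ≤ U) → (100 * (D + δ) ≤ 99 * Y) ⊎ (4 * U < Y) → Estimate Y D δ
  estimate-linear Y D δ U δ≤D r≤ hyp = begin
    25 * D * ∑⁴ (target Y δ) + 100 * (N * cube * δ)
      ≡⟨ cong₂ _+_ (sym (∑⁴-* (25 * D) (target Y δ))) (trans (lem 100 (N * cube) δ) (sym (∑⁴-const (100 * δ)))) ⟩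
    ∑⁴ (λ a b c d → 25 * D * target Y δ a b c d) + ∑⁴ (λ _ _ _ _ → 100 * δ)
      ≡⟨ sym (∑⁴-+ (λ a b c d → 25 * D * target Y δ a b c d) (λ _ _ _ _ → 100 * δ)) ⟩
    ∑⁴ (λ a b c d → 25 * D * target Y δ a b c d + 100 * δ)
      ≤⟨ ∑⁴-mono {λ a b c d → 25 * D * target Y δ a b c d + 100 * δ} {λ a b c d → 100 * D + 99 * (a + b + c + d)} U r≤ (λ a b c d a≤ b≤ c≤ d≤ → target-linear Y D δ U a b c d δ≤D a≤ b≤ c≤ d≤ (light a≤ b≤ c≤ d≤ hyp)) ⟩
    ∑⁴ (λ a b c d → 100 * D + 99 * (a + b + c + d))
      ≡⟨ trans (∑⁴-+ (λ _ _ _ _ → 100 * D) (λ a b c d → 99 * (a + b + c + d))) (cong₂ _+_ (trans (∑⁴-const (100 * D)) (sym (lem 100 (N * cube) D)))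
           (trans (∑⁴-* 99 (λ a b c d → a + b + c + d)) (trans (cong (99 *_) ∑⁴-sum) (lem′ (cube * M))))) ⟩
    100 * (N * cube * D) + 396 * (cube * M) ∎
    where
    open ≤-Reasoning
    lem : ∀ k q x → k * (q * x) ≡ q * (k * x)
    lem = solve-∀
    lem′ : ∀ x → 99 * (4 * x) ≡ 396 * x
    lem′ = solve-∀
    light : ∀ {a b c d} → a ≤ U → b ≤ U → c ≤ U → d ≤ U → (100 * (D + δ) ≤ 99 * Y) ⊎ (4 * U < Y) →
      (100 * (D + δ) ≤ 99 * Y) ⊎ (a + b + c + d < Y)
    light _ _ _ _ (inj₁ p) = inj₁ p
    light a≤ b≤ c≤ d≤ (inj₂ p) = inj₂ (≤-<-trans (≤-trans (+-mono-≤ (+-mono-≤ (+-mono-≤ a≤ b≤) c≤) d≤) (≤-reflexive (four-fold U))) p)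
      where
      four-fold : ∀ x → x + x + x + x ≡ 4 * x
      four-fold = solve-∀

  -- The kernel values and their differences enter as variables tied by equations, so that the
  -- algebra below is independent of their numerals.
  module _ (K : Kernel) (i k u e k₀ k₁ k₂ k₃ k₄ d c₁ c₂ c₃ : ℕ)
    (k₀≡ : eval K 1 0 ≡ k₀) (k₁≡ : eval K 1 u ≡ k₁) (k₂≡ : eval K 1 (u + u) ≡ k₂)
    (k₃≡ : eval K 1 (u + u + u) ≡ k₃) (k₄≡ : eval K 1 (u + u + u + u) ≡ k₄)
    (valid : ValidAt i k K u e k₀ k₁ k₂ k₃ k₄ d c₁ c₂ c₃)
    (y D δ : ℕ) (0<y : 0 < y) (0<N : 0 < N)
    (D≤ : D ≤ suc i * y) (dy≤δ : low i k * y ≤ δ) (δ≤ : 60 * δ ≤ suc k * D)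
    (r≤ : ∀ j → j < N → r j ≤ u * y) (4M≤ : 4 * M ≤ N * D) where
    private
      a b B E L U V F H : ℕ
      a = suc i
      b = a + e
      B = b * b * b
      E = secant a e d c₁ c₂ c₃
      L = Kernel.L K
      U = u * y
      V = ∑ N (λ j → U ∸ r j)
      F = ∑⁴ (λ p q s t → eval K y (p + q + s + t))
      H = ∑⁴ (target (200 * y) δ)

      0<L : 0 < L
      0<L = proj₁ valid
      0<u : 0 < u
      0<u = proj₁ (proj₂ valid)
      dominates : Dominates u (low i k) K
      dominates = proj₁ (proj₂ (proj₂ valid))
      values : ConvexValues k₀ k₁ k₂ k₃ k₄ d c₁ c₂ c₃
      values = proj₁ (proj₂ (proj₂ (proj₂ valid)))
      mean : MeanBound a e k u L k₀ E
      mean = proj₂ (proj₂ (proj₂ (proj₂ valid)))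
      b≡4u : b ≡ 4 * u
      b≡4u = proj₁ mean
      intercept : 60 * k₀ + 4 * L * suc k ≤ 240 * L
      intercept = proj₁ (proj₂ mean)
      slope : 1500 * a * E + 100 * B * u * (60 * k₀ + 4 * L * suc k) ≤ 100 * B * u * (240 * L) + 23760 * B * u * L
      slope = proj₂ (proj₂ mean)

      V+M≡ : V + M ≡ N * U
      V+M≡ = complement-sum r N U r≤

      H≤F : L * y * H ≤ F
      H≤F = ≤-trans (≤-reflexive (sym (∑⁴-* (L * y) (target (200 * y) δ))))
        (∑⁴-mono {λ p q s t → L * y * target (200 * y) δ p q s t} {λ p q s t → eval K y (p + q + s + t)} U r≤ (λ p q s t p≤ q≤ s≤ t≤ → target≤eval K {u} {low i k} y δ p q s t dominates dy≤δ p≤ q≤ s≤ t≤))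

      -- The mean `M / N` is at most `D / 4`, hence at most `a * y / 4`. Dividing by `U = u * y`
      -- bounds p by `a / (4 * u)`, and `4 * u` is `a + e`.
      mean≤ : M * e ≤ a * V
      mean≤ = +-cancelʳ-≤ (a * M) (M * e) (a * V) (begin
        M * e + a * M        ≡⟨ lem M e a ⟩
        b * M                ≡⟨ cong (_* M) b≡4u ⟩
        4 * u * M            ≡⟨ lem₁ u M ⟩
        u * (4 * M)          ≤⟨ *-monoʳ-≤ u (≤-trans 4M≤ (*-monoʳ-≤ N D≤)) ⟩
        u * (N * (a * y))    ≡⟨ lem₂ u N a y ⟩
        a * (N * U)          ≡⟨ cong (a *_) (sym V+M≡) ⟩
        a * (V + M)          ≡⟨ *-distribˡ-+ a V M ⟩
        a * V + a * M        ∎)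
        where
        open ≤-Reasoning
        lem : ∀ M e a → M * e + a * M ≡ (a + e) * M
        lem = solve-∀
        lem₁ : ∀ u M → 4 * u * M ≡ u * (4 * M)
        lem₁ = solve-∀
        lem₂ : ∀ u N a y → u * (N * (a * y)) ≡ a * (N * (u * y))
        lem₂ = solve-∀

      binomial : ℕ → ℕ → ℕ → ℕ → ℕ → ℕ
      binomial x₀ x₁ x₂ x₃ x₄ = V * V * V * V * x₀ + 4 * (V * V * V * M * x₁) + 6 * (V * V * M * M * x₂)
        + 4 * (V * M * M * M * x₃) + M * M * M * M * x₄

      F≤binomial : U ^ 4 * F ≤ binomial k₀ k₁ k₂ k₃ k₄ * y
      F≤binomial = begin
        U ^ 4 * F
          ≤⟨ tuples≤twoPoints r N U r≤ 4 0 (chordal-eval K U y) ⟩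
        twoPoints U V M 4 f 0
          ≡⟨ expand V M (f 0) (f U) (f (U + U)) (f (U + U + U)) (f (U + U + U + U)) ⟩
        binomial (f 0) (f U) (f (U + U)) (f (U + U + U)) (f (U + U + U + U))
          ≡⟨ cong₂ _+_ (cong₂ _+_ (cong₂ _+_ (cong₂ _+_
               (cong (V * V * V * V *_) (at 0 refl k₀≡))
               (cong (λ x → 4 * (V * V * V * M * x)) (at u refl k₁≡)))
               (cong (λ x → 6 * (V * V * M * M * x)) (at (u + u) (*-distribʳ-+ y u u) k₂≡)))
               (cong (λ x → 4 * (V * M * M * M * x)) (at (u + u + u) (three-fold u y) k₃≡)))
               (cong (M * M * M * M *_) (at (u + u + u + u) (four-fold u y) k₄≡)) ⟩
        binomial (k₀ * y) (k₁ * y) (k₂ * y) (k₃ * y) (k₄ * y)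
          ≡⟨ collect V M y k₀ k₁ k₂ k₃ k₄ ⟩
        binomial k₀ k₁ k₂ k₃ k₄ * y ∎
        where
        open ≤-Reasoning
        f : ℕ → ℕ
        f = eval K y
        at : ∀ x {z v} → x * y ≡ z → eval K 1 x ≡ v → f z ≡ v * y
        at x refl refl = eval-scale K y x
        three-fold : ∀ u y → (u + u + u) * y ≡ u * y + u * y + u * y
        three-fold = solve-∀
        four-fold : ∀ u y → (u + u + u + u) * y ≡ u * y + u * y + u * y + u * y
        four-fold = solve-∀
        expand : ∀ V M f₀ f₁ f₂ f₃ f₄ →
          V * (V * (V * (V * f₀ + M * f₁) + M * (V * f₁ + M * f₂)) + M * (V * (V * f₁ + M * f₂) + M * (V * f₂ + M * f₃)))
          + M * (V * (V * (V * f₁ + M * f₂) + M * (V * f₂ + M * f₃)) + M * (V * (V * f₂ + M * f₃) + M * (V * f₃ + M * f₄)))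
          ≡ V * V * V * V * f₀ + 4 * (V * V * V * M * f₁) + 6 * (V * V * M * M * f₂) + 4 * (V * M * M * M * f₃) + M * M * M * M * f₄
        expand = solve-∀
        collect : ∀ V M y k₀ k₁ k₂ k₃ k₄ →
          V * V * V * V * (k₀ * y) + 4 * (V * V * V * M * (k₁ * y)) + 6 * (V * V * M * M * (k₂ * y)) + 4 * (V * M * M * M * (k₃ * y)) + M * M * M * M * (k₄ * y)
          ≡ (V * V * V * V * k₀ + 4 * (V * V * V * M * k₁) + 6 * (V * V * M * M * k₂) + 4 * (V * M * M * M * k₃) + M * M * M * M * k₄) * y
        collect = solve-∀

      B*F≤ : B * u * F ≤ cube * (B * k₀ * (N * U) + M * E)
      B*F≤ = *-cancelˡ-≤ (U * U * U * y) {{>-nonZero 0<UUUy}} (begin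
        U * U * U * y * (B * u * F)
          ≡⟨ lem U y B u F ⟩
        B * (U * (U * (U * (u * y * 1))) * F)
          ≤⟨ *-monoʳ-≤ B F≤binomial ⟩
        B * (binomial k₀ k₁ k₂ k₃ k₄ * y)
          ≡⟨ sym (*-assoc B (binomial k₀ k₁ k₂ k₃ k₄) y) ⟩
        B * binomial k₀ k₁ k₂ k₃ k₄ * y
          ≡⟨ cong (λ x → B * x * y) (cong₂ _+_ (cong₂ _+_ (cong₂ _+_ (cong (V * V * V * V * k₀ +_)
               (cong (λ x → 4 * (V * V * V * M * x)) (proj₁ values)))
               (cong (λ x → 6 * (V * V * M * M * x)) (proj₁ (proj₂ values))))
               (cong (λ x → 4 * (V * M * M * M * x)) (proj₁ (proj₂ (proj₂ values)))))
               (cong (M * M * M * M *_) (proj₂ (proj₂ (proj₂ values))))) ⟩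
        B * binomial k₀ (k₀ + d) (k₀ + 2 * d + c₁) (k₀ + 3 * d + 2 * c₁ + c₂) (k₀ + 4 * d + 3 * c₁ + 2 * c₂ + c₃) * y
          ≤⟨ *-monoˡ-≤ y (binomial≤secant V M a e k₀ d c₁ c₂ c₃ mean≤) ⟩
        (V + M) * (V + M) * (V + M) * (B * k₀ * (V + M) + M * E) * y
          ≡⟨ cong (λ Q → Q * Q * Q * (B * k₀ * Q + M * E) * y) V+M≡ ⟩
        N * U * (N * U) * (N * U) * (B * k₀ * (N * U) + M * E) * y
          ≡⟨ lem₂ N U (B * k₀ * (N * U) + M * E) y ⟩
        U * U * U * y * (cube * (B * k₀ * (N * U) + M * E)) ∎)
        where
        open ≤-Reasoning
        0<U : 0 < U
        0<U = 0<* 0<u 0<y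
        0<UUUy : 0 < U * U * U * y
        0<UUUy = 0<* (0<* (0<* 0<U 0<U) 0<U) 0<y
        lem : ∀ U y B u F → U * U * U * y * (B * u * F) ≡ B * (U * (U * (U * (u * y * 1))) * F)
        lem = solve-∀
        lem₂ : ∀ N U x y → N * U * (N * U) * (N * U) * x * y ≡ U * U * U * y * (N * N * N * x)
        lem₂ = solve-∀

      gain : 1500 * a * E * M + 1500 * B * u * k₀ * (N * D) + 100 * B * u * L * (suc k * (N * D))
        ≤ 6000 * B * u * L * (N * D) + 23760 * B * u * L * M
      gain = slope-gain a E M B u k₀ L k (N * D) 4M≤ intercept slope

    estimate-cell : Estimate (200 * y) D δ
    estimate-cell = *-cancelˡ-≤ (60 * (B * u * (L * y))) {{>-nonZero 0<c}} (begin
      60 * (B * u * (L * y)) * (25 * D * H + 100 * (N * cube * δ))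
        ≡⟨ lem₁ B u L y D H N cube δ ⟩
      1500 * D * (B * u * (L * y * H)) + 100 * B * u * L * y * N * cube * (60 * δ)
        ≤⟨ +-mono-≤ (*-monoʳ-≤ (1500 * D) (≤-trans (*-monoʳ-≤ (B * u) H≤F) B*F≤)) (*-monoʳ-≤ (100 * B * u * L * y * N * cube) δ≤) ⟩
      1500 * D * (cube * (B * k₀ * (N * U) + M * E)) + 100 * B * u * L * y * N * cube * (suc k * D)
        ≡⟨ lem₂ D cube B k₀ N u y M E L (suc k) ⟩
      1500 * cube * M * E * D + cube * y * (1500 * B * u * k₀ * (N * D) + 100 * B * u * L * (suc k * (N * D)))
        ≤⟨ +-monoˡ-≤ _ (*-monoʳ-≤ (1500 * cube * M * E) D≤) ⟩
      1500 * cube * M * E * (a * y) + cube * y * (1500 * B * u * k₀ * (N * D) + 100 * B * u * L * (suc k * (N * D)))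
        ≡⟨ lem₃ cube y M E a (1500 * B * u * k₀ * (N * D)) (100 * B * u * L * (suc k * (N * D))) ⟩
      cube * y * (1500 * a * E * M + 1500 * B * u * k₀ * (N * D) + 100 * B * u * L * (suc k * (N * D)))
        ≤⟨ *-monoʳ-≤ (cube * y) gain ⟩
      cube * y * (6000 * B * u * L * (N * D) + 23760 * B * u * L * M)
        ≡⟨ lem₄ cube y B u L N D M ⟩
      60 * (B * u * (L * y)) * (100 * (N * cube * D) + 396 * (cube * M)) ∎)
      where
      open ≤-Reasoning
      0<b : 0 < b
      0<b = s≤s z≤n
      0<c : 0 < 60 * (B * u * (L * y))
      0<c = 0<* {60} (s≤s z≤n) (0<* (0<* (0<* (0<* 0<b 0<b) 0<b) 0<u) (0<* 0<L 0<y))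
      lem₁ : ∀ B u L y D H N q δ → 60 * (B * u * (L * y)) * (25 * D * H + 100 * (N * q * δ))
        ≡ 1500 * D * (B * u * (L * y * H)) + 100 * B * u * L * y * N * q * (60 * δ)
      lem₁ = solve-∀
      lem₂ : ∀ D q B k₀ N u y M E L k → 1500 * D * (q * (B * k₀ * (N * (u * y)) + M * E)) + 100 * B * u * L * y * N * q * (k * D)
        ≡ 1500 * q * M * E * D + q * y * (1500 * B * u * k₀ * (N * D) + 100 * B * u * L * (k * (N * D)))
      lem₂ = solve-∀
      lem₃ : ∀ q y M E a s t → 1500 * q * M * E * (a * y) + q * y * (s + t) ≡ q * y * (1500 * a * E * M + s + t)
      lem₃ = solve-∀
      lem₄ : ∀ q y B u L N D M → q * y * (6000 * B * u * L * (N * D) + 23760 * B * u * L * M)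
        ≡ 60 * (B * u * (L * y)) * (100 * (N * q * D) + 396 * (q * M))
      lem₄ = solve-∀

  estimate-in-cell : ∀ i k → i < 151 → k < 60 → Nonlinear i k → ∀ y D δ → 0 < y → 0 < N →
    D ≤ suc i * y → low i k * y ≤ δ → 60 * δ ≤ suc k * D →
    (∀ j → j < N → r j ≤ gap i * y) → 4 * M ≤ N * D → Estimate (200 * y) D δ
  estimate-in-cell i k i<151 k<60 nonlinear y D δ 0<y 0<N D≤ dy≤δ δ≤ r≤ 4M≤ = go (cell-kernel i k i<151 k<60 nonlinear)
    where
    go : ∃ (Valid i k) → Estimate (200 * y) D δ
    go (K , valid) = estimate-cell K i k (gap i) _ _ _ _ _ _ _ _ _ _ refl refl refl refl refl valid
      y D δ 0<y 0<N D≤ dy≤δ δ≤ r≤ 4M≤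

  -- k is 60 δ / D rounded down, except that δ = D belongs to cell 59.
  cell-index : ∀ {D δ} → 0 < D → δ ≤ D → ∃ λ k → k < 60 × k * D ≤ 60 * δ × 60 * δ ≤ suc k * D
  cell-index {D} {δ} 0<D δ≤D = search 59 ≤-refl (*-monoʳ-≤ 60 δ≤D)
    where
    search : ∀ k → k < 60 → 60 * δ ≤ suc k * D → ∃ λ k → k < 60 × k * D ≤ 60 * δ × 60 * δ ≤ suc k * D
    search zero    p q = 0 , p , z≤n , q
    search (suc k) p q with suc k * D ≤? 60 * δ
    ... | yes h = suc k , p , h , q
    ... | no ¬h = search k (<-trans (n<1+n k) p) (<⇒≤ (≰⇒> ¬h))

  estimate : ∀ y D δ τ → 0 < N → 0 < D → 0 < y → τ + D ≡ 200 * y → δ ≤ D →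
    (∀ j → j < N → r j ≤ τ) → 4 * M ≤ N * D → Estimate (200 * y) D δ
  estimate y D δ τ 0<N 0<D 0<y τ+D≡ δ≤D r≤ 4M≤ =
    by-cases (100 * (D + δ) ≤? 99 * (200 * y)) (4 * τ <? 200 * y)
    where
    open ≤-Reasoning
    instance
      y≢0 : NonZero y
      y≢0 = >-nonZero 0<y
    i : ℕ
    i = D ℕ./ y
    iy≤D : i * y ≤ D
    iy≤D = m/n*n≤m D y
    D<y+iy : D < suc i * y
    D<y+iy = begin-strict
      D                  ≡⟨ m≡m%n+[m/n]*n D y ⟩
      D ℕ.% y + i * y    <⟨ +-monoˡ-< (i * y) (m%n<n D y) ⟩
      y + i * y          ∎
    module _ (¬p : ¬ (100 * (D + δ) ≤ 99 * (200 * y))) (¬q : ¬ (4 * τ < 200 * y)) where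
      D<151y : D < 151 * y
      D<151y = *-cancelˡ-< 4 D (151 * y) (begin-strict
        -- The case assumption yields only `D ≤ 150 * y`; the summand `4 * y` makes the bound with
        -- 151 strict.
        4 * D            <⟨ +-monoˡ-< (4 * D) (*-monoʳ-< 4 0<y) ⟩
        4 * y + 4 * D    ≤⟨ +-cancelˡ-≤ (200 * y) _ _ (begin
          200 * y + (4 * y + 4 * D)     ≤⟨ +-monoˡ-≤ _ (≮⇒≥ ¬q) ⟩
          4 * τ + (4 * y + 4 * D)       ≡⟨ lem τ y D ⟩
          4 * (τ + D) + 4 * y           ≡⟨ cong (λ x → 4 * x + 4 * y) τ+D≡ ⟩
          4 * (200 * y) + 4 * y         ≡⟨ lem′ y ⟩
          200 * y + 4 * (151 * y)       ∎) ⟩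
        4 * (151 * y)    ∎)
        where
        lem : ∀ τ y D → 4 * τ + (4 * y + 4 * D) ≡ 4 * (τ + D) + 4 * y
        lem = solve-∀
        lem′ : ∀ y → 4 * (200 * y) + 4 * y ≡ 200 * y + 4 * (151 * y)
        lem′ = solve-∀
      i<151 : i < 151
      i<151 = m<n*o⇒m/o<n D<151y
      index : ∃ λ k → k < 60 × k * D ≤ 60 * δ × 60 * δ ≤ suc k * D
      index = cell-index 0<D δ≤D
      k : ℕ
      k = proj₁ index
      k<60 : k < 60
      k<60 = proj₁ (proj₂ index)
      nonlinear : Nonlinear i k
      nonlinear = *-cancelʳ-< y (19800 * 60) (100 * (suc i * (61 + k))) (begin-strict
        19800 * 60 * y                   ≡⟨ lem y ⟩
        60 * (99 * (200 * y))            <⟨ *-monoʳ-< 60 (≰⇒> ¬p) ⟩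
        60 * (100 * (D + δ))             ≡⟨ lem₁ D δ ⟩
        100 * (60 * D + 60 * δ)          ≤⟨ *-monoʳ-≤ 100 (+-monoʳ-≤ (60 * D) (proj₂ (proj₂ (proj₂ index)))) ⟩
        100 * (60 * D + suc k * D)       ≡⟨ lem₂ D k ⟩
        100 * (61 + k) * D               ≤⟨ *-monoʳ-≤ (100 * (61 + k)) (<⇒≤ D<y+iy) ⟩
        100 * (61 + k) * (suc i * y)     ≡⟨ lem₃ (61 + k) (suc i) y ⟩
        100 * (suc i * (61 + k)) * y     ∎)
        where
        lem : ∀ y → 19800 * 60 * y ≡ 60 * (99 * (200 * y))
        lem = solve-∀
        lem₁ : ∀ D δ → 60 * (100 * (D + δ)) ≡ 100 * (60 * D + 60 * δ)
        lem₁ = solve-∀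
        lem₂ : ∀ D k → 100 * (60 * D + suc k * D) ≡ 100 * (61 + k) * D
        lem₂ = solve-∀
        lem₃ : ∀ k i y → 100 * k * (i * y) ≡ 100 * (i * k) * y
        lem₃ = solve-∀
      low≤δ : low i k * y ≤ δ
      low≤δ = /-scale≤ (k * i) 60 δ y (begin
        k * i * y     ≡⟨ *-assoc k i y ⟩
        k * (i * y)   ≤⟨ *-monoʳ-≤ k iy≤D ⟩
        k * D         ≤⟨ proj₁ (proj₂ (proj₂ index)) ⟩
        60 * δ        ∎)
      τ≤ : τ ≤ gap i * y
      τ≤ = begin
        τ                     ≡⟨ sym (m+n∸n≡m τ D) ⟩
        τ + D ∸ D             ≤⟨ ∸-monoʳ-≤ (τ + D) iy≤D ⟩
        τ + D ∸ i * y         ≡⟨ cong (_∸ i * y) τ+D≡ ⟩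
        200 * y ∸ i * y       ≡⟨ sym (*-distribʳ-∸ y 200 i) ⟩
        gap i * y             ∎
      nonlinear-case : Estimate (200 * y) D δ
      nonlinear-case = estimate-in-cell i k i<151 k<60 nonlinear y D δ 0<y 0<N (<⇒≤ D<y+iy) low≤δ
        (proj₂ (proj₂ (proj₂ index))) (λ j j<N → ≤-trans (r≤ j j<N) τ≤) 4M≤
    by-cases : Dec (100 * (D + δ) ≤ 99 * (200 * y)) → Dec (4 * τ < 200 * y) → Estimate (200 * y) D δ
    by-cases (yes p) _       = estimate-linear (200 * y) D δ τ δ≤D r≤ (inj₁ p)
    by-cases (no _)  (yes q) = estimate-linear (200 * y) D δ τ δ≤D r≤ (inj₂ q)
    by-cases (no ¬p) (no ¬q) = nonlinear-case ¬p ¬q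

-- Weighted counting

-- Adds the estimates at δ over the s heavy vertices and at 0 with multiplicity N − 4 s.
combine-estimates : ∀ x s q M D P R Δ → let N = 4 * s + x in 0 < N →
  25 * D * (s * P + N * R) + 25 * (N * q * Δ) ≤ s * (25 * (N * q * D) + 99 * (q * M)) →
  25 * D * P ≤ 99 * (q * M) → M ≤ Δ → D * P ≤ 4 * (q * M) →
  D * (101 * P + 400 * R) ≤ D * (400 * (s * q))
combine-estimates x s q M D P R Δ 0<N sumEst zeroEst M≤Δ markov = +-cancelʳ-≤ (4 * (q * M)) _ _ (begin
  D * (101 * P + 400 * R) + 4 * (q * M)                          ≡⟨ lem₁ D P R (q * M) ⟩
  4 * (25 * D * P + 100 * D * R + q * M) + D * P                 ≤⟨ +-mono-≤ (*-monoʳ-≤ 4 main) markov ⟩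
  4 * (100 * (s * q * D)) + 4 * (q * M)                          ≡⟨ lem₂ s q D (4 * (q * M)) ⟩
  D * (400 * (s * q)) + 4 * (q * M)                              ∎)
  where
  open ≤-Reasoning
  N : ℕ
  N = 4 * s + x
  lem₁ : ∀ D P R z → D * (101 * P + 400 * R) + 4 * z ≡ 4 * (25 * D * P + 100 * D * R + z) + D * P
  lem₁ = solve-∀
  lem₂ : ∀ s q D z → 4 * (100 * (s * q * D)) + z ≡ D * (400 * (s * q)) + z
  lem₂ = solve-∀
  main : 25 * D * P + 100 * D * R + q * M ≤ 100 * (s * q * D)
  main = *-cancelˡ-≤ N {{>-nonZero 0<N}} (+-cancelʳ-≤ (99 * (N * (q * M))) _ _ (begin
    N * (25 * D * P + 100 * D * R + q * M) + 99 * (N * (q * M))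
      ≡⟨ e₁ x s q M D P R ⟩
    4 * (25 * D * (s * P + N * R) + 25 * (N * q * M)) + x * (25 * D * P)
      ≤⟨ +-mono-≤ (*-monoʳ-≤ 4 (≤-trans (+-monoʳ-≤ (25 * D * (s * P + N * R)) (*-monoʳ-≤ 25 (*-monoʳ-≤ (N * q) M≤Δ))) sumEst)) (*-monoʳ-≤ x zeroEst) ⟩
    4 * (s * (25 * (N * q * D) + 99 * (q * M))) + x * (99 * (q * M))
      ≡⟨ e₂ x s q M D ⟩
    N * (100 * (s * q * D)) + 99 * (N * (q * M)) ∎))
    where
    e₁ : ∀ x s q M D P R → (4 * s + x) * (25 * D * P + 100 * D * R + q * M) + 99 * ((4 * s + x) * (q * M))
      ≡ 4 * (25 * D * (s * P + (4 * s + x) * R) + 25 * ((4 * s + x) * q * M)) + x * (25 * D * P)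
    e₁ = solve-∀
    e₂ : ∀ x s q M D → 4 * (s * (25 * ((4 * s + x) * q * D) + 99 * (q * M))) + x * (99 * (q * M))
      ≡ (4 * s + x) * (100 * (s * q * D)) + 99 * ((4 * s + x) * (q * M))
    e₂ = solve-∀

module _ (r : ℕ → ℕ) (N : ℕ) where
  open Tuples r

  private
    M q : ℕ
    M = ∑ N r
    q = cube r N

  -- Markov's inequality for a sum of four weights. Because `D ≤ Y`, it converts the slack of 99
  -- against 100 in the estimates into the 101 against 100 of the conclusion.
  markov : ∀ Y → Y * heavy r N Y ≤ 4 * (q * M)
  markov Y = begin
    Y * heavy r N Y                                     ≡⟨ sym (∑⁴-* r N Y F) ⟩
    ∑⁴ r N (λ a b c d → Y * F a b c d)                  ≤⟨ ∑⁴-mono r N {λ a b c d → Y * F a b c d} {λ a b c d → a + b + c + d} M (λ i i<N → term≤∑ r i<N) (λ a b c d _ _ _ _ → pointwise (a + b + c + d)) ⟩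
    ∑⁴ r N (λ a b c d → a + b + c + d)                  ≡⟨ ∑⁴-sum r N ⟩
    4 * (q * M)                                         ∎
    where
    open ≤-Reasoning
    F : ℕ → ℕ → ℕ → ℕ → ℕ
    F a b c d = ⟦ Y ≤? a + b + c + d ⟧
    pointwise : ∀ z → Y * ⟦ Y ≤? z ⟧ ≤ z
    pointwise z with Y ≤? z
    ... | yes Y≤z = ≤-trans (≤-reflexive (*-identityʳ Y)) Y≤z
    ... | no _    = ≤-trans (≤-reflexive (*-zeroʳ Y)) z≤n

  ∑³-one : ∀ (F : ℕ → ℕ) → (∀ z → F z ≡ 1) → tuples N 3 F 0 ≡ q
  ∑³-one F F≡1 = trans (∑-cong N (λ i _ → trans (∑-cong N (λ j _ → trans (∑-cong N (λ k _ → F≡1 _)) (∑-const N 1))) (∑-const N (N * 1)))) (trans (∑-const N (N * (N * 1))) (lem N))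
    where
    lem : ∀ N → N * (N * (N * 1)) ≡ N * N * N
    lem = solve-∀

  heavy₃-0 : heavy₃ r N 0 ≡ q
  heavy₃-0 = ∑³-one (λ z → ⟦ 0 ≤? z ⟧) (λ z → ⟦⟧-yes (0 ≤? z) z≤n)

  heavy₃≤cube : ∀ δ → heavy₃ r N δ ≤ q
  heavy₃≤cube δ = ≤-trans (∑-mono N (λ i _ → ∑-mono N (λ j _ → ∑-mono N (λ k _ → ⟦⟧≤1 (δ ≤? r i + r j + r k)))))
    (≤-reflexive (∑³-one (λ _ → 1) (λ _ → refl)))

  -- The alternative `D ≡ 0` comes from truncated subtraction, when all of T already weighs Y. Then
  -- the deficits and with them `M` vanish, and by Markov nothing is heavy.
  heavy-bound : ∀ s y D τ (δ : ℕ → ℕ) → 0 < N → 0 < y → 4 * s ≤ N → τ + D ≡ 200 * y ⊎ D ≡ 0 →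
    (∀ t → t < s → δ t ≤ D) → (∀ j → j < N → r j ≤ τ) → M ≤ ∑ s δ →
    101 * heavy r N (200 * y) + 400 * ∑ s (λ t → heavy₃ r N (δ t)) ≤ 400 * (s * q)
  heavy-bound s y zero τ δ 0<N 0<y 4s≤N _ δ≤ r≤ M≤ = begin
    101 * heavy r N (200 * y) + 400 * ∑ s (λ t → heavy₃ r N (δ t))
      ≡⟨ cong (λ z → 101 * z + 400 * ∑ s (λ t → heavy₃ r N (δ t))) heavy≡0 ⟩
    400 * ∑ s (λ t → heavy₃ r N (δ t))
      ≤⟨ *-monoʳ-≤ 400 (∑-≤const s q (λ t _ → heavy₃≤cube (δ t))) ⟩
    400 * (s * q) ∎
    where
    open ≤-Reasoning
    M≡0 : M ≡ 0
    M≡0 = n≤0⇒n≡0 (≤-trans M≤ (≤-trans (∑-≤const s 0 δ≤) (≤-reflexive (*-zeroʳ s))))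
    heavy≡0 : heavy r N (200 * y) ≡ 0
    heavy≡0 = n≤0⇒n≡0 (*-cancelˡ-≤ (200 * y) {{>-nonZero (0<* {200} (s≤s z≤n) 0<y)}} (begin
      200 * y * heavy r N (200 * y)   ≤⟨ markov (200 * y) ⟩
      4 * (q * M)                     ≡⟨ cong (λ z → 4 * (q * z)) M≡0 ⟩
      4 * (q * 0)                     ≡⟨ cong (4 *_) (*-zeroʳ q) ⟩
      0                               ≡⟨ sym (*-zeroʳ (200 * y)) ⟩
      200 * y * 0                     ∎))
  heavy-bound s y D@(suc _) τ δ 0<N 0<y 4s≤N (inj₁ τ+D≡) δ≤ r≤ M≤ =
    *-cancelˡ-≤ D (bound (N ∸ 4 * s) (m+[n∸m]≡n 4s≤N))
    where
    open ≤-Reasoning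
    P : ℕ
    P = heavy r N (200 * y)
    R : ℕ → ℕ
    R t = heavy₃ r N (δ t)
    4M≤ : 4 * M ≤ N * D
    4M≤ = begin
      4 * M          ≤⟨ *-monoʳ-≤ 4 (≤-trans M≤ (∑-≤const s D δ≤)) ⟩
      4 * (s * D)    ≡⟨ sym (*-assoc 4 s D) ⟩
      4 * s * D      ≤⟨ *-monoˡ-≤ D 4s≤N ⟩
      N * D          ∎
    at : ∀ δ → δ ≤ D → 25 * D * (P + N * heavy₃ r N δ) + 25 * (N * q * δ) ≤ 25 * (N * q * D) + 99 * (q * M)
    at δ δ≤D = *-cancelˡ-≤ 4 (begin
      4 * (25 * D * (P + N * heavy₃ r N δ) + 25 * (N * q * δ))
        ≡⟨ lem D (P + N * heavy₃ r N δ) (N * q * δ) ⟩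
      25 * D * (4 * (P + N * heavy₃ r N δ)) + 100 * (N * q * δ)
        ≡⟨ cong (λ z → 25 * D * z + 100 * (N * q * δ)) (sym (∑⁴-target r N (200 * y) δ)) ⟩
      25 * D * ∑⁴ r N (target (200 * y) δ) + 100 * (N * q * δ)
        ≤⟨ estimate r N y D δ τ 0<N (s≤s z≤n) 0<y τ+D≡ δ≤D r≤ 4M≤ ⟩
      100 * (N * q * D) + 396 * (q * M)
        ≡⟨ lem′ (N * q * D) (q * M) ⟩
      4 * (25 * (N * q * D) + 99 * (q * M)) ∎)
      where
      lem : ∀ D z x → 4 * (25 * D * z + 25 * x) ≡ 25 * D * (4 * z) + 100 * x
      lem = solve-∀
      lem′ : ∀ x z → 100 * x + 396 * z ≡ 4 * (25 * x + 99 * z)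
      lem′ = solve-∀
    -- At `δ = 0` every triple is heavy, so its contribution cancels the constant term.
    zeroEst : 25 * D * P ≤ 99 * (q * M)
    zeroEst = +-cancelˡ-≤ (25 * (N * q * D)) _ _ (begin
      25 * (N * q * D) + 25 * D * P                           ≡⟨ lem N q D P ⟩
      25 * D * (P + N * q) + 25 * (N * q * 0)                 ≡⟨ cong (λ z → 25 * D * (P + N * z) + 25 * (N * q * 0)) (sym heavy₃-0) ⟩
      25 * D * (P + N * heavy₃ r N 0) + 25 * (N * q * 0)      ≤⟨ at 0 z≤n ⟩
      25 * (N * q * D) + 99 * (q * M)                         ∎)
      where
      lem : ∀ N q D P → 25 * (N * q * D) + 25 * D * P ≡ 25 * D * (P + N * q) + 25 * (N * q * 0)
      lem = solve-∀
    sumEst : 25 * D * (s * P + N * ∑ s R) + 25 * (N * q * ∑ s δ) ≤ s * (25 * (N * q * D) + 99 * (q * M))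
    sumEst = begin
      25 * D * (s * P + N * ∑ s R) + 25 * (N * q * ∑ s δ)
        ≡⟨ lem D (s * P) (N * ∑ s R) (N * q) (∑ s δ) ⟩
      25 * D * (s * P + N * ∑ s R) + 25 * (N * q) * ∑ s δ
        ≡⟨ cong₂ _+_ (cong (25 * D *_) (cong₂ _+_ (sym (∑-const s P)) (sym (∑-*ˡ s N R)))) (sym (∑-*ˡ s (25 * (N * q)) δ)) ⟩
      25 * D * (∑ s (λ _ → P) + ∑ s (λ t → N * R t)) + ∑ s (λ t → 25 * (N * q) * δ t)
        ≡⟨ cong (_+ ∑ s (λ t → 25 * (N * q) * δ t)) (trans (cong (25 * D *_) (sym (∑-+ s (λ _ → P) (λ t → N * R t)))) (sym (∑-*ˡ s (25 * D) (λ t → P + N * R t)))) ⟩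
      ∑ s (λ t → 25 * D * (P + N * R t)) + ∑ s (λ t → 25 * (N * q) * δ t)
        ≡⟨ sym (∑-+ s (λ t → 25 * D * (P + N * R t)) (λ t → 25 * (N * q) * δ t)) ⟩
      ∑ s (λ t → 25 * D * (P + N * R t) + 25 * (N * q) * δ t)
        ≤⟨ ∑-≤const s _ (λ t t<s → ≤-trans (≤-reflexive (cong (25 * D * (P + N * R t) +_) (*-assoc 25 (N * q) (δ t)))) (at (δ t) (δ≤ t t<s))) ⟩
      s * (25 * (N * q * D) + 99 * (q * M)) ∎
      where
      lem : ∀ D x z w v → 25 * D * (x + z) + 25 * (w * v) ≡ 25 * D * (x + z) + 25 * w * v
      lem = solve-∀
    D*P≤ : D * P ≤ 4 * (q * M)
    D*P≤ = ≤-trans (*-monoˡ-≤ P (≤-trans (m≤n+m D τ) (≤-reflexive τ+D≡))) (markov (200 * y))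
    bound : ∀ x → 4 * s + x ≡ N → D * (101 * P + 400 * ∑ s R) ≤ D * (400 * (s * q))
    bound x eq = combine-estimates x s q M D P (∑ s R) (∑ s δ) (subst (0 <_) (sym eq) 0<N)
      (subst (λ n → 25 * D * (s * P + n * ∑ s R) + 25 * (n * q * ∑ s δ) ≤ s * (25 * (n * q * D) + 99 * (q * M))) (sym eq) sumEst)
      zeroEst M≤ D*P≤

  pairs-count : ∀ n z → 2 * subsets n 2 (λ _ → 1) z + n ≡ n * n
  pairs-count zero    z = refl
  pairs-count (suc n) z = begin
    2 * (p + ∑ n (λ _ → 1)) + suc n   ≡⟨ cong (λ x → 2 * (p + x) + suc n) (trans (∑-const n 1) (*-identityʳ n)) ⟩
    2 * (p + n) + suc n               ≡⟨ lem p n ⟩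
    (2 * p + n) + suc (n + n)         ≡⟨ cong (_+ suc (n + n)) (pairs-count n z) ⟩
    n * n + suc (n + n)               ≡⟨ lem′ n ⟩
    suc n * suc n                     ∎
    where
    open ≡-Reasoning
    p : ℕ
    p = subsets n 2 (λ _ → 1) z
    lem : ∀ p n → 2 * (p + n) + suc n ≡ (2 * p + n) + suc (n + n)
    lem = solve-∀
    lem′ : ∀ n → n * n + suc (n + n) ≡ suc n * suc n
    lem′ = solve-∀

  triples-count : ∀ n z → n * n * n ≤ 6 * subsets n 3 (λ _ → 1) z + 3 * (n * n)
  triples-count zero    z = z≤n
  triples-count (suc n) z = begin
    suc n * suc n * suc n                            ≡⟨ lem n ⟩
    n * n * n + (3 * (n * n) + 3 * n + 1)            ≤⟨ +-mono-≤ (triples-count n z) (+-monoʳ-≤ (3 * (n * n) + 3 * n) (s≤s (z≤n {2}))) ⟩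
    6 * t + 3 * (n * n) + (3 * (n * n) + 3 * n + 3)  ≡⟨ cong (λ x → 6 * t + 3 * x + (3 * (n * n) + 3 * n + 3)) (sym (pairs-count n (z + r n))) ⟩
    6 * t + 3 * (2 * p + n) + (3 * (n * n) + 3 * n + 3) ≡⟨ lem′ t p n ⟩
    6 * (t + p) + 3 * (suc n * suc n)                ∎
    where
    open ≤-Reasoning
    t p : ℕ
    t = subsets n 3 (λ _ → 1) z
    p = subsets n 2 (λ _ → 1) (z + r n)
    lem : ∀ n → suc n * suc n * suc n ≡ n * n * n + (3 * (n * n) + 3 * n + 1)
    lem = solve-∀
    lem′ : ∀ t p n → 6 * t + 3 * (2 * p + n) + (3 * (n * n) + 3 * n + 3) ≡ 6 * (t + p) + 3 * (suc n * suc n)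
    lem′ = solve-∀

  subsets-+ : ∀ n k F G z → subsets n k (λ x → F x + G x) z ≡ subsets n k F z + subsets n k G z
  subsets-+ n zero    F G z = refl
  subsets-+ n (suc k) F G z = trans (∑-cong n (λ i _ → subsets-+ i k F G (z + r i)))
    (∑-+ n (λ i → subsets i k F (z + r i)) (λ i → subsets i k G (z + r i)))

  subsets-cong : ∀ n k {F G} z → (∀ x → F x ≡ G x) → subsets n k F z ≡ subsets n k G z
  subsets-cong n zero    z h = h z
  subsets-cong n (suc k) z h = ∑-cong n (λ i _ → subsets-cong i k (z + r i) h)

  -- `factorial-subsets≤tuples` bounds numbers of sets only from above. The light 3-sets, needed
  -- from below, are therefore obtained as all 3-sets without the heavy ones. At most `3 * (N * N)`
  -- triples have a repetition; they cost 400 times 3 over 24, which is 50.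
  light-bound : ∀ s y D τ (δ : ℕ → ℕ) → 0 < N → 0 < y → 4 * s ≤ N → τ + D ≡ 200 * y ⊎ D ≡ 0 →
    (∀ t → t < s → δ t ≤ D) → (∀ j → j < N → r j ≤ τ) → M ≤ ∑ s δ →
    101 * subsets N 4 (λ z → ⟦ 200 * y ≤? z ⟧) 0
      ≤ 100 * ∑ s (λ t → subsets N 3 (λ z → ⟦ z <? δ t ⟧) 0) + 50 * (s * (N * N))
  light-bound s y D τ δ 0<N 0<y 4s≤N eq δ≤ r≤ M≤ = *-cancelˡ-≤ 24 (+-cancelʳ-≤ (400 * ∑ s (λ t → heavy₃ r N (δ t))) _ _ (begin
    24 * (101 * I) + 400 * R                       ≡⟨ cong (_+ 400 * R) (lem I) ⟩
    101 * (24 * I) + 400 * R                       ≤⟨ +-monoˡ-≤ (400 * R) (*-monoʳ-≤ 101 (factorial-subsets≤tuples N 4 (λ z → ⟦ 200 * y ≤? z ⟧) 0)) ⟩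
    101 * heavy r N (200 * y) + 400 * R            ≤⟨ heavy-bound s y D τ δ 0<N 0<y 4s≤N eq δ≤ r≤ M≤ ⟩
    400 * (s * q)                                  ≡⟨ cong (400 *_) (sym (∑-const s q)) ⟩
    400 * ∑ s (λ _ → q)                            ≤⟨ *-monoʳ-≤ 400 (∑-mono s (λ t _ → cube≤ (δ t))) ⟩
    400 * ∑ s (λ t → 6 * light (δ t) + heavy₃ r N (δ t) + 3 * (N * N))
      ≡⟨ cong (400 *_) (trans (∑-+ s (λ t → 6 * light (δ t) + heavy₃ r N (δ t)) (λ _ → 3 * (N * N)))
           (cong₂ _+_ (trans (∑-+ s (λ t → 6 * light (δ t)) (λ t → heavy₃ r N (δ t))) (cong (_+ R) (∑-*ˡ s 6 (λ t → light (δ t))))) (∑-const s (3 * (N * N))))) ⟩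
    400 * (6 * ∑ s (λ t → light (δ t)) + R + s * (3 * (N * N)))
      ≡⟨ lem′ (∑ s (λ t → light (δ t))) R s (N * N) ⟩
    24 * (100 * ∑ s (λ t → light (δ t)) + 50 * (s * (N * N))) + 400 * R ∎))
    where
    open ≤-Reasoning
    I R : ℕ
    I = subsets N 4 (λ z → ⟦ 200 * y ≤? z ⟧) 0
    R = ∑ s (λ t → heavy₃ r N (δ t))
    light : ℕ → ℕ
    light δ = subsets N 3 (λ z → ⟦ z <? δ ⟧) 0
    lem : ∀ I → 24 * (101 * I) ≡ 101 * (24 * I)
    lem = solve-∀
    lem′ : ∀ l R s m → 400 * (6 * l + R + s * (3 * m)) ≡ 24 * (100 * l + 50 * (s * m)) + 400 * R
    lem′ = solve-∀
    dichotomy : ∀ δ z → 1 ≡ ⟦ z <? δ ⟧ + ⟦ δ ≤? z ⟧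
    dichotomy δ z with z <? δ | δ ≤? z
    ... | yes p | yes q = ⊥-elim (<⇒≱ p q)
    ... | yes p | no ¬q = refl
    ... | no ¬p | yes q = refl
    ... | no ¬p | no ¬q = ⊥-elim (¬q (≮⇒≥ ¬p))
    cube≤ : ∀ δ → q ≤ 6 * light δ + heavy₃ r N δ + 3 * (N * N)
    cube≤ δ = begin
      q                                                   ≤⟨ triples-count N 0 ⟩
      6 * subsets N 3 (λ _ → 1) 0 + 3 * (N * N)           ≡⟨ cong (λ x → 6 * x + 3 * (N * N)) (trans (subsets-cong N 3 0 (dichotomy δ)) (subsets-+ N 3 (λ z → ⟦ z <? δ ⟧) (λ z → ⟦ δ ≤? z ⟧) 0)) ⟩
      6 * (light δ + subsets N 3 (λ z → ⟦ δ ≤? z ⟧) 0) + 3 * (N * N)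
        ≡⟨ cong (_+ 3 * (N * N)) (*-distribˡ-+ 6 (light δ) _) ⟩
      6 * light δ + 6 * subsets N 3 (λ z → ⟦ δ ≤? z ⟧) 0 + 3 * (N * N)
        ≤⟨ +-monoˡ-≤ (3 * (N * N)) (+-monoʳ-≤ (6 * light δ) (factorial-subsets≤tuples N 3 (λ z → ⟦ δ ≤? z ⟧) 0)) ⟩
      6 * light δ + heavy₃ r N δ + 3 * (N * N) ∎

-- Matchings in stable graphs

∑-list : ∀ {a} {A : Set a} → (A → ℕ) → List A → ℕ
∑-list f xs = sum (map f xs)

coordinates : ∀ {n} → (ℕ → ℕ) → Quad n → ℕ
coordinates f (a , b , c , d) = f (toℕ a) + f (toℕ b) + f (toℕ c) + f (toℕ d)

below at : ∀ {n} → ℕ → Quad n → ℕ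
below j = coordinates (λ x → ⟦ x <? j ⟧)
at v = coordinates (λ x → ⟦ x ≟ v ⟧)

load : ∀ {n} → List (Quad n) → ℕ → ℕ
load M j = ∑-list (below j) M

<-suc-split : ∀ x v → ⟦ x <? suc v ⟧ ≡ ⟦ x <? v ⟧ + ⟦ x ≟ v ⟧
<-suc-split x v with <-cmp x v
... | tri< x<v x≢v _ = trans (⟦⟧-yes (x <? suc v) (m<n⇒m<1+n x<v)) (sym (cong₂ _+_ (⟦⟧-yes (x <? v) x<v) (⟦⟧-no (x ≟ v) x≢v)))
... | tri≈ x≮v refl _ = trans (⟦⟧-yes (x <? suc v) ≤-refl) (sym (cong₂ _+_ (⟦⟧-no (x <? v) x≮v) (⟦⟧-yes (x ≟ v) refl)))
... | tri> x≮v x≢v v<x = trans (⟦⟧-no (x <? suc v) (λ p → <⇒≱ v<x (s≤s⁻¹ p))) (sym (cong₂ _+_ (⟦⟧-no (x <? v) x≮v) (⟦⟧-no (x ≟ v) x≢v)))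

load-suc : ∀ {n} (M : List (Quad n)) v → load M v + ∑-list (at v) M ≡ load M (suc v)
load-suc [] v = refl
load-suc (q ∷ M) v = trans (lem (below v q) (load M v) (at v q) (∑-list (at v) M)) (cong₂ _+_ (split q) (load-suc M v))
  where
  lem : ∀ a b c d → a + b + (c + d) ≡ (a + c) + (b + d)
  lem = solve-∀
  split : ∀ q → below v q + at v q ≡ below (suc v) q
  split (a , b , c , d) = trans (lem′ (⟦ toℕ a <? v ⟧) (⟦ toℕ b <? v ⟧) (⟦ toℕ c <? v ⟧) (⟦ toℕ d <? v ⟧) (⟦ toℕ a ≟ v ⟧) (⟦ toℕ b ≟ v ⟧) (⟦ toℕ c ≟ v ⟧) (⟦ toℕ d ≟ v ⟧))
    (sym (cong₂ _+_ (cong₂ _+_ (cong₂ _+_ (<-suc-split (toℕ a) v) (<-suc-split (toℕ b) v)) (<-suc-split (toℕ c) v)) (<-suc-split (toℕ d) v)))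
    where
    lem′ : ∀ a b c d a′ b′ c′ d′ → a + b + c + d + (a′ + b′ + c′ + d′) ≡ (a + a′) + (b + b′) + (c + c′) + (d + d′)
    lem′ = solve-∀

load-mono : ∀ {n} (M : List (Quad n)) {i j} → i ≤ j → load M i ≤ load M j
load-mono [] i≤j = ≤-refl
load-mono (q@(a , b , c , d) ∷ M) {i} {j} i≤j = +-mono-≤ (+-mono-≤ (+-mono-≤ (+-mono-≤ (le a) (le b)) (le c)) (le d)) (load-mono M i≤j)
  where
  le : ∀ x → ⟦ toℕ x <? i ⟧ ≤ ⟦ toℕ x <? j ⟧
  le x = ⟦⟧-mono (toℕ x <? i) (toℕ x <? j) (λ p → <-≤-trans p i≤j)

∈-at : ∀ {n} (x : Fin n) q → x ∈q q → 1 ≤ at (toℕ x) q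
∈-at x (a , b , c , d) x∈ = ≤-trans (≤-reflexive (sym (⟦⟧-yes (toℕ x ≟ toℕ x) refl))) (pick x∈)
  where
  f : Fin _ → ℕ
  f y = ⟦ toℕ y ≟ toℕ x ⟧
  pick : x ∈q (a , b , c , d) → f x ≤ f a + f b + f c + f d
  pick (inj₁ refl) = ≤-trans (m≤m+n _ (f b)) (≤-trans (m≤m+n _ (f c)) (m≤m+n _ (f d)))
  pick (inj₂ (inj₁ refl)) = ≤-trans (m≤n+m _ (f a)) (≤-trans (m≤m+n _ (f c)) (m≤m+n _ (f d)))
  pick (inj₂ (inj₂ (inj₁ refl))) = ≤-trans (m≤n+m _ (f a + f b)) (m≤m+n _ (f d))
  pick (inj₂ (inj₂ (inj₂ refl))) = m≤n+m _ (f a + f b + f c)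

-- Every incidence (edge, v) of a list of edges is moved to c v + e v, where c v counts the
-- incidences below v and e v those at v in earlier edges: these ranks are pairwise
-- distinct, increase inside an edge, and do not exceed v as soon as c j ≤ j for all j.
module _ {n} (G : FourGraph n) (stable : Stable G) (c : ℕ → ℕ)
  (c-mono : ∀ {i j} → i ≤ j → c i ≤ c j) (c≤ : ∀ j → c j ≤ j) where

  record Ranked (e : ℕ → ℕ) (x : Fin n) : Set where
    constructor ranked
    field
      source : ℕ
      lower  : c source + e source ≤ toℕ x
      upper  : toℕ x < c (suc source)

  AllRanked : (ℕ → ℕ) → Quad n → Set
  AllRanked e q = ∀ x → x ∈q q → Ranked e x

  module _ (e : ℕ → ℕ) (a b c₀ d : Fin n) (edge : IsEdge G (a , b , c₀ , d))
    (room : ∀ v → c v + e v + at v (a , b , c₀ , d) ≤ c (suc v)) where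

    private
      q : Quad n
      q = a , b , c₀ , d

    rank<  : ∀ v → v ∈q q → c (toℕ v) + e (toℕ v) < c (suc (toℕ v))
    rank< v v∈ = ≤-trans (≤-trans (≤-reflexive (+-comm 1 _)) (+-monoʳ-≤ _ (∈-at v q v∈))) (room (toℕ v))

    rank≤ : ∀ v → v ∈q q → c (toℕ v) + e (toℕ v) ≤ toℕ v
    rank≤ v v∈ = s≤s⁻¹ (≤-trans (rank< v v∈) (c≤ (suc (toℕ v))))

    place : ∀ v → v ∈q q → Fin n
    place v v∈ = fromℕ< (≤-<-trans (rank≤ v v∈) (Fin.toℕ<n v))

    toℕ-place : ∀ v v∈ → toℕ (place v v∈) ≡ c (toℕ v) + e (toℕ v)
    toℕ-place v v∈ = Fin.toℕ-fromℕ< _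

    place≤ : ∀ v v∈ → place v v∈ Fin.≤ v
    place≤ v v∈ = ≤-trans (≤-reflexive (toℕ-place v v∈)) (rank≤ v v∈)

    place-mono : ∀ v v∈ w w∈ → v Fin.< w → place v v∈ Fin.< place w w∈
    place-mono v v∈ w w∈ v<w = begin-strict
      toℕ (place v v∈)             ≡⟨ toℕ-place v v∈ ⟩
      c (toℕ v) + e (toℕ v)        <⟨ rank< v v∈ ⟩
      c (suc (toℕ v))              ≤⟨ c-mono v<w ⟩
      c (toℕ w)                    ≤⟨ m≤m+n _ _ ⟩
      c (toℕ w) + e (toℕ w)        ≡⟨ sym (toℕ-place w w∈) ⟩
      toℕ (place w w∈)             ∎
      where open ≤-Reasoning

    a∈ : a ∈q q
    a∈ = inj₁ refl
    b∈ : b ∈q q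
    b∈ = inj₂ (inj₁ refl)
    c∈ : c₀ ∈q q
    c∈ = inj₂ (inj₂ (inj₁ refl))
    d∈ : d ∈q q
    d∈ = inj₂ (inj₂ (inj₂ refl))

    moved : Quad n
    moved = place a a∈ , place b b∈ , place c₀ c∈ , place d d∈

    moved-edge : IsEdge G moved
    moved-edge = stable q moved edge
      (place-mono a a∈ b b∈ (proj₁ (proj₁ edge)) , place-mono b b∈ c₀ c∈ (proj₁ (proj₂ (proj₁ edge))) , place-mono c₀ c∈ d d∈ (proj₂ (proj₂ (proj₁ edge))))
      (place≤ a a∈) (place≤ b b∈) (place≤ c₀ c∈) (place≤ d d∈)

    moved-from : ∀ x → x ∈q moved → ∃ λ v → Σ (v ∈q q) λ v∈ → x ≡ place v v∈
    moved-from x (inj₁ p) = a , a∈ , p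
    moved-from x (inj₂ (inj₁ p)) = b , b∈ , p
    moved-from x (inj₂ (inj₂ (inj₁ p))) = c₀ , c∈ , p
    moved-from x (inj₂ (inj₂ (inj₂ p))) = d , d∈ , p

    moved-ranked : AllRanked e moved
    moved-ranked x x∈ with moved-from x x∈
    ... | v , v∈ , refl = ranked (toℕ v) (≤-reflexive (sym (toℕ-place v v∈))) (≤-trans (s≤s (≤-reflexive (toℕ-place v v∈))) (rank< v v∈))

    -- Places coming from `v` lie in the window from `c v` to `c (suc v)`, and windows of different
    -- vertices do not overlap since `c` is monotone. For a common source, a later place starts
    -- beyond the offset `e v + at v q`, which includes the incidence moved here.
    moved-disjoint : ∀ q′ → AllRanked (λ v → e v + at v q) q′ → Disjoint moved q′
    moved-disjoint q′ later x x∈ x∈′ with moved-from x x∈ | later x x∈′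
    ... | v , v∈ , refl | ranked w lo hi with <-cmp (toℕ v) w
    ...   | tri< v<w _ _ = <-irrefl refl (begin-strict
      toℕ x                    ≡⟨ toℕ-place v v∈ ⟩
      c (toℕ v) + e (toℕ v)    <⟨ rank< v v∈ ⟩
      c (suc (toℕ v))          ≤⟨ c-mono v<w ⟩
      c w                      ≤⟨ m≤m+n _ _ ⟩
      c w + (e w + at w q)     ≤⟨ lo ⟩
      toℕ x                    ∎)
      where open ≤-Reasoning
    ...   | tri≈ _ refl _ = <-irrefl refl (begin-strict
      toℕ x                                          ≡⟨ toℕ-place v v∈ ⟩
      c (toℕ v) + e (toℕ v)                          <⟨ +-monoʳ-< (c (toℕ v)) (≤-trans (≤-reflexive (+-comm 1 _)) (+-monoʳ-≤ (e (toℕ v)) (∈-at v q v∈))) ⟩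
      c (toℕ v) + (e (toℕ v) + at (toℕ v) q)         ≤⟨ lo ⟩
      toℕ x                                          ∎)
      where open ≤-Reasoning
    ...   | tri> _ _ w<v = <-irrefl refl (begin-strict
      toℕ x                    <⟨ hi ⟩
      c (suc w)                ≤⟨ c-mono w<v ⟩
      c (toℕ v)                ≤⟨ m≤m+n _ _ ⟩
      c (toℕ v) + e (toℕ v)    ≡⟨ sym (toℕ-place v v∈) ⟩
      toℕ x                    ∎)
      where open ≤-Reasoning

  -- The ranks are part of the conclusion so that the induction can separate the front edge from all
  -- later ones, whose offsets `e′` count it.
  spread : ∀ e (M : List (Quad n)) → All (IsEdge G) M → (∀ v → c v + e v + ∑-list (at v) M ≤ c (suc v)) →
    ∃ λ M′ → IsMatching G M′ × All (AllRanked e) M′ × length M′ ≡ length M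
  spread e [] [] room = [] , ([] , []) , [] , refl
  spread e (q@(a , b , c₀ , d) ∷ M) (edge ∷ edges) room =
    let M′ , (edges′ , disjoint) , ranks , len = spread e′ M edges later-room
    in moved e a b c₀ d edge here-room ∷ M′
     , (moved-edge e a b c₀ d edge here-room ∷ edges′ , All.map (λ {q′} → moved-disjoint e a b c₀ d edge here-room q′) ranks ∷ disjoint)
     , moved-ranked e a b c₀ d edge here-room ∷ All.map weaken ranks
     , cong suc len
    where
    e′ : ℕ → ℕ
    e′ v = e v + at v q
    here-room : ∀ v → c v + e v + at v q ≤ c (suc v)
    here-room v = ≤-trans (+-monoʳ-≤ (c v + e v) (m≤m+n _ _)) (room v)
    later-room : ∀ v → c v + e′ v + ∑-list (at v) M ≤ c (suc v)
    later-room v = ≤-trans (≤-reflexive (lem (c v) (e v) (at v q) (∑-list (at v) M))) (room v)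
      where
      lem : ∀ x y z w → x + (y + z) + w ≡ x + y + (z + w)
      lem = solve-∀
    weaken : ∀ {q′} → AllRanked e′ q′ → AllRanked e q′
    weaken h x x∈ with h x x∈
    ... | ranked w lo hi = ranked w (≤-trans (+-monoʳ-≤ (c w) (m≤m+n (e w) _)) lo) hi

-- The edges of `M` may repeat and overlap. The bound on the loads is a Hall condition for initial
-- segments: it leaves room to move all incidences down to distinct vertices, and stability keeps
-- the results edges.
matching-of-load : ∀ {n} (G : FourGraph n) → Stable G → (M : List (Quad n)) → All (IsEdge G) M →
  (∀ j → load M j ≤ j) → ∃ λ M′ → IsMatching G M′ × length M′ ≡ length M
matching-of-load G stable M edges load≤ =
  let M′ , matching , _ , len = spread G stable (load M) (load-mono M) load≤ (λ _ → 0) M edges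
        (λ v → ≤-reflexive (trans (cong (_+ ∑-list (at v) M) (+-identityʳ (load M v))) (load-suc M v)))
  in M′ , matching , len

-- Fractional covers by approachability

-- The new excess is at most the positive part of y + A - B, whose square is at most y² + 2 y (A -
-- B) + A² + B². The term with `B` stands on the left to avoid a subtraction.
excess-step : ∀ z x A B → let y = z ∸ x ; y′ = (z + A) ∸ (x + B) in
  y′ * y′ + 2 * (y * B) ≤ y * y + 2 * (y * A) + (A * A + B * B)
excess-step z x A B = ≤-trans (+-monoˡ-≤ (2 * (y * B)) (*-mono-≤ y′≤ y′≤)) square
  where
  open ≤-Reasoning
  y : ℕ
  y = z ∸ x
  y′≤ : (z + A) ∸ (x + B) ≤ y + A ∸ B
  y′≤ = begin
    (z + A) ∸ (x + B)     ≡⟨ sym (∸-+-assoc (z + A) x B) ⟩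
    (z + A) ∸ x ∸ B       ≤⟨ ∸-monoˡ-≤ B (m≤n+o⇒m∸n≤o (z + A) x (≤-trans (+-monoˡ-≤ A (m≤n+m∸n z x)) (≤-reflexive (+-assoc x y A)))) ⟩
    y + A ∸ B             ∎
  square : (y + A ∸ B) * (y + A ∸ B) + 2 * (y * B) ≤ y * y + 2 * (y * A) + (A * A + B * B)
  square with ≤-total B (y + A)
  ... | inj₁ B≤ = begin
    g * g + 2 * (y * B)                        ≤⟨ +-monoʳ-≤ (g * g) (*-monoʳ-≤ 2 (*-monoˡ-≤ B (m≤m+n y A))) ⟩
    g * g + 2 * ((y + A) * B)                  ≡⟨ cong (λ t → g * g + 2 * (t * B)) (sym (m+[n∸m]≡n B≤)) ⟩
    g * g + 2 * ((B + g) * B)                  ≡⟨ lem B g ⟩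
    (B + g) * (B + g) + B * B                  ≡⟨ cong (λ t → t * t + B * B) (m+[n∸m]≡n B≤) ⟩
    (y + A) * (y + A) + B * B                  ≡⟨ lem′ y A B ⟩
    y * y + 2 * (y * A) + (A * A + B * B)      ∎
    where
    g : ℕ
    g = y + A ∸ B
    lem : ∀ B g → g * g + 2 * ((B + g) * B) ≡ (B + g) * (B + g) + B * B
    lem = solve-∀
    lem′ : ∀ y A B → (y + A) * (y + A) + B * B ≡ y * y + 2 * (y * A) + (A * A + B * B)
    lem′ = solve-∀
  ... | inj₂ ≤B = begin
    (y + A ∸ B) * (y + A ∸ B) + 2 * (y * B)            ≡⟨ cong (λ t → t * t + 2 * (y * B)) (m≤n⇒m∸n≡0 ≤B) ⟩
    2 * (y * B)                                        ≡⟨ cong (λ t → 2 * (y * t)) (sym (m+[n∸m]≡n ≤B)) ⟩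
    2 * (y * (y + A + h))                              ≤⟨ m≤m+n _ _ ⟩
    2 * (y * (y + A + h)) + (2 * (y * A) + 2 * (A * A) + h * h + 2 * (A * h))
                                                       ≡⟨ lem y A h ⟩
    y * y + 2 * (y * A) + (A * A + (y + A + h) * (y + A + h)) ≡⟨ cong (λ t → y * y + 2 * (y * A) + (A * A + t * t)) (m+[n∸m]≡n ≤B) ⟩
    y * y + 2 * (y * A) + (A * A + B * B)              ∎
    where
    h : ℕ
    h = B ∸ (y + A)
    lem : ∀ y A h → 2 * (y * (y + A + h)) + (2 * (y * A) + 2 * (A * A) + h * h + 2 * (A * h))
      ≡ y * y + 2 * (y * A) + (A * A + (y + A + h) * (y + A + h))
    lem = solve-∀

module _ {n} (G : FourGraph n) (s m b : ℕ) where

  -- Edges meeting the first 2 b vertices are left out of the process: this absorbs both the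
  -- rounding of vertices to levels and the final excess over the capacities.
  level capacity : ℕ → ℕ
  level i = 2 * b + suc i * b
  capacity i = suc i * b

  Admissible : Quad n → Set
  Admissible q = IsEdge G q × 2 * b ≤ toℕ (proj₁ q)

  -- Each edge is entitled to `capacity i / s` incidences below `level i`, so that `s` edges use up
  -- the capacity. Only overuse counts, and it is multiplied by `s` to stay integral.
  excess : List (Quad n) → ℕ → ℕ
  excess M i = s * load M (level i) ∸ length M * capacity i

  potential : List (Quad n) → ℕ
  potential M = ∑ m (λ i → excess M i * excess M i)

  increment : ℕ
  increment = m * (4 * s * (4 * s) + m * b * (m * b))

  weigh : (ℕ → ℕ) → Quad n → ℕ
  weigh y q = ∑ m (λ i → y i * (s * below (level i) q))

  budget : (ℕ → ℕ) → ℕ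
  budget y = ∑ m (λ i → y i * capacity i)

  Cover : (ℕ → ℕ) → Set
  Cover y = ∀ q → Admissible q → budget y < weigh y q

  cheap-edge? : ∀ y → Dec (∃ λ q → Admissible q × weigh y q ≤ budget y)
  cheap-edge? y with Fin.any? (λ a → Fin.any? (λ b′ → Fin.any? (λ c → Fin.any? (λ d →
      (((a Fin.<? b′) ×-dec ((b′ Fin.<? c) ×-dec (c Fin.<? d))) ×-dec (G (a , b′ , c , d) ≟ᵇ true))
      ×-dec (2 * b ≤? toℕ a) ×-dec (weigh y (a , b′ , c , d) ≤? budget y)))))
  ... | yes (a , b′ , c , d , edge , 2b≤a , cheap) = yes ((a , b′ , c , d) , (edge , 2b≤a) , cheap)
  ... | no ¬h = no λ { ((a , b′ , c , d) , (edge , 2b≤a) , cheap) → ¬h (a , b′ , c , d , edge , 2b≤a , cheap) }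

  below≤4 : ∀ j (q : Quad n) → below j q ≤ 4
  below≤4 j (a , b′ , c , d) = +-mono-≤ (+-mono-≤ (+-mono-≤ (⟦⟧≤1 (toℕ a <? j)) (⟦⟧≤1 (toℕ b′ <? j))) (⟦⟧≤1 (toℕ c <? j))) (⟦⟧≤1 (toℕ d <? j))

  potential-step : ∀ M q → weigh (excess M) q ≤ budget (excess M) → potential (q ∷ M) ≤ potential M + increment
  potential-step M q cheap = +-cancelʳ-≤ (2 * budget y) _ _ (begin
    potential (q ∷ M) + 2 * budget y
      ≡⟨ cong (potential (q ∷ M) +_) (sym (∑-*ˡ m 2 (λ i → y i * capacity i))) ⟩
    potential (q ∷ M) + ∑ m (λ i → 2 * (y i * capacity i))
      ≡⟨ sym (∑-+ m (λ i → y′ i * y′ i) (λ i → 2 * (y i * capacity i))) ⟩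
    ∑ m (λ i → y′ i * y′ i + 2 * (y i * capacity i))
      ≤⟨ ∑-mono m step ⟩
    ∑ m (λ i → y i * y i + 2 * (y i * A i) + (4 * s * (4 * s) + m * b * (m * b)))
      ≡⟨ ∑-+ m (λ i → y i * y i + 2 * (y i * A i)) (λ _ → 4 * s * (4 * s) + m * b * (m * b)) ⟩
    ∑ m (λ i → y i * y i + 2 * (y i * A i)) + ∑ m (λ _ → 4 * s * (4 * s) + m * b * (m * b))
      ≡⟨ cong₂ _+_ (trans (∑-+ m (λ i → y i * y i) (λ i → 2 * (y i * A i))) (cong (potential M +_) (∑-*ˡ m 2 (λ i → y i * A i)))) (∑-const m _) ⟩
    potential M + 2 * weigh y q + increment
      ≤⟨ +-monoˡ-≤ increment (+-monoʳ-≤ (potential M) (*-monoʳ-≤ 2 cheap)) ⟩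
    potential M + 2 * budget y + increment
      ≡⟨ +-exchange (potential M) (2 * budget y) increment ⟩
    potential M + increment + 2 * budget y ∎)
    where
    open ≤-Reasoning
    y y′ A : ℕ → ℕ
    y = excess M
    y′ = excess (q ∷ M)
    A i = s * below (level i) q
    step : ∀ i → i < m → y′ i * y′ i + 2 * (y i * capacity i) ≤ y i * y i + 2 * (y i * A i) + (4 * s * (4 * s) + m * b * (m * b))
    step i i<m = begin
      y′ i * y′ i + 2 * (y i * capacity i)
        ≡⟨ cong (λ t → t * t + 2 * (y i * capacity i)) (cong₂ _∸_ (trans (*-distribˡ-+ s (below (level i) q) (load M (level i))) (+-comm (A i) _)) (+-comm (capacity i) (length M * capacity i))) ⟩
      next * next + 2 * (y i * capacity i)
        ≤⟨ excess-step (s * load M (level i)) (length M * capacity i) (A i) (capacity i) ⟩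
      y i * y i + 2 * (y i * A i) + (A i * A i + capacity i * capacity i)
        ≤⟨ +-monoʳ-≤ (y i * y i + 2 * (y i * A i)) (+-mono-≤ (*-mono-≤ A≤ A≤) (*-mono-≤ (*-monoˡ-≤ b i<m) (*-monoˡ-≤ b i<m))) ⟩
      y i * y i + 2 * (y i * A i) + (4 * s * (4 * s) + m * b * (m * b)) ∎
      where
      next : ℕ
      next = (s * load M (level i) + A i) ∸ (length M * capacity i + capacity i)
      A≤ : A i ≤ 4 * s
      A≤ = ≤-trans (*-monoʳ-≤ s (below≤4 (level i) q)) (≤-reflexive (*-comm s 4))

  -- Either the excesses over the prescribed loads give a cover, or an edge that does not
  -- increase their weighted sum can be added; then the squared excess grows boundedly.
  approach : ∀ t → ∃ Cover ⊎ (∃ λ M → length M ≡ t × All Admissible M × potential M ≤ t * increment)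
  approach zero = inj₂ ([] , refl , [] , ≤-reflexive (trans (∑-cong m (λ i _ → cong (λ x → x * x) (cong (_∸ 0) (*-zeroʳ s)))) (∑-zero m)))
  approach (suc t) with approach t
  ... | inj₁ cover = inj₁ cover
  ... | inj₂ (M , len , adm , pot) with cheap-edge? (excess M)
  ...   | no ¬cheap = inj₁ (excess M , λ q q-adm → ≰⇒> (λ cheap → ¬cheap (q , q-adm , cheap)))
  ...   | yes (q , q-adm , cheap) = inj₂ (q ∷ M , cong suc len , q-adm ∷ adm ,
          ≤-trans (potential-step M q cheap) (≤-trans (+-monoˡ-≤ increment pot) (≤-reflexive (+-comm (t * increment) increment))))

  load-low : ∀ {M} → All Admissible M → ∀ {j} → j ≤ 2 * b → load M j ≡ 0
  load-low [] _ = refl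
  load-low {(a , b′ , c , d) ∷ _} ((((a<b , b<c , c<d) , _) , 2b≤a) ∷ adm) {j} j≤ =
    cong₂ _+_ (cong₂ _+_ (cong₂ _+_ (cong₂ _+_ (zero-at a ≤-refl) (zero-at b′ (<⇒≤ a<b))) (zero-at c (<⇒≤ (<-trans a<b b<c))))
      (zero-at d (<⇒≤ (<-trans a<b (<-trans b<c c<d))))) (load-low adm j≤)
    where
    zero-at : ∀ x → toℕ a ≤ toℕ x → ⟦ toℕ x <? j ⟧ ≡ 0
    zero-at x a≤x = ⟦⟧-no (toℕ x <? j) (≤⇒≯ (≤-trans j≤ (≤-trans 2b≤a a≤x)))

  load-high : ∀ (M : List (Quad n)) j k → n ≤ k → load M j ≤ load M k
  load-high [] _ _ _ = z≤n
  load-high ((a , b′ , c , d) ∷ M) j k n≤k = +-mono-≤ (+-mono-≤ (+-mono-≤ (+-mono-≤ (one a) (one b′)) (one c)) (one d)) (load-high M j k n≤k)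
    where
    one : ∀ x → ⟦ toℕ x <? j ⟧ ≤ ⟦ toℕ x <? k ⟧
    one x = ⟦⟧-mono (toℕ x <? j) (toℕ x <? k) (λ _ → <-≤-trans (Fin.toℕ<n x) n≤k)

  -- By `room`, the share of the one edge beyond `s` and the excess add up to at most `s * b`. Hence
  -- `load M (level i)` is at most `capacity i + b`, one block short of `level i`, and this settles
  -- every `j` in the block that ends there.
  load-bounded : ∀ M → All Admissible M → length M ≡ suc s → 0 < s → n ≤ 2 * b + m * b →
    (∀ y → y * y ≤ suc s * increment → m * b + y ≤ s * b) → potential M ≤ suc s * increment → ∀ j → load M j ≤ j
  load-bounded M adm len 0<s n≤ room pot j = go (≤-total j (2 * b + m * b))
    where
    open ≤-Reasoning
    at-level : ∀ i → i < m → load M (level i) ≤ 2 * b + i * b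
    at-level i i<m = *-cancelˡ-≤ s {{>-nonZero 0<s}} (begin
      s * load M (level i)                          ≤⟨ m≤n+m∸n _ (length M * capacity i) ⟩
      length M * capacity i + excess M i            ≡⟨ cong (λ t → t * capacity i + excess M i) len ⟩
      suc s * capacity i + excess M i               ≡⟨ lem (capacity i) (s * capacity i) (excess M i) ⟩
      s * capacity i + (capacity i + excess M i)    ≤⟨ +-monoʳ-≤ (s * capacity i) (≤-trans (+-monoˡ-≤ (excess M i) (*-monoˡ-≤ b i<m)) (room (excess M i) (≤-trans (term≤∑ (λ i → excess M i * excess M i) i<m) pot))) ⟩
      s * capacity i + s * b                        ≡⟨ lem′ s i b ⟩
      s * (2 * b + i * b)                           ∎)
      where
      lem : ∀ c x y → c + x + y ≡ x + (c + y)
      lem = solve-∀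
      lem′ : ∀ s i b → s * (suc i * b) + s * b ≡ s * (2 * b + i * b)
      lem′ = solve-∀
    upTo : ∀ i → i ≤ m → ∀ {j} → j ≤ 2 * b + i * b → load M j ≤ j
    upTo zero _ j≤ = ≤-trans (≤-reflexive (load-low adm (≤-trans j≤ (≤-reflexive (+-identityʳ (2 * b)))))) z≤n
    upTo (suc i) i<m {j} j≤ with ≤-total j (2 * b + i * b)
    ... | inj₁ j≤′ = upTo i (<⇒≤ i<m) j≤′
    ... | inj₂ ≤j = ≤-trans (load-mono M j≤) (≤-trans (at-level i i<m) ≤j)
    go : j ≤ 2 * b + m * b ⊎ 2 * b + m * b ≤ j → load M j ≤ j
    go (inj₁ j≤) = upTo m ≤-refl j≤
    go (inj₂ ≤j) = ≤-trans (load-high M j (2 * b + m * b) n≤) (≤-trans (upTo m ≤-refl ≤-refl) ≤j)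

  exists-cover : Stable G → MatchingNumberAtMost G s → 0 < s → n ≤ 2 * b + m * b →
    (∀ y → y * y ≤ suc s * increment → m * b + y ≤ s * b) → ∃ Cover
  exists-cover stable ν≤s 0<s n≤ room with approach (suc s)
  ... | inj₁ cover = cover
  ... | inj₂ (M , len , adm , pot) =
    let M′ , matching , len′ = matching-of-load G stable M (All.map proj₁ adm) (load-bounded M adm len 0<s n≤ room pot)
    in ⊥-elim (<-irrefl refl (≤-trans (≤-reflexive (sym (trans len′ len))) (ν≤s M′ matching)))

  -- The threshold Y is `200 * y` to fit the grid of cells. The weights are defined on all of ℕ, and
  -- `total` starts at `2 * b` because each level exceeds its capacity by that amount.
  record Weighting : Set where
    field
      y       : ℕ
      w       : ℕ → ℕ
      0<y     : 0 < y
      w-anti  : ∀ {i j} → i ≤ j → w j ≤ w i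
      covers  : ∀ q → Admissible q → 200 * y ≤ coordinates w q
      total   : ∑ n (λ j → w (2 * b + j)) ≤ s * (200 * y)

  -- A vertex is paid the excess of every level above it, so that `weigh` becomes a sum over the
  -- vertices of the edge. Level `i` pays only `capacity i` vertices from `2 * b` on, which bounds
  -- the total by `s` times the budget.
  weighting : ∃ Cover → Weighting
  weighting (y , cover) with budget y in eq
  -- A zero budget leaves every edge with weight 0: for positive `b` all the coefficients vanish,
  -- and for `b = 0` all levels are 0. So no edge is admissible, and the zero weight is a cover.
  ... | zero = record { y = 1 ; w = λ _ → 0 ; 0<y = s≤s z≤n ; w-anti = λ _ → z≤n
      ; covers = λ q adm → ⊥-elim (no-edge q adm) ; total = ≤-trans (≤-reflexive (∑-zero n)) z≤n }
    where
    zero-weight : ∀ i → i < m → ∀ x → 0 < b → y i * x ≡ 0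
    zero-weight i i<m x 0<b with m*n≡0⇒m≡0∨n≡0 (y i) (n≤0⇒n≡0 (≤-trans (term≤∑ (λ i → y i * capacity i) i<m) (≤-reflexive eq)))
    ... | inj₁ yi≡0 = cong (_* x) yi≡0
    ... | inj₂ cap≡0 = ⊥-elim (<⇒≢ (≤-trans 0<b (m≤m+n b (i * b))) (sym cap≡0))
    weightless : ∀ q → Admissible q → 0 < b → weigh y q ≡ 0
    weightless q adm 0<b = trans (∑-cong m (λ i i<m → zero-weight i i<m (s * below (level i) q) 0<b)) (∑-zero m)
    positive : ∀ q → 0 < weigh y q → 0 < b
    positive q@(a , b′ , c , d) 0<w = n≢0⇒n>0 λ { refl → <⇒≢ 0<w (sym (trans (∑-cong m (λ i _ → trans (cong (λ x → y i * (s * x)) (level0 i)) (trans (cong (y i *_) (*-zeroʳ s)) (*-zeroʳ (y i))))) (∑-zero m))) }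
      where
      below0 : ∀ {j} → j ≡ 0 → below j q ≡ 0
      below0 refl = refl
      level0 : ∀ i → below (suc i * 0) q ≡ 0
      level0 i = below0 (*-zeroʳ (suc i))
    no-edge : ∀ q → Admissible q → ⊥
    no-edge q adm = <⇒≢ 0<w (sym (weightless q adm (positive q 0<w)))
      where
      0<w : 0 < weigh y q
      0<w = ≤-<-trans z≤n (cover q adm)
  ... | suc p = record { y = suc p ; w = w ; 0<y = s≤s z≤n ; w-anti = anti ; covers = covers ; total = total }
    where
    open ≤-Reasoning
    w : ℕ → ℕ
    w v = 200 * (s * ∑ m (λ i → y i * ⟦ v <? level i ⟧))
    anti : ∀ {i j} → i ≤ j → w j ≤ w i
    anti {i} {j} i≤j = *-monoʳ-≤ 200 (*-monoʳ-≤ s (∑-mono m (λ k _ → *-monoʳ-≤ (y k) (⟦⟧-mono (j <? level k) (i <? level k) (≤-<-trans i≤j)))))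
    covers : ∀ q → Admissible q → 200 * suc p ≤ coordinates w q
    covers q@(a , b′ , c , d) adm = begin
      200 * suc p                ≤⟨ *-monoʳ-≤ 200 (<⇒≤ (cover q adm)) ⟩
      200 * weigh y q            ≡⟨ cong (200 *_) (trans (∑-cong m (λ i _ → spread-out (y i) s ⟦ toℕ a <? level i ⟧ ⟦ toℕ b′ <? level i ⟧ ⟦ toℕ c <? level i ⟧ ⟦ toℕ d <? level i ⟧))
                                     (trans (∑-*ˡ m s (λ i → f a i + f b′ i + f c i + f d i)) (cong (s *_) sums))) ⟩
      200 * (s * (∑ m (f a) + ∑ m (f b′) + ∑ m (f c) + ∑ m (f d)))
                                 ≡⟨ lem s (∑ m (f a)) (∑ m (f b′)) (∑ m (f c)) (∑ m (f d)) ⟩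
      coordinates w q            ∎
      where
      f : Fin n → ℕ → ℕ
      f x i = y i * ⟦ toℕ x <? level i ⟧
      sums : ∑ m (λ i → f a i + f b′ i + f c i + f d i) ≡ ∑ m (f a) + ∑ m (f b′) + ∑ m (f c) + ∑ m (f d)
      sums = trans (∑-+ m (λ i → f a i + f b′ i + f c i) (f d)) (cong (_+ ∑ m (f d)) (trans (∑-+ m (λ i → f a i + f b′ i) (f c)) (cong (_+ ∑ m (f c)) (∑-+ m (f a) (f b′)))))
      spread-out : ∀ y s α β γ δ → y * (s * (α + β + γ + δ)) ≡ s * (y * α + y * β + y * γ + y * δ)
      spread-out = solve-∀
      lem : ∀ s α β γ δ → 200 * (s * (α + β + γ + δ)) ≡ 200 * (s * α) + 200 * (s * β) + 200 * (s * γ) + 200 * (s * δ)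
      lem = solve-∀
    ∑-below : ∀ k c → ∑ k (λ j → ⟦ j <? c ⟧) ≤ c
    ∑-below zero    c = z≤n
    ∑-below (suc k) c with k <? c
    ... | yes k<c = ≤-trans (+-monoˡ-≤ 1 (∑-≤const k 1 (λ j _ → ⟦⟧≤1 (j <? c)))) (≤-trans (≤-reflexive (trans (cong (_+ 1) (*-identityʳ k)) (+-comm k 1))) k<c)
    ... | no _ = ≤-trans (≤-reflexive (+-identityʳ _)) (∑-below k c)
    total : ∑ n (λ j → w (2 * b + j)) ≤ s * (200 * suc p)
    total = begin
      ∑ n (λ j → w (2 * b + j))
        ≡⟨ trans (∑-*ˡ n 200 (λ j → s * ∑ m (λ i → g i j))) (cong (200 *_) (∑-*ˡ n s (λ j → ∑ m (λ i → g i j)))) ⟩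
      200 * (s * ∑ n (λ j → ∑ m (λ i → g i j)))
        ≡⟨ cong (λ x → 200 * (s * x)) (∑-swap n m (λ j i → g i j)) ⟩
      200 * (s * ∑ m (λ i → ∑ n (λ j → g i j)))
        ≤⟨ *-monoʳ-≤ 200 (*-monoʳ-≤ s (∑-mono m (λ i _ → ≤-trans (≤-reflexive (∑-*ˡ n (y i) (λ j → ⟦ 2 * b + j <? level i ⟧)))
             (*-monoʳ-≤ (y i) (≤-trans (∑-mono n (λ j _ → ⟦⟧-mono (2 * b + j <? level i) (j <? capacity i) (+-cancelˡ-< (2 * b) j (capacity i)))) (∑-below n (capacity i))))))) ⟩
      200 * (s * budget y)      ≡⟨ cong (λ x → 200 * (s * x)) eq ⟩
      200 * (s * suc p)         ≡⟨ lem s (suc p) ⟩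
      s * (200 * suc p)         ∎
      where
      g : ℕ → ℕ → ℕ
      g i j = y i * ⟦ 2 * b + j <? level i ⟧
      lem : ∀ s p → 200 * (s * p) ≡ s * (200 * p)
      lem = solve-∀

-- Counting 4-sets

bit : Bool → ℕ
bit true  = 1
bit false = 0

module _ {a} {A : Set a} where

  ∑-list-cong : ∀ {f g : A → ℕ} → (∀ x → f x ≡ g x) → ∀ xs → ∑-list f xs ≡ ∑-list g xs
  ∑-list-cong h []       = refl
  ∑-list-cong h (x ∷ xs) = cong₂ _+_ (h x) (∑-list-cong h xs)

  ∑-list-mono : ∀ {f g : A → ℕ} → (∀ x → f x ≤ g x) → ∀ xs → ∑-list f xs ≤ ∑-list g xs
  ∑-list-mono h []       = z≤n
  ∑-list-mono h (x ∷ xs) = +-mono-≤ (h x) (∑-list-mono h xs)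

  ∑-list-+ : ∀ (f g : A → ℕ) xs → ∑-list (λ x → f x + g x) xs ≡ ∑-list f xs + ∑-list g xs
  ∑-list-+ f g []       = refl
  ∑-list-+ f g (x ∷ xs) = trans (cong (f x + g x +_) (∑-list-+ f g xs)) (lem (f x) (g x) (∑-list f xs) (∑-list g xs))
    where
    lem : ∀ a b c d → a + b + (c + d) ≡ a + c + (b + d)
    lem = solve-∀

  length-filter-bit : ∀ (B : A → Bool) xs → length (filter (λ x → B x ≟ᵇ true) xs) ≡ ∑-list (λ x → bit (B x)) xs
  length-filter-bit B [] = refl
  length-filter-bit B (x ∷ xs) with B x
  ... | true  = cong suc (length-filter-bit B xs)
  ... | false = length-filter-bit B xs

  ∑-list-filter : ∀ {p} {P : Pred A p} (P? : Decidable P) (f : A → ℕ) xs →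
    ∑-list f (filter P? xs) ≡ ∑-list (λ x → ⟦ P? x ⟧ * f x) xs
  ∑-list-filter P? f [] = refl
  ∑-list-filter P? f (x ∷ xs) with P? x
  ... | yes _ = cong₂ _+_ (sym (*-identityˡ (f x))) (∑-list-filter P? f xs)
  ... | no _  = ∑-list-filter P? f xs

  ∑-list-++ : ∀ (f : A → ℕ) xs ys → ∑-list f (xs ++ ys) ≡ ∑-list f xs + ∑-list f ys
  ∑-list-++ f xs ys = trans (cong sum (map-++ f xs ys)) (sum-++ (map f xs) (map f ys))

∑-list-concatMap : ∀ {a b} {A : Set a} {B : Set b} (f : B → ℕ) (g : A → List B) xs →
  ∑-list f (concatMap g xs) ≡ ∑-list (λ x → ∑-list f (g x)) xs
∑-list-concatMap f g [] = refl
∑-list-concatMap f g (x ∷ xs) = trans (∑-list-++ f (g x) (concatMap g xs)) (cong (∑-list f (g x) +_) (∑-list-concatMap f g xs))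

∑-list-allFin : ∀ n (φ : ℕ → ℕ) → ∑-list (λ i → φ (toℕ i)) (allFin n) ≡ ∑ n φ
∑-list-allFin n φ = trans (cong sum (map-tabulate {n = n} (λ i → i) (λ i → φ (toℕ i)))) (tabulated n φ)
  where
  tabulated : ∀ n φ → sum (tabulate {n = n} (λ i → φ (toℕ i))) ≡ ∑ n φ
  tabulated zero    φ = refl
  tabulated (suc n) φ = trans (cong (φ 0 +_) (tabulated n (λ i → φ (suc i)))) (sym (∑-front n φ))

-- The largest entry is outermost, so that sums over 4-sets match `subsets` by unfolding.
chains : ℕ → (ℕ → ℕ → ℕ → ℕ → ℕ) → ℕ
chains n φ = ∑ n (λ d → ∑ d (λ c → ∑ c (λ b → ∑ b (λ a → φ a b c d))))

∑-below-index : ∀ {b n} → b ≤ n → ∀ g → ∑ n (λ a → ⟦ a <? b ⟧ * g a) ≡ ∑ b g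
∑-below-index {b} {n} b≤n g = begin
  ∑ n f                                                ≡⟨ cong (λ k → ∑ k f) (sym (m+[n∸m]≡n b≤n)) ⟩
  ∑ (b + (n ∸ b)) f                                    ≡⟨ ∑-split b (n ∸ b) f ⟩
  ∑ b f + ∑ (n ∸ b) (λ i → f (b + i))                  ≡⟨ cong₂ _+_ (∑-cong b (λ i i<b → trans (cong (_* g i) (⟦⟧-yes (i <? b) i<b)) (*-identityˡ (g i))))
                                                            (trans (∑-cong (n ∸ b) (λ i _ → cong (_* g (b + i)) (⟦⟧-no (b + i <? b) (≤⇒≯ (m≤m+n b i))))) (∑-zero (n ∸ b))) ⟩
  ∑ b g + 0                                            ≡⟨ +-identityʳ _ ⟩
  ∑ b g                                                ∎
  where
  open ≡-Reasoning
  f : ℕ → ℕ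
  f a = ⟦ a <? b ⟧ * g a

∑-triangle : ∀ n (g : ℕ → ℕ → ℕ) → ∑ n (λ a → ∑ n (λ b → ⟦ a <? b ⟧ * g a b)) ≡ ∑ n (λ b → ∑ b (λ a → g a b))
∑-triangle n g = trans (∑-swap n n (λ a b → ⟦ a <? b ⟧ * g a b)) (∑-cong n (λ b b<n → ∑-below-index (<⇒≤ b<n) (λ a → g a b)))

increasing : (a b c d : ℕ) → ℕ → ℕ
increasing a b c d x = ⟦ a <? b ⟧ * (⟦ b <? c ⟧ * (⟦ c <? d ⟧ * x))

∑-increasing : ∀ n φ → ∑ n (λ a → ∑ n (λ b → ∑ n (λ c → ∑ n (λ d → increasing a b c d (φ a b c d))))) ≡ chains n φ
∑-increasing n φ = begin
  ∑ n (λ a → ∑ n (λ b → ∑ n (λ c → ∑ n (λ d → increasing a b c d (φ a b c d)))))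
    ≡⟨ ∑-cong n (λ a _ → ∑-cong n (λ b _ → trans
         (∑-cong n (λ c _ → trans (∑-*ˡ n ⟦ a <? b ⟧ (λ d → ⟦ b <? c ⟧ * (⟦ c <? d ⟧ * φ a b c d)))
           (cong (⟦ a <? b ⟧ *_) (∑-*ˡ n ⟦ b <? c ⟧ (λ d → ⟦ c <? d ⟧ * φ a b c d)))))
         (∑-*ˡ n ⟦ a <? b ⟧ (λ c → ⟦ b <? c ⟧ * h a b c)))) ⟩
  ∑ n (λ a → ∑ n (λ b → ⟦ a <? b ⟧ * ∑ n (λ c → ⟦ b <? c ⟧ * h a b c)))
    ≡⟨ ∑-triangle n (λ a b → ∑ n (λ c → ⟦ b <? c ⟧ * h a b c)) ⟩
  ∑ n (λ b → ∑ b (λ a → ∑ n (λ c → ⟦ b <? c ⟧ * h a b c)))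
    ≡⟨ ∑-cong n (λ b _ → trans (∑-swap b n (λ a c → ⟦ b <? c ⟧ * h a b c)) (∑-cong n (λ c _ → ∑-*ˡ b ⟦ b <? c ⟧ (λ a → h a b c)))) ⟩
  ∑ n (λ b → ∑ n (λ c → ⟦ b <? c ⟧ * ∑ b (λ a → h a b c)))
    ≡⟨ ∑-triangle n (λ b c → ∑ b (λ a → h a b c)) ⟩
  ∑ n (λ c → ∑ c (λ b → ∑ b (λ a → ∑ n (λ d → ⟦ c <? d ⟧ * φ a b c d))))
    ≡⟨ ∑-cong n (λ c _ → trans (∑-cong c (λ b _ → trans (∑-swap b n (λ a d → ⟦ c <? d ⟧ * φ a b c d)) (∑-cong n (λ d _ → ∑-*ˡ b ⟦ c <? d ⟧ (λ a → φ a b c d)))))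
         (trans (∑-swap c n (λ b d → ⟦ c <? d ⟧ * ∑ b (λ a → φ a b c d))) (∑-cong n (λ d _ → ∑-*ˡ c ⟦ c <? d ⟧ (λ b → ∑ b (λ a → φ a b c d)))))) ⟩
  ∑ n (λ c → ∑ n (λ d → ⟦ c <? d ⟧ * ∑ c (λ b → ∑ b (λ a → φ a b c d))))
    ≡⟨ ∑-triangle n (λ c d → ∑ c (λ b → ∑ b (λ a → φ a b c d))) ⟩
  chains n φ ∎
  where
  open ≡-Reasoning
  h : ℕ → ℕ → ℕ → ℕ
  h a b c = ∑ n (λ d → ⟦ c <? d ⟧ * φ a b c d)

increasing? : ∀ {n} (q : Quad n) → Dec (Increasing q)
increasing? (a , b , c , d) = (a Fin.<? b) ×-dec ((b Fin.<? c) ×-dec (c Fin.<? d))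

lift : ∀ {n} → (ℕ → ℕ → ℕ → ℕ → ℕ) → Quad n → ℕ
lift φ (a , b , c , d) = φ (toℕ a) (toℕ b) (toℕ c) (toℕ d)

count : ∀ {n} → (Quad n → Bool) → ℕ
count {n} B = length (filter (λ q → B q ≟ᵇ true) (fourSets n))

∑-list-allQuads : ∀ n φ → ∑-list (lift φ) (allQuads n) ≡ ∑ n (λ a → ∑ n (λ b → ∑ n (λ c → ∑ n (λ d → φ a b c d))))
∑-list-allQuads n φ = trans (∑-list-concatMap (lift φ) _ (allFin n))
  (trans (∑-list-cong over-b (allFin n)) (∑-list-allFin n (λ a → ∑ n (λ b → ∑ n (λ c → ∑ n (λ d → φ a b c d))))))
  where
  over-d : ∀ a b c → ∑-list (lift φ) (map (λ d → (a , b , c , d)) (allFin n)) ≡ ∑ n (λ d → φ (toℕ a) (toℕ b) (toℕ c) d)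
  over-d a b c = trans (cong sum (sym (map-∘ (allFin n)))) (∑-list-allFin n (φ (toℕ a) (toℕ b) (toℕ c)))
  over-c : ∀ a b → ∑-list (lift φ) (concatMap (λ c → map (λ d → (a , b , c , d)) (allFin n)) (allFin n))
    ≡ ∑ n (λ c → ∑ n (λ d → φ (toℕ a) (toℕ b) c d))
  over-c a b = trans (∑-list-concatMap (lift φ) _ (allFin n))
    (trans (∑-list-cong (over-d a b) (allFin n)) (∑-list-allFin n (λ c → ∑ n (λ d → φ (toℕ a) (toℕ b) c d))))
  over-b : ∀ a → ∑-list (lift φ) (concatMap (λ b → concatMap (λ c → map (λ d → (a , b , c , d)) (allFin n)) (allFin n)) (allFin n))
    ≡ ∑ n (λ b → ∑ n (λ c → ∑ n (λ d → φ (toℕ a) b c d)))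
  over-b a = trans (∑-list-concatMap (lift φ) _ (allFin n))
    (trans (∑-list-cong (over-c a) (allFin n)) (∑-list-allFin n (λ b → ∑ n (λ c → ∑ n (λ d → φ (toℕ a) b c d)))))

module _ {n : ℕ} where

  increasing-yes : ∀ (q : Quad n) x → Increasing q → lift (λ a b c d → increasing a b c d x) q ≡ x
  increasing-yes (a , b , c , d) x (a<b , b<c , c<d) =
    trans (cong₂ _*_ (⟦⟧-yes (toℕ a <? toℕ b) a<b) (cong₂ _*_ (⟦⟧-yes (toℕ b <? toℕ c) b<c) (cong (_* x) (⟦⟧-yes (toℕ c <? toℕ d) c<d)))) (lem x)
    where
    lem : ∀ x → 1 * (1 * (1 * x)) ≡ x
    lem = solve-∀

  increasing-no : ∀ (q : Quad n) x → ¬ Increasing q → lift (λ a b c d → increasing a b c d x) q ≡ 0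
  increasing-no (a , b , c , d) x ¬inc with toℕ a <? toℕ b | toℕ b <? toℕ c | toℕ c <? toℕ d
  ... | no _ | _ | _ = refl
  ... | yes _ | no _ | _ = refl
  ... | yes _ | yes _ | no _ = refl
  ... | yes p | yes q | yes r = ⊥-elim (¬inc (p , q , r))

  count-as-sum : ∀ (B : Quad n → Bool) → count B ≡ ∑-list (λ q → ⟦ increasing? q ⟧ * bit (B q)) (allQuads n)
  count-as-sum B = trans (length-filter-bit B (fourSets n)) (∑-list-filter _ (λ q → bit (B q)) (allQuads n))

  chains-as-sum : ∀ φ → ∑-list (lift (λ a b c d → increasing a b c d (φ a b c d))) (allQuads n) ≡ chains n φ
  chains-as-sum φ = trans (∑-list-allQuads n (λ a b c d → increasing a b c d (φ a b c d))) (∑-increasing n φ)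

  count≤chains : ∀ (B : Quad n → Bool) φ → (∀ q → Increasing q → bit (B q) ≤ lift φ q) → count B ≤ chains n φ
  count≤chains B φ h = begin
    count B                                                                        ≡⟨ count-as-sum B ⟩
    ∑-list (λ q → ⟦ increasing? q ⟧ * bit (B q)) (allQuads n)                      ≤⟨ ∑-list-mono pointwise (allQuads n) ⟩
    ∑-list (lift (λ a b c d → increasing a b c d (φ a b c d))) (allQuads n)        ≡⟨ chains-as-sum φ ⟩
    chains n φ                                                                     ∎
    where
    open ≤-Reasoning
    pointwise : ∀ q → ⟦ increasing? q ⟧ * bit (B q) ≤ lift (λ a b c d → increasing a b c d (φ a b c d)) q
    pointwise q with increasing? q
    ... | yes inc = ≤-trans (≤-reflexive (*-identityˡ (bit (B q)))) (≤-trans (h q inc) (≤-reflexive (sym (increasing-yes q (lift φ q) inc))))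
    ... | no _ = z≤n

  chains≤count : ∀ (B : Quad n → Bool) φ → (∀ q → Increasing q → lift φ q ≤ bit (B q)) → chains n φ ≤ count B
  chains≤count B φ h = begin
    chains n φ                                                                     ≡⟨ sym (chains-as-sum φ) ⟩
    ∑-list (lift (λ a b c d → increasing a b c d (φ a b c d))) (allQuads n)        ≤⟨ ∑-list-mono pointwise (allQuads n) ⟩
    ∑-list (λ q → ⟦ increasing? q ⟧ * bit (B q)) (allQuads n)                      ≡⟨ sym (count-as-sum B) ⟩
    count B                                                                        ∎
    where
    open ≤-Reasoning
    pointwise : ∀ q → lift (λ a b c d → increasing a b c d (φ a b c d)) q ≤ ⟦ increasing? q ⟧ * bit (B q)
    pointwise q with increasing? q
    ... | yes inc = ≤-trans (≤-reflexive (increasing-yes q (lift φ q) inc)) (≤-trans (h q inc) (≤-reflexive (sym (*-identityˡ (bit (B q))))))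
    ... | no ¬inc = ≤-reflexive (increasing-no q (lift φ q) ¬inc)

  count-exchange : ∀ (G H : Quad n → Bool) →
    count (λ q → H q ∧ not (G q)) + count G ≡ count H + count (λ q → G q ∧ not (H q))
  count-exchange G H = begin
    count (λ q → H q ∧ not (G q)) + count G
      ≡⟨ cong₂ _+_ (length-filter-bit _ (fourSets n)) (length-filter-bit G (fourSets n)) ⟩
    ∑-list (λ q → bit (H q ∧ not (G q))) (fourSets n) + ∑-list (λ q → bit (G q)) (fourSets n)
      ≡⟨ sym (∑-list-+ (λ q → bit (H q ∧ not (G q))) (λ q → bit (G q)) (fourSets n)) ⟩
    ∑-list (λ q → bit (H q ∧ not (G q)) + bit (G q)) (fourSets n)
      ≡⟨ ∑-list-cong (λ q → exchange (G q) (H q)) (fourSets n) ⟩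
    ∑-list (λ q → bit (H q) + bit (G q ∧ not (H q))) (fourSets n)
      ≡⟨ ∑-list-+ (λ q → bit (H q)) (λ q → bit (G q ∧ not (H q))) (fourSets n) ⟩
    ∑-list (λ q → bit (H q)) (fourSets n) + ∑-list (λ q → bit (G q ∧ not (H q))) (fourSets n)
      ≡⟨ sym (cong₂ _+_ (length-filter-bit H (fourSets n)) (length-filter-bit _ (fourSets n))) ⟩
    count H + count (λ q → G q ∧ not (H q)) ∎
    where
    open ≡-Reasoning
    exchange : ∀ g h → bit (h ∧ not g) + bit g ≡ bit h + bit (g ∧ not h)
    exchange true  true  = refl
    exchange true  false = refl
    exchange false true  = refl
    exchange false false = refl

∑-shift : ∀ m c {f} → (∀ i → i < m → f i ≡ 0) → ∑ c f ≡ ∑ (c ∸ m) (λ i → f (m + i))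
∑-shift m c {f} zeros with ≤-total m c
... | inj₁ m≤c = trans (cong (λ k → ∑ k f) (sym (m+[n∸m]≡n m≤c))) (trans (∑-split m (c ∸ m) f) (cong (_+ ∑ (c ∸ m) (λ i → f (m + i))) (trans (∑-cong m zeros) (∑-zero m))))
... | inj₂ c≤m = trans (trans (∑-cong c (λ i i<c → zeros i (<-≤-trans i<c c≤m))) (∑-zero c)) (cong (λ k → ∑ k (λ i → f (m + i))) (sym (m≤n⇒m∸n≡0 c≤m)))

chains-shift : ∀ m n (φ : ℕ → ℕ → ℕ → ℕ → ℕ) → chains n (λ a b c d → ⟦ m ≤? a ⟧ * φ a b c d) ≡ chains (n ∸ m) (λ a b c d → φ (m + a) (m + b) (m + c) (m + d))
chains-shift m n φ = begin
  chains n (λ a b c d → ⟦ m ≤? a ⟧ * φ a b c d)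
    ≡⟨ ∑-cong n (λ d _ → ∑-cong d (λ c _ → ∑-cong c (λ b _ → first b (λ a → φ a b c d)))) ⟩
  ∑ n (λ d → ∑ d (λ c → ∑ c (λ b → ∑ (b ∸ m) (λ a → φ (m + a) b c d))))
    ≡⟨ ∑-cong n (λ d _ → ∑-cong d (λ c _ → next c (λ b k → ∑ k (λ a → φ (m + a) b c d)) (λ _ → refl))) ⟩
  ∑ n (λ d → ∑ d (λ c → ∑ (c ∸ m) (λ b → ∑ b (λ a → φ (m + a) (m + b) c d))))
    ≡⟨ ∑-cong n (λ d _ → next d (λ c k → ∑ k (λ b → ∑ b (λ a → φ (m + a) (m + b) c d))) (λ _ → refl)) ⟩
  ∑ n (λ d → ∑ (d ∸ m) (λ c → ∑ c (λ b → ∑ b (λ a → φ (m + a) (m + b) (m + c) d))))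
    ≡⟨ next n (λ d k → ∑ k (λ c → ∑ c (λ b → ∑ b (λ a → φ (m + a) (m + b) (m + c) d)))) (λ _ → refl) ⟩
  chains (n ∸ m) (λ a b c d → φ (m + a) (m + b) (m + c) (m + d)) ∎
  where
  open ≡-Reasoning
  first : ∀ b g → ∑ b (λ a → ⟦ m ≤? a ⟧ * g a) ≡ ∑ (b ∸ m) (λ a → g (m + a))
  first b g = trans (∑-shift m b (λ i i<m → cong (_* g i) (⟦⟧-no (m ≤? i) (<⇒≱ i<m))))
    (∑-cong (b ∸ m) (λ a _ → trans (cong (_* g (m + a)) (⟦⟧-yes (m ≤? m + a) (m≤m+n m a))) (*-identityˡ _)))
  next : ∀ c (g : ℕ → ℕ → ℕ) → (∀ b → g b 0 ≡ 0) → ∑ c (λ b → g b (b ∸ m)) ≡ ∑ (c ∸ m) (λ b → g (m + b) b)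
  next c g zero-at = trans (∑-shift m c (λ i i<m → trans (cong (g i) (m≤n⇒m∸n≡0 (<⇒≤ i<m))) (zero-at i)))
    (∑-cong (c ∸ m) (λ b _ → cong (g (m + b)) (m+n∸m≡n m b)))

chains-cong : ∀ n {φ ψ} → (∀ a b c d → φ a b c d ≡ ψ a b c d) → chains n φ ≡ chains n ψ
chains-cong n h = ∑-cong n (λ d _ → ∑-cong d (λ c _ → ∑-cong c (λ b _ → ∑-cong b (λ a _ → h a b c d))))

chains-+ : ∀ n (φ ψ : ℕ → ℕ → ℕ → ℕ → ℕ) → chains n (λ a b c d → φ a b c d + ψ a b c d) ≡ chains n φ + chains n ψ
chains-+ n φ ψ = trans (∑-cong n (λ d _ → trans (∑-cong d (λ c _ → trans (∑-cong c (λ b _ → ∑-+ b _ _)) (∑-+ c _ _))) (∑-+ d _ _))) (∑-+ n _ _)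

∑-binomial : ∀ k n → ∑ n (_C k) ≡ n C suc k
∑-binomial k zero    = refl
∑-binomial k (suc n) = trans (cong (_+ n C k) (∑-binomial k n)) (trans (+-comm (n C suc k) (n C k)) (nCk+nC[k+1]≡[n+1]C[k+1] n k))

chains-one : ∀ n → chains n (λ _ _ _ _ → 1) ≡ n C 4
chains-one n = trans (∑-cong n (λ d _ → trans (∑-cong d (λ c _ → trans (∑-cong c (λ b _ → trans (∑-const b 1) (trans (*-identityʳ b) (sym (nC1≡n b))))) (∑-binomial 1 c))) (∑-binomial 2 d))) (∑-binomial 3 n)

-- Comparison with H₁

bit≤1 : ∀ x → bit x ≤ 1
bit≤1 true  = ≤-refl
bit≤1 false = z≤n

<ᵇ-true : ∀ {m n} → m < n → (m <ᵇ n) ≡ true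
<ᵇ-true {m} {n} m<n with m <ᵇ n | <⇒<ᵇ m<n
... | true | _ = refl

<ᵇ-false : ∀ {m n} → n ≤ m → (m <ᵇ n) ≡ false
<ᵇ-false {m} {n} n≤m with m <ᵇ n in eq
... | true  = ⊥-elim (<⇒≱ (<ᵇ⇒< m n (subst T (sym eq) tt)) n≤m)
... | false = refl

H₁-true : ∀ {n s} (q : Quad n) → toℕ (proj₁ q) < s → H₁ n s q ≡ true
H₁-true {s = s} (a , b , c , d) a<s rewrite <ᵇ-true a<s = refl

H₁-false : ∀ {n s} (q : Quad n) → Increasing q → s ≤ toℕ (proj₁ q) → H₁ n s q ≡ false
H₁-false {s = s} (a , b , c , d) (a<b , b<c , c<d) s≤a
  rewrite <ᵇ-false {n = s} s≤a | <ᵇ-false {n = s} (≤-trans s≤a (<⇒≤ a<b))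
        | <ᵇ-false {n = s} (≤-trans s≤a (<⇒≤ (<-trans a<b b<c)))
        | <ᵇ-false {n = s} (≤-trans s≤a (<⇒≤ (<-trans a<b (<-trans b<c c<d)))) = refl

count-H₁ : ∀ n s → count (H₁ n s) + (n ∸ s) C 4 ≡ n C 4
count-H₁ n s = begin
  count (H₁ n s) + (n ∸ s) C 4
    ≡⟨ cong₂ _+_ (≤-antisym (count≤chains (H₁ n s) touching (λ q inc → ≤-reflexive (bit-H₁ q inc))) (chains≤count (H₁ n s) touching (λ q inc → ≤-reflexive (sym (bit-H₁ q inc)))))
         (trans (sym (chains-one (n ∸ s))) (sym (chains-shift s n (λ _ _ _ _ → 1)))) ⟩
  chains n touching + chains n (λ a b c d → ⟦ s ≤? a ⟧ * 1)
    ≡⟨ sym (chains-+ n touching (λ a b c d → ⟦ s ≤? a ⟧ * 1)) ⟩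
  chains n (λ a b c d → ⟦ a <? s ⟧ + ⟦ s ≤? a ⟧ * 1)
    ≡⟨ chains-cong n (λ a b c d → dichotomy a) ⟩
  chains n (λ _ _ _ _ → 1)
    ≡⟨ chains-one n ⟩
  n C 4 ∎
  where
  open ≡-Reasoning
  touching : ℕ → ℕ → ℕ → ℕ → ℕ
  touching a b c d = ⟦ a <? s ⟧
  bit-H₁ : ∀ q → Increasing q → bit (H₁ n s q) ≡ lift touching q
  bit-H₁ q@(a , _) inc with toℕ a <? s
  ... | yes a<s = cong bit (H₁-true q a<s)
  ... | no a≮s  = cong bit (H₁-false q inc (≮⇒≥ a≮s))
  dichotomy : ∀ a → ⟦ a <? s ⟧ + ⟦ s ≤? a ⟧ * 1 ≡ 1
  dichotomy a with a <? s | s ≤? a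
  ... | yes p | yes q = ⊥-elim (<⇒≱ p q)
  ... | yes p | no _  = refl
  ... | no _  | yes _ = refl
  ... | no p  | no q  = ⊥-elim (q (≮⇒≥ p))

∑-window : ∀ k c β → ∑ k (λ i → ⟦ c ≤? i ⟧ * ⟦ i <? β + c ⟧) ≤ β
∑-window k c β = begin
  ∑ k (λ i → ⟦ c ≤? i ⟧ * ⟦ i <? β + c ⟧)
    ≡⟨ ∑-shift c k (λ i i<c → cong (_* ⟦ i <? β + c ⟧) (⟦⟧-no (c ≤? i) (<⇒≱ i<c))) ⟩
  ∑ (k ∸ c) (λ i → ⟦ c ≤? c + i ⟧ * ⟦ c + i <? β + c ⟧)
    ≤⟨ ∑-mono (k ∸ c) (λ i _ → inside i) ⟩
  ∑ (k ∸ c) (λ i → ⟦ i <? β ⟧ * 1)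
    ≤⟨ ∑-≤β (≤-total β (k ∸ c)) ⟩
  β ∎
  where
  open ≤-Reasoning
  inside : ∀ i → ⟦ c ≤? c + i ⟧ * ⟦ c + i <? β + c ⟧ ≤ ⟦ i <? β ⟧ * 1
  inside i = ≤-trans (*-mono-≤ (⟦⟧≤1 (c ≤? c + i)) (⟦⟧-mono (c + i <? β + c) (i <? β) (λ p → +-cancelˡ-< c i β (<-≤-trans p (≤-reflexive (+-comm β c))))))
    (≤-reflexive (*-comm 1 ⟦ i <? β ⟧))
  ∑-≤β : β ≤ k ∸ c ⊎ k ∸ c ≤ β → ∑ (k ∸ c) (λ i → ⟦ i <? β ⟧ * 1) ≤ β
  ∑-≤β (inj₁ β≤) = ≤-reflexive (trans (∑-below-index β≤ (λ _ → 1)) (trans (∑-const β 1) (*-identityʳ β)))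
  ∑-≤β (inj₂ ≤β) = ≤-trans (∑-≤const (k ∸ c) 1 (λ i _ → *-monoˡ-≤ 1 (⟦⟧≤1 (i <? β)))) (≤-trans (≤-reflexive (*-identityʳ _)) ≤β)

module _ {n} (G : FourGraph n) (s m b : ℕ) (weighting : Weighting G s m b)
  (0<s : 0 < s) (5s≤n : 5 * s ≤ n) where
  open Weighting weighting

  private
    -- The weights are read from vertex `β` on, as in `total`: T is formed by `β + t` with `t < s`,
    -- and R by the `N` places after them, of which those from `n` on are no vertices. H₁ refers to
    -- the unshifted first `s` vertices, and the errors with `β` pay for the difference.
    β N Y τ D : ℕ
    β = 2 * b
    N = n ∸ s
    Y = 200 * y
    τ = w (β + (s ∸ 1))
    D = Y ∸ τ

    r δ : ℕ → ℕ
    r j = w (β + (s + j))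
    δ t = Y ∸ w (β + t)

    s≤n : s ≤ n
    s≤n = ≤-trans (m≤m+n s (4 * s)) 5s≤n
    s+N≡n : s + N ≡ n
    s+N≡n = m+[n∸m]≡n s≤n
    4s≤N : 4 * s ≤ N
    4s≤N = +-cancelˡ-≤ s _ _ (≤-trans 5s≤n (≤-reflexive (sym s+N≡n)))
    0<N : 0 < N
    0<N = ≤-trans 0<s (≤-trans (m≤m+n s (3 * s)) 4s≤N)
    N≤n : N ≤ n
    N≤n = m∸n≤m n s

  open Tuples r using (subsets)

  private
    surplus : ℕ
    surplus = count (λ q → G q ∧ not (H₁ n s q))

    heavy₄ : ℕ
    heavy₄ = subsets N 4 (λ z → ⟦ Y ≤? z ⟧) 0

    light : (t j k l : ℕ) → ℕ
    light t j k l = ⟦ r l + r k + r j <? δ t ⟧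

    lights : ℕ
    lights = ∑ N (λ l → ∑ l (λ k → ∑ k (λ j → ∑ s (λ t → light t j k l))))

  heavy₄≤ : 101 * heavy₄ ≤ 100 * lights + 50 * (s * (N * N))
  heavy₄≤ = ≤-trans (light-bound r N s y D τ δ 0<N 0<y 4s≤N τ-or-0 (λ t t<s → ∸-monoʳ-≤ Y (w-anti (+-monoʳ-≤ β (pred-bound t<s))))
      (λ j _ → w-anti (+-monoʳ-≤ β (≤-trans (m∸n≤m s 1) (m≤m+n s j)))) total-light)
    (≤-reflexive (cong (λ x → 100 * x + 50 * (s * (N * N))) swap))
    where
    open ≤-Reasoning
    pred-bound : ∀ {t} → t < s → t ≤ s ∸ 1
    pred-bound {t} t<s = ∸-monoˡ-≤ 1 t<s
    τ-or-0 : τ + D ≡ Y ⊎ D ≡ 0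
    τ-or-0 with ≤-total τ Y
    ... | inj₁ τ≤Y = inj₁ (m+[n∸m]≡n τ≤Y)
    ... | inj₂ Y≤τ = inj₂ (m≤n⇒m∸n≡0 Y≤τ)
    -- The total weight is at most `s * Y`, what T would weigh without deficits, so R weighs at most
    -- their sum. Truncation in `δ` only enlarges the right side.
    total-light : ∑ N r ≤ ∑ s δ
    total-light = +-cancelˡ-≤ (∑ s (λ t → w (β + t))) _ _ (begin
      ∑ s (λ t → w (β + t)) + ∑ N r                       ≡⟨ sym (∑-split s N (λ j → w (β + j))) ⟩
      ∑ (s + N) (λ j → w (β + j))                         ≡⟨ cong (λ k → ∑ k (λ j → w (β + j))) s+N≡n ⟩
      ∑ n (λ j → w (β + j))                               ≤⟨ total ⟩
      s * Y                                               ≡⟨ sym (∑-const s Y) ⟩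
      ∑ s (λ _ → Y)                                       ≤⟨ ∑-mono s (λ t _ → m≤n+m∸n Y (w (β + t))) ⟩
      ∑ s (λ t → w (β + t) + δ t)                         ≡⟨ ∑-+ s (λ t → w (β + t)) δ ⟩
      ∑ s (λ t → w (β + t)) + ∑ s δ                       ∎)
    swap : ∑ s (λ t → subsets N 3 (λ z → ⟦ z <? δ t ⟧) 0) ≡ lights
    swap = trans (∑-swap s N (λ t l → ∑ l (λ k → ∑ k (λ j → light t j k l))))
      (∑-cong N (λ l _ → trans (∑-swap s l (λ t k → ∑ k (λ j → light t j k l)))
        (∑-cong l (λ k _ → ∑-swap s k (λ t j → light t j k l)))))

  -- An edge outside H₁ avoids the first `s` vertices. Either its least vertex is one of the next
  -- `β`, or all its vertices lie in R; in that case it is admissible, so its weight is at least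
  -- `Y`.
  surplus≤ : surplus ≤ heavy₄ + β * (n * n * n)
  surplus≤ = begin
    surplus
      ≤⟨ count≤chains (λ q → G q ∧ not (H₁ n s q)) (λ a b c d → near a + far a b c d) pointwise ⟩
    chains n (λ a b c d → near a + far a b c d)
      ≡⟨ trans (chains-+ n (λ a b c d → near a) far) (+-comm (chains n (λ a b c d → near a)) (chains n far)) ⟩
    chains n far + chains n (λ a b c d → near a)
      ≤⟨ +-mono-≤ far≤ near≤ ⟩
    heavy₄ + β * (n * n * n) ∎
    where
    open ≤-Reasoning
    near : ℕ → ℕ
    near a = ⟦ s ≤? a ⟧ * ⟦ a <? β + s ⟧
    far : (a b c d : ℕ) → ℕ
    far a b c d = ⟦ β + s ≤? a ⟧ * ⟦ Y ≤? w d + w c + w b + w a ⟧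
    reverse : ∀ x y z v → x + y + z + v ≡ v + z + y + x
    reverse = solve-∀
    pointwise : ∀ q → Increasing q → bit (G q ∧ not (H₁ n s q)) ≤ lift (λ a b c d → near a + far a b c d) q
    pointwise q@(a , b′ , c , d) inc with toℕ a <? s
    ... | yes a<s rewrite H₁-true q a<s | ∧-zeroʳ (G q) = z≤n
    ... | no a≮s with toℕ a <? β + s
    ...   | yes _ = ≤-trans (bit≤1 _) (≤-trans (≤-reflexive (sym (trans (*-identityʳ _) (⟦⟧-yes (s ≤? toℕ a) (≮⇒≥ a≮s))))) (m≤m+n _ _))
    ...   | no a≮β+s with G q in Gq
    ...     | false = z≤n
    ...     | true = ≤-trans (bit≤1 _) (≤-trans (≤-reflexive (sym (cong₂ _*_ (⟦⟧-yes (β + s ≤? toℕ a) β+s≤a)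
                (⟦⟧-yes (Y ≤? w (toℕ d) + w (toℕ c) + w (toℕ b′) + w (toℕ a)) covered)))) (m≤n+m _ _))
      where
      β+s≤a : β + s ≤ toℕ a
      β+s≤a = ≮⇒≥ a≮β+s
      covered : Y ≤ w (toℕ d) + w (toℕ c) + w (toℕ b′) + w (toℕ a)
      covered = ≤-trans (covers q ((inc , Gq) , ≤-trans (m≤m+n β s) β+s≤a)) (≤-reflexive (reverse (w (toℕ a)) (w (toℕ b′)) (w (toℕ c)) (w (toℕ d))))
    near≤ : chains n (λ a b c d → near a) ≤ β * (n * n * n)
    near≤ = ≤-trans (∑-≤const n (n * (n * β)) (λ d d<n → ≤-trans (∑-≤const d (n * β) (λ c c<d → ≤-trans (∑-≤const c β (λ b _ → ∑-window b s β))
        (*-monoˡ-≤ β (<⇒≤ (<-trans c<d d<n))))) (*-monoˡ-≤ (n * β) (<⇒≤ d<n)))) (≤-reflexive (lem n β))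
      where
      lem : ∀ n β → n * (n * (n * β)) ≡ β * (n * n * n)
      lem = solve-∀
    far≤ : chains n far ≤ heavy₄
    far≤ = begin
      chains n far
        ≡⟨ chains-shift (β + s) n (λ a b c d → ⟦ Y ≤? w d + w c + w b + w a ⟧) ⟩
      chains (n ∸ (β + s)) (λ a b c d → ⟦ Y ≤? w (β + s + d) + w (β + s + c) + w (β + s + b) + w (β + s + a) ⟧)
        ≡⟨ chains-cong (n ∸ (β + s)) (λ a b c d → cong (λ x → ⟦ Y ≤? x ⟧) (cong₂ _+_ (cong₂ _+_ (cong₂ _+_ (assoc d) (assoc c)) (assoc b)) (assoc a))) ⟩
      chains (n ∸ (β + s)) (λ a b c d → ⟦ Y ≤? r d + r c + r b + r a ⟧)
        ≤⟨ ∑-mono-range (∸-monoʳ-≤ n (m≤n+m s β)) (λ d → ∑ d (λ c → ∑ c (λ b → ∑ b (λ a → ⟦ Y ≤? r d + r c + r b + r a ⟧)))) ⟩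
      heavy₄ ∎
      where
      assoc : ∀ i → w (β + s + i) ≡ r i
      assoc i = cong w (+-assoc β s i)

  -- A light set with `β + t < s` and `l < N ∸ β` is a genuine 4-set meeting the first `s` vertices;
  -- it weighs less than `Y` and is thus missing. At most `β` values of `t` and `β` values of `l`
  -- violate these conditions.
  lights≤ : lights ≤ missing G (H₁ n s) + 2 * β * (n * n * n)
  lights≤ = begin
    lights
      ≤⟨ drop-high ⟩
    ∑ (N ∸ β) layer + β * (N * (N * s))
      ≤⟨ +-monoˡ-≤ (β * (N * (N * s))) drop-late ⟩
    (∑ (N ∸ β) kept + β * (N * N * N)) + β * (N * (N * s))
      ≤⟨ +-mono-≤ (+-mono-≤ kept≤ (*-monoʳ-≤ β (*-mono-≤ (*-mono-≤ N≤n N≤n) N≤n))) (*-monoʳ-≤ β (*-mono-≤ N≤n (*-mono-≤ N≤n s≤n))) ⟩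
    (missing G (H₁ n s) + β * (n * n * n)) + β * (n * (n * n))
      ≡⟨ lem (missing G (H₁ n s)) β n ⟩
    missing G (H₁ n s) + 2 * β * (n * n * n) ∎
    where
    open ≤-Reasoning
    lem : ∀ x β n → x + β * (n * n * n) + β * (n * (n * n)) ≡ x + 2 * β * (n * n * n)
    lem = solve-∀
    layer kept : ℕ → ℕ
    layer l = ∑ l (λ k → ∑ k (λ j → ∑ s (λ t → light t j k l)))
    kept l = ∑ l (λ k → ∑ k (λ j → ∑ s (λ t → ⟦ β + t <? s ⟧ * light t j k l)))
    layer≤ : ∀ l → l < N → layer l ≤ N * (N * s)
    layer≤ l l<N = ≤-trans (∑-≤const l (N * s) (λ k k<l → ≤-trans (∑-≤const k s (λ j _ → ≤-trans (∑-≤const s 1 (λ t _ → ⟦⟧≤1 (r l + r k + r j <? δ t))) (≤-reflexive (*-identityʳ s))))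
      (*-monoˡ-≤ s (<⇒≤ (<-trans k<l l<N))))) (*-monoˡ-≤ (N * s) (<⇒≤ l<N))
    drop-high : lights ≤ ∑ (N ∸ β) layer + β * (N * (N * s))
    drop-high with ≤-total β N
    ... | inj₁ β≤N = begin
      ∑ N layer                                                      ≡⟨ cong (λ k → ∑ k layer) (sym (m∸n+n≡m β≤N)) ⟩
      ∑ (N ∸ β + β) layer                                            ≡⟨ ∑-split (N ∸ β) β layer ⟩
      ∑ (N ∸ β) layer + ∑ β (λ i → layer (N ∸ β + i))                ≤⟨ +-monoʳ-≤ (∑ (N ∸ β) layer) (∑-≤const β _ (λ i i<β → layer≤ (N ∸ β + i) (<-≤-trans (+-monoʳ-< (N ∸ β) i<β) (≤-reflexive (m∸n+n≡m β≤N))))) ⟩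
      ∑ (N ∸ β) layer + β * (N * (N * s))                            ∎
    ... | inj₂ N≤β = ≤-trans (∑-≤const N _ layer≤) (≤-trans (*-monoˡ-≤ (N * (N * s)) N≤β) (m≤n+m _ _))
    late : ℕ
    late = ∑ s (λ t → ⟦ s ≤? β + t ⟧)
    late≤ : late ≤ β
    late≤ = begin
      ∑ s (λ t → ⟦ s ≤? β + t ⟧)                                     ≤⟨ ∑-mono s (λ t t<s → in-window t t<s) ⟩
      ∑ s (λ t → ⟦ s ∸ β ≤? t ⟧ * ⟦ t <? β + (s ∸ β) ⟧)              ≤⟨ ∑-window s (s ∸ β) β ⟩
      β                                                              ∎
      where
      in-window : ∀ t → t < s → ⟦ s ≤? β + t ⟧ ≤ ⟦ s ∸ β ≤? t ⟧ * ⟦ t <? β + (s ∸ β) ⟧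
      in-window t t<s with s ≤? β + t
      ... | no _ = z≤n
      ... | yes p = ≤-reflexive (sym (cong₂ _*_ (⟦⟧-yes (s ∸ β ≤? t) (m≤n+o⇒m∸n≤o s β p)) (⟦⟧-yes (t <? β + (s ∸ β)) (<-≤-trans t<s (m≤n+m∸n s β)))))
    split-late : ∀ t x → x ≤ 1 → x ≤ ⟦ β + t <? s ⟧ * x + ⟦ s ≤? β + t ⟧
    split-late t x x≤1 with β + t <? s | s ≤? β + t
    ... | yes _ | _     = ≤-trans (≤-reflexive (sym (*-identityˡ x))) (m≤m+n _ _)
    ... | no _  | yes _ = x≤1
    ... | no p  | no q  = ⊥-elim (q (≮⇒≥ p))
    layer-split : ∀ l → l < N → layer l ≤ kept l + N * N * β
    layer-split l l<N = begin
      layer l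
        ≤⟨ ∑-mono l (λ k _ → ∑-mono k (λ j _ → ≤-trans (∑-mono s (λ t _ → split-late t (light t j k l) (⟦⟧≤1 (r l + r k + r j <? δ t))))
             (≤-trans (≤-reflexive (∑-+ s (λ t → ⟦ β + t <? s ⟧ * light t j k l) (λ t → ⟦ s ≤? β + t ⟧))) (+-monoʳ-≤ _ late≤)))) ⟩
      ∑ l (λ k → ∑ k (λ j → ∑ s (λ t → ⟦ β + t <? s ⟧ * light t j k l) + β))
        ≡⟨ trans (∑-cong l (λ k _ → ∑-+ k (λ j → ∑ s (λ t → ⟦ β + t <? s ⟧ * light t j k l)) (λ _ → β))) (∑-+ l _ (λ k → ∑ k (λ _ → β))) ⟩
      kept l + ∑ l (λ k → ∑ k (λ _ → β))
        ≤⟨ +-monoʳ-≤ (kept l) (≤-trans (∑-≤const l (N * β) (λ k k<l → ≤-trans (≤-reflexive (∑-const k β)) (*-monoˡ-≤ β (<⇒≤ (<-trans k<l l<N))))) (*-monoˡ-≤ (N * β) (<⇒≤ l<N))) ⟩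
      kept l + N * (N * β)
        ≡⟨ cong (kept l +_) (sym (*-assoc N N β)) ⟩
      kept l + N * N * β ∎
    drop-late : ∑ (N ∸ β) layer ≤ ∑ (N ∸ β) kept + β * (N * N * N)
    drop-late = begin
      ∑ (N ∸ β) layer                                  ≤⟨ ∑-mono (N ∸ β) (λ l l< → layer-split l (<-≤-trans l< (m∸n≤m N β))) ⟩
      ∑ (N ∸ β) (λ l → kept l + N * N * β)             ≡⟨ trans (∑-+ (N ∸ β) kept (λ _ → N * N * β)) (cong (∑ (N ∸ β) kept +_) (∑-const (N ∸ β) (N * N * β))) ⟩
      ∑ (N ∸ β) kept + (N ∸ β) * (N * N * β)           ≤⟨ +-monoʳ-≤ (∑ (N ∸ β) kept) (*-monoˡ-≤ (N * N * β) (m∸n≤m N β)) ⟩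
      ∑ (N ∸ β) kept + N * (N * N * β)                 ≡⟨ cong (∑ (N ∸ β) kept +_) (lem′ N β) ⟩
      ∑ (N ∸ β) kept + β * (N * N * N)                 ∎
      where
      lem′ : ∀ N β → N * (N * N * β) ≡ β * (N * N * N)
      lem′ = solve-∀
    nonedge : (a b c d : ℕ) → ℕ
    nonedge a b c d = ⟦ a <? s ⟧ * ⟦ w d + w c + w b <? Y ∸ w a ⟧
    missing-pointwise : ∀ q → Increasing q → lift (λ a b c d → ⟦ β ≤? a ⟧ * nonedge a b c d) q ≤ bit (H₁ n s q ∧ not (G q))
    missing-pointwise q@(a , b′ , c , d) inc with β ≤? toℕ a | toℕ a <? s | w (toℕ d) + w (toℕ c) + w (toℕ b′) <? Y ∸ w (toℕ a)
    ... | no _ | _ | _ = z≤n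
    ... | yes _ | no _ | _ = z≤n
    ... | yes _ | yes _ | no _ = z≤n
    ... | yes β≤a | yes a<s | yes low rewrite H₁-true q a<s with G q in Gq
    ...   | false = ≤-refl
    ...   | true = ⊥-elim (<⇒≱ light-edge (covers q ((inc , Gq) , β≤a)))
      where
      light-edge : coordinates w q < Y
      light-edge = begin-strict
        w (toℕ a) + w (toℕ b′) + w (toℕ c) + w (toℕ d)        ≡⟨ rotate (w (toℕ a)) (w (toℕ b′)) (w (toℕ c)) (w (toℕ d)) ⟩
        w (toℕ d) + w (toℕ c) + w (toℕ b′) + w (toℕ a)        <⟨ m<n∸o⇒m+o<n low ⟩
        Y                                                     ∎
        where
        rotate : ∀ a b c d → a + b + c + d ≡ d + c + b + a
        rotate = solve-∀
        m<n∸o⇒m+o<n : ∀ {m n o} → m < n ∸ o → m + o < n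
        m<n∸o⇒m+o<n {m} {n} {o} p = ≤-trans (+-monoˡ-≤ o p) (≤-reflexive (m∸n+n≡m (<⇒≤ o<n)))
          where
          o<n : o < n
          o<n = ≰⇒> (λ n≤o → <⇒≱ p (≤-trans (≤-reflexive (m≤n⇒m∸n≡0 n≤o)) z≤n))
    ∑-drop : ∀ c (f : ℕ → ℕ) → ∑ (c ∸ s) (λ i → f (s + i)) ≤ ∑ c f
    ∑-drop c f with ≤-total s c
    ... | inj₁ s≤c = ≤-trans (m≤n+m _ (∑ s f)) (≤-trans (≤-reflexive (sym (∑-split s (c ∸ s) f))) (≤-reflexive (cong (λ k → ∑ k f) (m+[n∸m]≡n s≤c))))
    ... | inj₂ c≤s = ≤-trans (≤-reflexive (cong (λ k → ∑ k (λ i → f (s + i))) (m≤n⇒m∸n≡0 c≤s))) z≤n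
    ∑-drop-at : ∀ c (f : ℕ → ℕ) → ∑ c (λ i → f (s + i)) ≤ ∑ (s + c) f
    ∑-drop-at c f = ≤-trans (≤-reflexive (cong (λ k → ∑ k (λ i → f (s + i))) (sym (m+n∸m≡n s c)))) (∑-drop (s + c) f)
    kept≤ : ∑ (N ∸ β) kept ≤ missing G (H₁ n s)
    kept≤ = begin
      ∑ (N ∸ β) kept
        ≡⟨ cong (λ k → ∑ k kept) (trans (∸-+-assoc n s β) (trans (cong (n ∸_) (+-comm s β)) (sym (∸-+-assoc n β s)))) ⟩
      ∑ (n ∸ β ∸ s) kept
        -- The ranges `t < s` and `s + j < s + k < s + l` are relaxed one at a time to those of
        -- arbitrary increasing quadruples, which only adds terms.
        ≤⟨ ∑-mono (n ∸ β ∸ s) (λ l _ → ∑-mono l (λ k _ → ∑-mono k (λ j _ → ∑-mono-range (m≤m+n s j) (λ t → ψ t (s + j) (s + k) (s + l))))) ⟩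
      ∑ (n ∸ β ∸ s) (λ l → ∑ l (λ k → ∑ k (λ j → ∑ (s + j) (λ t → ψ t (s + j) (s + k) (s + l)))))
        ≤⟨ ∑-mono (n ∸ β ∸ s) (λ l _ → ∑-mono l (λ k _ → ∑-drop-at k (λ b → ∑ b (λ t → ψ t b (s + k) (s + l))))) ⟩
      ∑ (n ∸ β ∸ s) (λ l → ∑ l (λ k → ∑ (s + k) (λ b → ∑ b (λ t → ψ t b (s + k) (s + l)))))
        ≤⟨ ∑-mono (n ∸ β ∸ s) (λ l _ → ∑-drop-at l (λ c → ∑ c (λ b → ∑ b (λ t → ψ t b c (s + l))))) ⟩
      ∑ (n ∸ β ∸ s) (λ l → ∑ (s + l) (λ c → ∑ c (λ b → ∑ b (λ t → ψ t b c (s + l)))))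
        ≤⟨ ∑-drop (n ∸ β) (λ d → ∑ d (λ c → ∑ c (λ b → ∑ b (λ t → ψ t b c d)))) ⟩
      chains (n ∸ β) ψ
        ≡⟨ sym (chains-shift β n nonedge) ⟩
      chains n (λ a b c d → ⟦ β ≤? a ⟧ * nonedge a b c d)
        ≤⟨ chains≤count (λ q → H₁ n s q ∧ not (G q)) (λ a b c d → ⟦ β ≤? a ⟧ * nonedge a b c d) missing-pointwise ⟩
      missing G (H₁ n s) ∎
      where
      ψ : (a b c d : ℕ) → ℕ
      ψ a b c d = nonedge (β + a) (β + b) (β + c) (β + d)

  surplus-bound : 0 < b → 101 * surplus ≤ 100 * missing G (H₁ n s) + 652 * (b * (n * n * n))
  surplus-bound 0<b = begin
    101 * surplus
      ≤⟨ *-monoʳ-≤ 101 surplus≤ ⟩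
    101 * (heavy₄ + β * n³)
      ≡⟨ *-distribˡ-+ 101 heavy₄ (β * n³) ⟩
    101 * heavy₄ + 101 * (β * n³)
      ≤⟨ +-monoˡ-≤ (101 * (β * n³)) heavy₄≤ ⟩
    100 * lights + 50 * (s * (N * N)) + 101 * (β * n³)
      ≤⟨ +-monoˡ-≤ (101 * (β * n³)) (+-mono-≤ (*-monoʳ-≤ 100 lights≤) (*-monoʳ-≤ 50 sNN≤)) ⟩
    100 * (missing G (H₁ n s) + 2 * β * n³) + 50 * (b * n³) + 101 * (β * n³)
      -- With `β = 2 * b` the errors are 400 from `lights≤`, 50 from `light-bound` and 202 from
      -- `surplus≤`.
      ≡⟨ lem (missing G (H₁ n s)) b n³ ⟩
    100 * missing G (H₁ n s) + 652 * (b * n³) ∎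
    where
    open ≤-Reasoning
    n³ : ℕ
    n³ = n * n * n
    sNN≤ : s * (N * N) ≤ b * n³
    sNN≤ = ≤-trans (*-mono-≤ s≤n (*-mono-≤ N≤n N≤n)) (≤-trans (≤-reflexive (sym (*-assoc n n n))) (≤-trans (≤-reflexive (sym (*-identityˡ n³))) (*-monoˡ-≤ n³ 0<b)))
    lem : ∀ x b q → 100 * (x + 2 * (2 * b) * q) + 50 * (b * q) + 101 * (2 * b * q) ≡ 100 * x + 652 * (b * q)
    lem = solve-∀

  missing-edges : missing G (H₁ n s) + edges G ≡ count (H₁ n s) + surplus
  missing-edges = count-exchange G (H₁ n s)

-- Rational bookkeeping

-- Imported here because the prefix +_ makes sections of addition ambiguous.
open import Data.Integer using (+_; -[1+_])

ℕ→ℚ-mkℚ : ∀ k → ℕ→ℚ k ≡ mkℚ (+ k) 0 (Coprimality.sym (1-coprimeTo k))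
ℕ→ℚ-mkℚ k = ℚ.normalize-coprime (Coprimality.sym (1-coprimeTo k))

toℚᵘ-ℕ→ℚ : ∀ k → toℚᵘ (ℕ→ℚ k) ≡ mkℚᵘ (+ k) 0
toℚᵘ-ℕ→ℚ k = cong toℚᵘ (ℕ→ℚ-mkℚ k)

ℕ→ℚ-+ : ∀ a b → ℕ→ℚ (a + b) ≡ ℕ→ℚ a ℚ.+ ℕ→ℚ b
ℕ→ℚ-+ a b = sym (ℚ.toℚᵘ-injective (begin
  toℚᵘ (ℕ→ℚ a ℚ.+ ℕ→ℚ b)              ≈⟨ ℚ.toℚᵘ-homo-+ (ℕ→ℚ a) (ℕ→ℚ b) ⟩
  toℚᵘ (ℕ→ℚ a) ℚᵘ.+ toℚᵘ (ℕ→ℚ b)      ≡⟨ cong₂ ℚᵘ._+_ (toℚᵘ-ℕ→ℚ a) (toℚᵘ-ℕ→ℚ b) ⟩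
  mkℚᵘ (+ a) 0 ℚᵘ.+ mkℚᵘ (+ b) 0       ≡⟨ cong (λ x → mkℚᵘ x 0) (cong₂ ℤ._+_ (ℤ.*-identityʳ (+ a)) (ℤ.*-identityʳ (+ b))) ⟩
  mkℚᵘ (+ (a + b)) 0                   ≡⟨ sym (toℚᵘ-ℕ→ℚ (a + b)) ⟩
  toℚᵘ (ℕ→ℚ (a + b))                  ∎))
  where open ℚᵘ.≃-Reasoning

ℕ→ℚ-* : ∀ a b → ℕ→ℚ (a * b) ≡ ℕ→ℚ a ℚ.* ℕ→ℚ b
ℕ→ℚ-* a b = sym (ℚ.toℚᵘ-injective (begin
  toℚᵘ (ℕ→ℚ a ℚ.* ℕ→ℚ b)              ≈⟨ ℚ.toℚᵘ-homo-* (ℕ→ℚ a) (ℕ→ℚ b) ⟩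
  toℚᵘ (ℕ→ℚ a) ℚᵘ.* toℚᵘ (ℕ→ℚ b)      ≡⟨ cong₂ ℚᵘ._*_ (toℚᵘ-ℕ→ℚ a) (toℚᵘ-ℕ→ℚ b) ⟩
  mkℚᵘ (+ a) 0 ℚᵘ.* mkℚᵘ (+ b) 0       ≡⟨ cong (λ x → mkℚᵘ x 0) (sym (ℤ.pos-* a b)) ⟩
  mkℚᵘ (+ (a * b)) 0                   ≡⟨ sym (toℚᵘ-ℕ→ℚ (a * b)) ⟩
  toℚᵘ (ℕ→ℚ (a * b))                  ∎))
  where open ℚᵘ.≃-Reasoning

ℕ→ℚ-cancel-≤ : ∀ {a b} → ℕ→ℚ a ℚ.≤ ℕ→ℚ b → a ≤ b
ℕ→ℚ-cancel-≤ {a} {b} p rewrite ℕ→ℚ-mkℚ a | ℕ→ℚ-mkℚ b =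
  ℤ.drop‿+≤+ (subst₂ ℤ._≤_ (ℤ.*-identityʳ (+ a)) (ℤ.*-identityʳ (+ b)) (ℚ.drop-*≤* p))

ℕ→ℚ-mono-< : ∀ {a b} → a < b → ℕ→ℚ a ℚ.< ℕ→ℚ b
ℕ→ℚ-mono-< {a} {b} p rewrite ℕ→ℚ-mkℚ a | ℕ→ℚ-mkℚ b =
  ℚ.*<* (subst₂ ℤ._<_ (sym (ℤ.*-identityʳ (+ a))) (sym (ℤ.*-identityʳ (+ b))) (ℤ.+<+ p))

ℕ→ℚ-nonNegative : ∀ k → ℚ.NonNegative (ℕ→ℚ k)
ℕ→ℚ-nonNegative k rewrite ℕ→ℚ-mkℚ k = _

denominator-cancels : ∀ p d .(c : Coprime p (suc d)) → mkℚ (+ p) d c ℚ.* ℕ→ℚ (suc d) ≡ ℕ→ℚ p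
denominator-cancels p d c = ℚ.toℚᵘ-injective (begin
  toℚᵘ (mkℚ (+ p) d c ℚ.* ℕ→ℚ (suc d))         ≈⟨ ℚ.toℚᵘ-homo-* (mkℚ (+ p) d c) (ℕ→ℚ (suc d)) ⟩
  mkℚᵘ (+ p) d ℚᵘ.* toℚᵘ (ℕ→ℚ (suc d))          ≡⟨ cong (mkℚᵘ (+ p) d ℚᵘ.*_) (toℚᵘ-ℕ→ℚ (suc d)) ⟩
  mkℚᵘ (+ p) d ℚᵘ.* mkℚᵘ (+ suc d) 0            ≈⟨ *≡* (ℤ.*-assoc (+ p) (+ suc d) (+ 1)) ⟩
  mkℚᵘ (+ p) 0                                  ≡⟨ sym (toℚᵘ-ℕ→ℚ p) ⟩
  toℚᵘ (ℕ→ℚ p)                                 ∎)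
  where open ℚᵘ.≃-Reasoning

module _ (p d : ℕ) .(cop : Coprime p (suc d)) where
  private
    ε : ℚ
    ε = mkℚ (+ p) d cop
    q : ℕ
    q = suc d

  scaled-lower : ∀ n s → ε ℚ.* ℕ→ℚ n ℚ.≤ ℕ→ℚ s → p * n ≤ s * q
  scaled-lower n s h = ℕ→ℚ-cancel-≤ (begin
    ℕ→ℚ (p * n)                        ≡⟨ ℕ→ℚ-* p n ⟩
    ℕ→ℚ p ℚ.* ℕ→ℚ n                    ≡⟨ cong (ℚ._* ℕ→ℚ n) (sym (denominator-cancels p d cop)) ⟩
    ε ℚ.* ℕ→ℚ q ℚ.* ℕ→ℚ n              ≡⟨ exchange ε (ℕ→ℚ q) (ℕ→ℚ n) ⟩
    ε ℚ.* ℕ→ℚ n ℚ.* ℕ→ℚ q              ≤⟨ ℚ.*-monoʳ-≤-nonNeg (ℕ→ℚ q) {{ℕ→ℚ-nonNegative q}} h ⟩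
    ℕ→ℚ s ℚ.* ℕ→ℚ q                    ≡⟨ sym (ℕ→ℚ-* s q) ⟩
    ℕ→ℚ (s * q)                        ∎)
    where
    open ℚ.≤-Reasoning
    exchange : ∀ x y z → x ℚ.* y ℚ.* z ≡ x ℚ.* z ℚ.* y
    exchange x y z = trans (ℚ.*-assoc x y z) (trans (cong (x ℚ.*_) (ℚ.*-comm y z)) (sym (ℚ.*-assoc x z y)))

  scaled-deficit : ∀ A B M e → ℕ→ℚ A ℚ.- ℕ→ℚ B ℚ.- ε ℚ.* ℕ→ℚ M ℚ.≤ ℕ→ℚ e → A * q ≤ (e + B) * q + p * M
  scaled-deficit A B M e h = ℕ→ℚ-cancel-≤ (begin
    ℕ→ℚ (A * q)                                          ≡⟨ ℕ→ℚ-* A q ⟩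
    ℕ→ℚ A ℚ.* Q                                          ≤⟨ ℚ.*-monoʳ-≤-nonNeg Q {{ℕ→ℚ-nonNegative q}} (move (ℕ→ℚ A) (ℕ→ℚ B) (ε ℚ.* ℕ→ℚ M) (ℕ→ℚ e) h) ⟩
    (ℕ→ℚ e ℚ.+ ε ℚ.* ℕ→ℚ M ℚ.+ ℕ→ℚ B) ℚ.* Q              ≡⟨ rearrange (ℕ→ℚ e) ε (ℕ→ℚ M) (ℕ→ℚ B) Q ⟩
    (ℕ→ℚ e ℚ.+ ℕ→ℚ B) ℚ.* Q ℚ.+ (ε ℚ.* Q) ℚ.* ℕ→ℚ M      ≡⟨ cong₂ ℚ._+_ (cong (ℚ._* Q) (sym (ℕ→ℚ-+ e B))) (cong (ℚ._* ℕ→ℚ M) (denominator-cancels p d cop)) ⟩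
    ℕ→ℚ (e + B) ℚ.* Q ℚ.+ ℕ→ℚ p ℚ.* ℕ→ℚ M                ≡⟨ cong₂ ℚ._+_ (sym (ℕ→ℚ-* (e + B) q)) (sym (ℕ→ℚ-* p M)) ⟩
    ℕ→ℚ ((e + B) * q) ℚ.+ ℕ→ℚ (p * M)                    ≡⟨ sym (ℕ→ℚ-+ ((e + B) * q) (p * M)) ⟩
    ℕ→ℚ ((e + B) * q + p * M)                            ∎)
    where
    open ℚ.≤-Reasoning
    Q : ℚ
    Q = ℕ→ℚ q
    cancel : ∀ x y → x ℚ.- y ℚ.+ y ≡ x
    cancel x y = trans (ℚ.+-assoc x (ℚ.- y) y) (trans (cong (x ℚ.+_) (ℚ.+-inverseˡ y)) (ℚ.+-identityʳ x))
    move : ∀ a b x e → a ℚ.- b ℚ.- x ℚ.≤ e → a ℚ.≤ e ℚ.+ x ℚ.+ b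
    move a b x e h = begin
      a                                 ≡⟨ sym (trans (cong (ℚ._+ b) (cancel (a ℚ.- b) x)) (cancel a b)) ⟩
      a ℚ.- b ℚ.- x ℚ.+ x ℚ.+ b         ≤⟨ ℚ.+-monoˡ-≤ b (ℚ.+-monoˡ-≤ x h) ⟩
      e ℚ.+ x ℚ.+ b                     ∎
    rearrange : ∀ e ε M B Q → (e ℚ.+ ε ℚ.* M ℚ.+ B) ℚ.* Q ≡ (e ℚ.+ B) ℚ.* Q ℚ.+ (ε ℚ.* Q) ℚ.* M
    rearrange e ε M B Q = trans (cong (ℚ._* Q) (trans (ℚ.+-assoc e (ε ℚ.* M) B) (trans (cong (e ℚ.+_) (ℚ.+-comm (ε ℚ.* M) B)) (sym (ℚ.+-assoc e B (ε ℚ.* M))))))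
      (trans (ℚ.*-distribʳ-+ Q (e ℚ.+ B) (ε ℚ.* M)) (cong ((e ℚ.+ B) ℚ.* Q ℚ.+_)
        (trans (ℚ.*-assoc ε M Q) (trans (cong (ε ℚ.*_) (ℚ.*-comm M Q)) (sym (ℚ.*-assoc ε Q M))))))

  scaled-upper : ∀ x X → x * q < X * p → ℕ→ℚ x ℚ.< ℕ→ℚ X ℚ.* ε
  scaled-upper x X h = ℚ.*-cancelʳ-<-nonNeg (ℕ→ℚ q) {{ℕ→ℚ-nonNegative q}} (begin-strict
    ℕ→ℚ x ℚ.* ℕ→ℚ q                    ≡⟨ sym (ℕ→ℚ-* x q) ⟩
    ℕ→ℚ (x * q)                        <⟨ ℕ→ℚ-mono-< h ⟩
    ℕ→ℚ (X * p)                        ≡⟨ ℕ→ℚ-* X p ⟩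
    ℕ→ℚ X ℚ.* ℕ→ℚ p                    ≡⟨ cong (ℕ→ℚ X ℚ.*_) (sym (denominator-cancels p d cop)) ⟩
    ℕ→ℚ X ℚ.* (ε ℚ.* ℕ→ℚ q)            ≡⟨ sym (ℚ.*-assoc (ℕ→ℚ X) ε (ℕ→ℚ q)) ⟩
    ℕ→ℚ X ℚ.* ε ℚ.* ℕ→ℚ q              ∎)
    where open ℚ.≤-Reasoning

^-distribʳ-* : ∀ k a b → (a * b) ^ k ≡ a ^ k * b ^ k
^-distribʳ-* zero    a b = refl
^-distribʳ-* (suc k) a b = trans (cong (a * b *_) (^-distribʳ-* k a b)) (lem a b (a ^ k) (b ^ k))
  where
  lem : ∀ a b x y → a * b * (x * y) ≡ a * x * (b * y)
  lem = solve-∀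

-- As `p ≤ q`, the fourth power of `p / q` is at most `p / q`; so a bound linear in ε implies the
-- one with its fourth root.
fourth-power-bound : ∀ x p q n → 0 < p → p ≤ q → 0 < n → q * x ≤ 102 * (p * n ^ 4) → ∀ K → 102 ^ 4 < K → x ^ 4 * q < K * n ^ 16 * p
fourth-power-bound x p q n 0<p p≤q 0<n h K 102⁴<K = begin-strict
  x ^ 4 * q                       ≤⟨ *-cancelʳ-≤ _ _ (q ^ 3) {{m^n≢0 q 3 {{>-nonZero (≤-trans 0<p p≤q)}}}} (begin
    x ^ 4 * q * q ^ 3             ≡⟨ *-assoc (x ^ 4) q (q ^ 3) ⟩
    x ^ 4 * q ^ 4                 ≡⟨ *-comm (x ^ 4) (q ^ 4) ⟩
    q ^ 4 * x ^ 4                 ≡⟨ sym (^-distribʳ-* 4 q x) ⟩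
    (q * x) ^ 4                   ≤⟨ ^-monoˡ-≤ 4 h ⟩
    (102 * (p * n ^ 4)) ^ 4       ≡⟨ trans (^-distribʳ-* 4 102 (p * n ^ 4)) (cong (102 ^ 4 *_) (trans (^-distribʳ-* 4 p (n ^ 4)) (cong (p ^ 4 *_) (^-*-assoc n 4 4)))) ⟩
    102 ^ 4 * (p ^ 4 * n ^ 16)    ≡⟨ lem (102 ^ 4) p (p ^ 3) (n ^ 16) ⟩
    102 ^ 4 * n ^ 16 * p * p ^ 3  ≤⟨ *-monoʳ-≤ (102 ^ 4 * n ^ 16 * p) (^-monoˡ-≤ 3 p≤q) ⟩
    102 ^ 4 * n ^ 16 * p * q ^ 3  ∎) ⟩
  102 ^ 4 * n ^ 16 * p            <⟨ *-monoˡ-< p {{>-nonZero 0<p}} (*-monoˡ-< (n ^ 16) {{m^n≢0 n 16 {{>-nonZero 0<n}}}} 102⁴<K) ⟩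
  K * n ^ 16 * p                  ∎
  where
  open ≤-Reasoning
  lem : ∀ k p r N → k * (p * r * N) ≡ k * N * p * r
  lem = solve-∀

-- In units of `p * N / q`, the density hypothesis says x ≤ g + 1. Inserted into 101 g ≤ 100 x + err
-- this leaves x ≤ 101 + err, and the error is at most 1 because `p` is at least 1.
missing-bound : ∀ x e h g B A q p N err → x + e ≡ h + g → h + B ≡ A → A * q ≤ (e + B) * q + p * N →
  101 * g ≤ 100 * x + err → q * err ≤ N → 0 < p → q * x ≤ 102 * (p * N)
missing-bound x e h g B A q p N err x+e≡h+g h+B≡A A≤ g≤ err≤ 0<p = +-cancelʳ-≤ (100 * (q * x)) _ _ (begin
  q * x + 100 * (q * x)                          ≡⟨ lem₁ q x ⟩
  101 * (q * x)                                  ≤⟨ *-monoʳ-≤ 101 qx≤ ⟩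
  101 * (q * g + p * N)                          ≡⟨ lem₂ q g (p * N) ⟩
  q * (101 * g) + 101 * (p * N)                  ≤⟨ +-monoˡ-≤ (101 * (p * N)) (*-monoʳ-≤ q g≤) ⟩
  q * (100 * x + err) + 101 * (p * N)            ≡⟨ lem₃ q x err (p * N) ⟩
  q * err + (100 * (q * x) + 101 * (p * N))      ≤⟨ +-monoˡ-≤ _ (≤-trans err≤ (≤-trans (≤-reflexive (sym (*-identityˡ N))) (*-monoˡ-≤ N 0<p))) ⟩
  p * N + (100 * (q * x) + 101 * (p * N))        ≡⟨ lem₄ (p * N) (q * x) ⟩
  102 * (p * N) + 100 * (q * x)                  ∎)
  where
  open ≤-Reasoning
  lem₁ : ∀ q x → q * x + 100 * (q * x) ≡ 101 * (q * x)
  lem₁ = solve-∀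
  lem₂ : ∀ q g z → 101 * (q * g + z) ≡ q * (101 * g) + 101 * z
  lem₂ = solve-∀
  lem₃ : ∀ q x r z → q * (100 * x + r) + 101 * z ≡ q * r + (100 * (q * x) + 101 * z)
  lem₃ = solve-∀
  lem₄ : ∀ z y → z + (100 * y + 101 * z) ≡ 102 * z + 100 * y
  lem₄ = solve-∀
  qx≤ : q * x ≤ q * g + p * N
  qx≤ = +-cancelʳ-≤ (q * e + q * B) _ _ (begin
    q * x + (q * e + q * B)            ≡⟨ l₁ q x e B ⟩
    q * (x + e) + q * B                ≡⟨ cong (λ z → q * z + q * B) x+e≡h+g ⟩
    q * (h + g) + q * B                ≡⟨ l₂ q h g B ⟩
    (h + B) * q + q * g                ≡⟨ cong (λ z → z * q + q * g) h+B≡A ⟩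
    A * q + q * g                      ≤⟨ +-monoˡ-≤ (q * g) A≤ ⟩
    (e + B) * q + p * N + q * g        ≡⟨ l₃ e B q (p * N) g ⟩
    q * g + p * N + (q * e + q * B)    ∎)
    where
    l₁ : ∀ q x e B → q * x + (q * e + q * B) ≡ q * (x + e) + q * B
    l₁ = solve-∀
    l₂ : ∀ q h g B → q * (h + g) + q * B ≡ (h + B) * q + q * g
    l₂ = solve-∀
    l₃ : ∀ e B q z g → (e + B) * q + z + q * g ≡ q * g + z + (q * e + q * B)
    l₃ = solve-∀

-- The factor 1304 = 2 · 652 makes the error term of surplus-bound at most n⁴ / q.
module Scale (q n s : ℕ) (0<q : 0 < q) where
  m : ℕ
  m = 1304 * q

  private instance
    m≢0 : NonZero m
    m≢0 = >-nonZero (≤-trans 0<q (m≤m+n q (1303 * q)))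

  b : ℕ
  b = suc (n ℕ./ m)

  n≤mb : n ≤ m * b
  n≤mb = begin
    n                       ≡⟨ m≡m%n+[m/n]*n n m ⟩
    n ℕ.% m + n ℕ./ m * m     ≤⟨ +-monoˡ-≤ (n ℕ./ m * m) (<⇒≤ (m%n<n n m)) ⟩
    m + n ℕ./ m * m           ≡⟨ *-comm b m ⟩
    m * b                   ∎
    where open ≤-Reasoning

  module _ (m≤n : m ≤ n) where

    mb≤2n : m * b ≤ 2 * n
    mb≤2n = begin
      m * b              ≡⟨ *-comm m b ⟩
      m + n ℕ./ m * m      ≤⟨ +-mono-≤ m≤n (m/n*n≤m n m) ⟩
      n + n              ≡⟨ lem n ⟩
      2 * n              ∎
      where
      open ≤-Reasoning
      lem : ∀ n → n + n ≡ 2 * n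
      lem = solve-∀

    error-small : q * (652 * (b * (n * n * n))) ≤ n ^ 4
    error-small = *-cancelˡ-≤ 2 (begin
      2 * (q * (652 * (b * (n * n * n))))    ≡⟨ lem q b n ⟩
      m * b * (n * n * n)                    ≤⟨ *-monoˡ-≤ (n * n * n) mb≤2n ⟩
      2 * n * (n * n * n)                    ≡⟨ lem′ n ⟩
      2 * (n * (n * (n * (n * 1))))          ∎)
      where
      open ≤-Reasoning
      lem : ∀ q b n → 2 * (q * (652 * (b * (n * n * n)))) ≡ 1304 * q * b * (n * n * n)
      lem = solve-∀
      lem′ : ∀ n → 2 * n * (n * n * n) ≡ 2 * (n * (n * (n * (n * 1))))
      lem′ = solve-∀

    -- Since `4 * s ≤ n ≤ m * b`, the increment is at most `2 * m * (m * b) ^ 2`. So `(2 * y) ^ 2`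
    -- is at most 16 s m³ b², and `y` fits into half of `s * b`; the other half holds `m * b`.
    room : 5 * s ≤ n → 40 * (m * m * m) ≤ s → ∀ {G : FourGraph n} y → y * y ≤ suc s * increment G s m b → m * b + y ≤ s * b
    room 5s≤n 40m³≤s y y²≤ = *-cancelˡ-≤ 2 (begin
      2 * (m * b + y)              ≡⟨ lem m b y ⟩
      2 * m * b + 2 * y            ≤⟨ +-mono-≤ (*-monoˡ-≤ b 2m≤s) 2y≤ ⟩
      s * b + s * b                ≡⟨ lem′ (s * b) ⟩
      2 * (s * b)                  ∎)
      where
      open ≤-Reasoning
      lem : ∀ m b y → 2 * (m * b + y) ≡ 2 * m * b + 2 * y
      lem = solve-∀
      lem′ : ∀ x → x + x ≡ 2 * x
      lem′ = solve-∀
      0<m : 0 < m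
      0<m = ≤-trans 0<q (m≤m+n q (1303 * q))
      m≤m³ : m ≤ m * m * m
      m≤m³ = ≤-trans (≤-reflexive (sym (trans (*-identityʳ (m * 1)) (*-identityʳ m)))) (*-mono-≤ (*-monoʳ-≤ m 0<m) 0<m)
      2m≤s : 2 * m ≤ s
      2m≤s = ≤-trans (*-mono-≤ {2} {40} (s≤s (s≤s z≤n)) m≤m³) 40m³≤s
      0<s : 0 < s
      0<s = ≤-trans 0<m (≤-trans (m≤m+n m (m + 0)) 2m≤s)
      4s≤2mb : 4 * s ≤ m * b
      4s≤2mb = ≤-trans (≤-trans (m≤n+m (4 * s) s) 5s≤n) n≤mb
      square≤ : (2 * y) * (2 * y) ≤ (s * b) * (s * b)
      square≤ = begin
        (2 * y) * (2 * y)                                           ≡⟨ e₁ y ⟩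
        4 * (y * y)                                                 ≤⟨ *-monoʳ-≤ 4 y²≤ ⟩
        4 * (suc s * (m * (4 * s * (4 * s) + m * b * (m * b))))     ≤⟨ *-monoʳ-≤ 4 (*-mono-≤ (+-monoˡ-≤ s 0<s) (*-monoʳ-≤ m (+-monoˡ-≤ (m * b * (m * b)) (*-mono-≤ 4s≤2mb 4s≤2mb)))) ⟩
        4 * ((s + s) * (m * (m * b * (m * b) + m * b * (m * b))))   ≡⟨ e₂ s m b ⟩
        s * (16 * (m * m * m)) * (b * b)                            ≤⟨ *-monoˡ-≤ (b * b) (*-monoʳ-≤ s (≤-trans (*-monoˡ-≤ (m * m * m) (m≤m+n 16 24)) 40m³≤s)) ⟩
        s * s * (b * b)                                             ≡⟨ e₃ s b ⟩
        (s * b) * (s * b)                                           ∎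
        where
        e₁ : ∀ y → (2 * y) * (2 * y) ≡ 4 * (y * y)
        e₁ = solve-∀
        e₂ : ∀ s m b → 4 * ((s + s) * (m * (m * b * (m * b) + m * b * (m * b)))) ≡ s * (16 * (m * m * m)) * (b * b)
        e₂ = solve-∀
        e₃ : ∀ s b → s * s * (b * b) ≡ (s * b) * (s * b)
        e₃ = solve-∀
      2y≤ : 2 * y ≤ s * b
      2y≤ = ≮⇒≥ (λ sb< → <⇒≱ (*-mono-< sb< sb<) square≤)

-- Choice of the threshold and conclusion

module _ (p₀ d₀ : ℕ) .(cop₀ : Coprime (suc p₀) (suc d₀)) (p d : ℕ) .(cop : Coprime (suc p) (suc d)) where
  private
    c ε : ℚ
    c = mkℚ (+ suc p₀) d₀ cop₀
    ε = mkℚ (+ suc p) d cop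
    q m : ℕ
    q = suc d
    m = 1304 * q

  -- As c is at least `1 / suc d₀`, the first summand forces `40 * m³ ≤ s`. The second forces
  -- `m ≤ n`, so that rounding `n` up to `m * b` at most doubles it.
  threshold : ℕ
  threshold = suc d₀ * (40 * (m * m * m)) + m

  close : suc p ≤ q → ∀ n s → threshold ≤ n → c ℚ.* ℕ→ℚ n ℚ.≤ ℕ→ℚ s → 5 * s ≤ n →
    (G : FourGraph n) → Stable G → MatchingNumberAtMost G s →
    ℕ→ℚ (n C 4) ℚ.- ℕ→ℚ ((n ∸ s) C 4) ℚ.- ε ℚ.* ℕ→ℚ (n ^ 4) ℚ.≤ ℕ→ℚ (edges G) →
    Close400 ε n G (H₁ n s)
  close p≤q n s n₀≤n cn≤s 5s≤n G stable ν≤s dense =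
    scaled-upper (suc p) d cop (missing G (H₁ n s) ^ 4) (400 ^ 4 * n ^ 16)
      (fourth-power-bound (missing G (H₁ n s)) (suc p) q n (s≤s z≤n) p≤q 0<n
        (missing-bound (missing G (H₁ n s)) (edges G) (count (H₁ n s)) _ ((n ∸ s) C 4) (n C 4) q (suc p) (n ^ 4) _
          (missing-edges G s m b W 0<s 5s≤n) (count-H₁ n s)
          (scaled-deficit (suc p) d cop (n C 4) ((n ∸ s) C 4) (n ^ 4) (edges G) dense)
          (surplus-bound G s m b W 0<s 5s≤n (s≤s z≤n)) (error-small m≤n) (s≤s z≤n))
        (400 ^ 4) (<ᵇ⇒< (102 ^ 4) (400 ^ 4) tt))
    where
    open Scale q n s (s≤s z≤n) using (b; n≤mb; error-small; room)
    m≤n : m ≤ n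
    m≤n = ≤-trans (m≤n+m m (suc d₀ * (40 * (m * m * m)))) n₀≤n
    0<n : 0 < n
    0<n = ≤-trans (s≤s z≤n) m≤n
    40m³≤s : 40 * (m * m * m) ≤ s
    40m³≤s = *-cancelˡ-≤ (suc d₀) (begin
      suc d₀ * (40 * (m * m * m))    ≤⟨ ≤-trans (m≤m+n _ m) n₀≤n ⟩
      n                              ≤⟨ m≤m+n n (p₀ * n) ⟩
      suc p₀ * n                     ≤⟨ scaled-lower (suc p₀) d₀ cop₀ n s cn≤s ⟩
      s * suc d₀                     ≡⟨ *-comm s (suc d₀) ⟩
      suc d₀ * s                     ∎)
      where open ≤-Reasoning
    0<s : 0 < s
    0<s = ≤-trans (s≤s z≤n) 40m³≤s
    W : Weighting G s m b
    W = weighting G s m b (exists-cover G s m b stable ν≤s 0<s (≤-trans n≤mb (m≤n+m (m * b) (2 * b)))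
      (λ y → room m≤n 5s≤n 40m³≤s {G} y))

theorem1p2 : (c : ℚ) → 0ℚ ℚ.< c → c ℚ.< (+ 1) / 5 →
    Σ ℚ (λ ε₀ → (0ℚ ℚ.< ε₀) ×
    ((ε : ℚ) → 0ℚ ℚ.< ε → ε ℚ.< ε₀ →
    Σ ℕ (λ n₀ → (n s : ℕ) → n₀ ℕ.≤ n → c ℚ.* ℕ→ℚ n ℚ.≤ ℕ→ℚ s → 5 ℕ.* s ℕ.≤ n →
    (G : FourGraph n) → Stable G → MatchingNumberAtMost G s →
    ℕ→ℚ (n C 4) ℚ.- ℕ→ℚ ((n ∸ s) C 4) ℚ.- ε ℚ.* ℕ→ℚ (n ^ 4) ℚ.≤ ℕ→ℚ (edges G) →
    Close400 ε n G (H₁ n s))))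
-- The value 1 suffices for `ε₀`, because ε < 1 gives the inequality `p ≤ q` that
-- `fourth-power-bound` asks for.
theorem1p2 (mkℚ (+ suc p₀) d₀ cop₀) _ _ = 1ℚ , ℚ.*<* (ℤ.+<+ (s≤s z≤n)) , main
  where
  main : (ε : ℚ) → 0ℚ ℚ.< ε → ε ℚ.< 1ℚ →
    Σ ℕ (λ n₀ → (n s : ℕ) → n₀ ℕ.≤ n → mkℚ (+ suc p₀) d₀ cop₀ ℚ.* ℕ→ℚ n ℚ.≤ ℕ→ℚ s → 5 ℕ.* s ℕ.≤ n →
    (G : FourGraph n) → Stable G → MatchingNumberAtMost G s →
    ℕ→ℚ (n C 4) ℚ.- ℕ→ℚ ((n ∸ s) C 4) ℚ.- ε ℚ.* ℕ→ℚ (n ^ 4) ℚ.≤ ℕ→ℚ (edges G) →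
    Close400 ε n G (H₁ n s))
  main (mkℚ (+ suc p) d cop) _ ε<1 = threshold p₀ d₀ cop₀ p d cop , close p₀ d₀ cop₀ p d cop p≤q
    where
    p≤q : suc p ≤ suc d
    p≤q = <⇒≤ (ℤ.drop‿+<+ (subst₂ ℤ._<_ (ℤ.*-identityʳ (+ suc p)) (ℤ.*-identityˡ (+ suc d)) (ℚ.drop-*<* ε<1)))
  main (mkℚ (+ zero) d cop) (ℚ.*<* (ℤ.+<+ ()))
  main (mkℚ -[1+ _ ] d cop) (ℚ.*<* ())
theorem1p2 (mkℚ (+ zero) _ _) (ℚ.*<* (ℤ.+<+ ()))
theorem1p2 (mkℚ -[1+ _ ] _ _) (ℚ.*<* ())
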